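{- There exists a planar almost hypohamiltonian graph of order $n$ whose exceptional vertex is cubic (has degree $3$) for (i) every $n = 36 + 4k$ with $k \ge 0$ an integer, and (ii) every $n \ge 73$.
   Context: Graphs are finite, simple, undirected and connected. A graph is hamiltonian if it has a cycle through all vertices. A graph $G$ is almost hypohamiltonian if $G$ is non-hamiltonian and there is a vertex $w$ (the exceptional vertex) such that $G - w$ is non-hamiltonian but $G - v$ is hamiltonian for every vertex $v \ne w$. -}

module Defs where

open import Data.Nat using (ℕ; zero; suc; _+_; _*_; _≤_; _<ᵇ_; _≤ᵇ_)
open import Data.Fin using (Fin; toℕ)
open import Data.Bool using (Bool; true; false; if_then_else_; _∧_; T)
open import Data.List using (List; []; _∷_; _++_; length; map; concatMap; allFin; upTo)
open import Data.Bool.ListAction using (and)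
open import Data.Nat.ListAction using (sum)
open import Data.List.Membership.Propositional using (_∈_)
open import Data.List.Relation.Unary.Unique.Propositional using (Unique)
open import Data.Product using (Σ; _×_; _,_; ∃-syntax)
open import Data.Sum using (_⊎_)
open import Data.Unit using (⊤)
open import Relation.Binary.PropositionalEquality using (_≡_; _≢_)
open import Relation.Nullary using (¬_)

record Graph (n : ℕ) : Set where
  field
    adj    : Fin n → Fin n → Bool
    sym    : ∀ u v → adj u v ≡ adj v u
    irrefl : ∀ v → adj v v ≡ false
open Graph public

module _ {n : ℕ} (G : Graph n) where

  Adj : Fin n → Fin n → Set
  Adj u v = T (adj G u v)

  data Walk : Fin n → Fin n → Set where
    here : ∀ v → Walk v v
    step : ∀ {u v w} → Adj u v → Walk v w → Walk u w

  Connected : Set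
  Connected = ∀ u v → Walk u v

  degree : Fin n → ℕ
  degree v = sum (map (λ u → if adj G v u then 1 else 0) (allFin n))

  Consec : List (Fin n) → Set
  Consec []            = ⊤
  Consec (x ∷ [])      = ⊤
  Consec (x ∷ y ∷ r)   = Adj x y × Consec (y ∷ r)

  record SpanningCycleOn (S : Fin n → Set) : Set where
    field
      first : Fin n
      rest  : List (Fin n)
      long  : 2 ≤ length rest
      uniq  : Unique (first ∷ rest)
      cover : ∀ v → (v ∈ (first ∷ rest) → S v) × (S v → v ∈ (first ∷ rest))
      edges : Consec (first ∷ rest ++ first ∷ [])

  Hamiltonian : Set
  Hamiltonian = SpanningCycleOn (λ _ → ⊤)

  HamiltonianMinus : Fin n → Set
  HamiltonianMinus w = SpanningCycleOn (λ v → v ≢ w)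

  AlmostHypohamiltonianWith : Fin n → Set
  AlmostHypohamiltonianWith w =
    ¬ Hamiltonian × ¬ HamiltonianMinus w × (∀ v → v ≢ w → HamiltonianMinus v)

  iter : (Fin n → Fin n) → ℕ → Fin n → Fin n
  iter f zero    x = x
  iter f (suc k) x = f (iter f k x)

  -- Planarity via combinatorial embeddings (rotation systems).
  -- rot v : cyclic ordering of the neighbours of v (successor map).
  record RotationSystem : Set where
    field
      rot    : Fin n → Fin n → Fin n
      closed : ∀ v u → Adj v u → Adj v (rot v u)
      inj    : ∀ v u u' → Adj v u → Adj v u' → rot v u ≡ rot v u' → u ≡ u'
      cyclic : ∀ v u u' → Adj v u → Adj v u' →
               ∃[ k ] (iter (rot v) k u ≡ u')
    faceStep : Fin n × Fin n → Fin n × Fin n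
    faceStep (u , v) = (v , rot v u)

  iterD : (Fin n × Fin n → Fin n × Fin n) → ℕ → Fin n × Fin n → Fin n × Fin n
  iterD f zero    x = x
  iterD f (suc k) x = f (iterD f k x)

  key : Fin n × Fin n → ℕ
  key (u , v) = toℕ u * n + toℕ v

  allPairs : List (Fin n × Fin n)
  allPairs = concatMap (λ u → map (λ v → (u , v)) (allFin n)) (allFin n)

  count : (Fin n × Fin n → Bool) → ℕ
  count p = sum (map (λ d → if p d then 1 else 0) allPairs)

  numEdges : ℕ
  numEdges = count (λ { (u , v) → adj G u v ∧ (toℕ u <ᵇ toℕ v) })

  -- number of faces = number of orbits of the face permutation on darts,
  -- counted by the darts that are key-minimal in their orbit
  -- (every orbit has length ≤ n * n, the number of pairs)
  numFaces : RotationSystem → ℕ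
  numFaces R = count (λ d → adj G (Data.Product.proj₁ d) (Data.Product.proj₂ d)
                     ∧ and (map (λ k → key d ≤ᵇ key (iterD (RotationSystem.faceStep R) k d))
                                (upTo (n * n))))

  -- Planar (for connected graphs): edgeless, or some rotation system has
  -- genus 0, i.e. satisfies Euler's formula  V - E + F = 2.
  Planar : Set
  Planar = numEdges ≡ 0 ⊎ Σ RotationSystem (λ R → n + numFaces R ≡ numEdges + 2)

{-# OPTIONS --safe #-}

-- All examples come from four plane graphs of order 36, 39, 42 and 45 whose faces are one quadrilateral abcd and
-- pentagons, with a cubic and its third neighbour w cubic as well. Grinberg's criterion modulo 3 makes such a graph,
-- and also the graph without w, non-hamiltonian; the other vertex-deleted subgraphs get explicit cycles.
-- Thomassen's operation deletes ab and cd, adds a quadrilateral a'b'c'd' inside abcd and joins corresponding corners.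
-- It adds four vertices, and it turns Hamiltonian cycles of one graph into those of the other, so that the four
-- graphs reach the order 36 + 4k for every k and every order from 42 on.

module Submission where

open import Defs renaming (sym to adj-sym)
open import Data.Bool using (Bool; T; T?; _∧_; _∨_; false; if_then_else_; not; true)
open import Data.Bool.ListAction using (all; and)
open import Data.Bool.Properties using (T-∧; T-∨; ∨-comm) renaming (_≟_ to _≟ᵇ_)
open import Data.Empty using (⊥; ⊥-elim)
open import Data.Fin using (Fin; _↑ˡ_; _≟_; suc; toℕ; zero)
open import Data.Fin.Properties using (all?; any?; combine-injective; suc-injective; toℕ-combine; toℕ-injective; toℕ<n)
open import Data.List using (List; []; [_]; _++_; _∷_; allFin; concat; concatMap; filter; filterᵇ; length; map; tabulate; upTo)
open import Data.List.Membership.Propositional using (_∈_)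
open import Data.List.Membership.Propositional.Properties
open import Data.List.Membership.Propositional.Properties.WithK using (unique∧set⇒bag)
open import Data.List.Properties using (++-assoc; ++-identityʳ; concat-map; length-++; length-filter; length-map; length-tabulate; map-++; map-tabulate)
open import Data.List.Relation.Binary.BagAndSetEquality using (∼bag⇒↭)
open import Data.List.Relation.Binary.Permutation.Propositional using (_↭_; prep; ↭-refl; ↭-reflexive; ↭-sym; ↭-trans; ↭⇒↭ₛ)
open import Data.List.Relation.Binary.Permutation.Propositional.Properties using (++-comm; ++-commutativeMonoid; ++⁺; ++⁺ʳ; ++⁺ˡ; shift; ↭-length; ∈-resp-↭; ∷↭∷ʳ) renaming (map⁺ to ↭-map⁺)
open import Data.List.Relation.Unary.All as All using (All; []; _∷_)
open import Data.List.Relation.Unary.AllPairs using ([]; _∷_)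
open import Data.List.Relation.Unary.Any using (here; there)
open import Data.List.Relation.Unary.Unique.Propositional using (Unique)
open import Data.Nat using (_*_; _+_; _<?_; _<_; _<ᵇ_; _∸_; _≡ᵇ_; _≤?_; _≤_; _≤ᵇ_; pred; suc; s≤s; zero; z≤n; ℕ) renaming (_≟_ to _≟ℕ_)
open import Data.Nat.DivMod using (_%_; _/_)
open import Data.Nat.ListAction using (sum)
open import Data.Nat.ListAction.Properties using (sum-↭)
open import Data.Nat.Properties using (*-cancelʳ-≡; *-comm; *-distribˡ-+; *-suc; *-zeroʳ; +-assoc; +-cancelʳ-≡; +-cancelʳ-≤; +-cancelˡ-≡; +-cancelˡ-≤; +-comm; +-identityʳ; +-mono-≤; +-monoʳ-≤; +-suc; 1+n≰n; <-asym; <-cmp; <-≤-trans; <ᵇ⇒<; <⇒<ᵇ; module ≤-Reasoning; m∸n+n≡m; m≤m+n; m≤n+m; n≤1+n; ≡ᵇ⇒≡; ≡⇒≡ᵇ; ≤-antisym; ≤-refl; ≤-reflexive; ≤-total; ≤-trans; ≤ᵇ⇒≤; ≤⇒≤ᵇ) renaming (suc-injective to ℕ-suc-injective)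
open import Data.Nat.Solver using (module +-*-Solver)
open import Data.Product using (_,_; _×_; proj₁; proj₂; swap; Σ; ∃-syntax)
open import Data.Product.Properties using () renaming (≡-dec to ×-≡-dec)
open import Data.Sum using (_⊎_; inj₁; inj₂) renaming (swap to ⊎-swap)
open import Data.Unit using (tt)
open import Data.Vec using (Vec; []; _∷_; lookup)
open import Function using (_∘_; id)
open import Function.Bundles using (Equivalence; mk⇔)
open import Relation.Binary using (DecidableEquality; tri<; tri>; tri≈)
open import Relation.Binary.PropositionalEquality using (_≡_; _≢_; cong; cong₂; refl; setoid; subst; subst₂; sym; trans)
open import Relation.Nullary using (Dec; _×-dec_; _→-dec_; _⊎-dec_; contradiction; does; no; yes; ¬?; ¬_)
open import Relation.Nullary.Decidable using (True; dec-false; dec-true; from-yes; toWitness)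
import Algebra.Solver.CommutativeMonoid as CMSolver
import Data.List.Membership.DecPropositional as DecMembership
import Data.List.Relation.Binary.Permutation.Setoid.Properties as ↭ₛ
import Data.List.Relation.Unary.All.Properties as Allₚ
import Data.List.Relation.Unary.Unique.DecPropositional as DecUnique
import Data.List.Relation.Unary.Unique.Propositional.Properties as Uniqueₚ

-- Lists and cyclic lists

-- The modulus 3 comes from the pentagon: in Grinberg's formula a face of length l counts l - 2. For
-- p pentagons and one quadrilateral Euler's formula gives the order n = 3 + 3p/2, and p is even
-- because the face lengths add up to an even number; hence 3 divides n. A side of k pentagons alone
-- would need 3k = n - 2. In G - w the vertex a has degree two, so ab lies on the cycle and parts
-- abcd from the face left by w; the side of abcd would need 2 + 3k = n - 3. Four consecutive
-- multiples of 3 meet all residues modulo 4.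
--
-- The two sides of a cycle are obtained without topology: a count of trees in the dual graph
-- replaces the Jordan curve theorem.
--
-- After one operation the faces are no longer pentagons, so non-hamiltonicity has to travel by
-- contraction of cycles. The recursion carries H, which is G without ab and cd, so that nothing is
-- ever deleted: the operation and the return to G only draw edges into a face. Cycles are kept as
-- paths of H between corners. Those that miss a corner use a prescribed edge, because they supply
-- the cycles that miss the new corners.

module _ {A : Set} where

  Unique-resp-↭ : {xs ys : List A} → xs ↭ ys → Unique xs → Unique ys
  Unique-resp-↭ p = ↭ₛ.Unique-resp-↭ (setoid A) (↭⇒↭ₛ p)

  unique-↭ : {xs ys : List A} → Unique xs → Unique ys →
             (∀ {z} → z ∈ xs → z ∈ ys) → (∀ {z} → z ∈ ys → z ∈ xs) → xs ↭ ys
  unique-↭ u v f g = ∼bag⇒↭ (unique∧set⇒bag u v (mk⇔ f g))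

  -- With `z` the first entry, these are the arcs of a cycle, the closing one included; with another
  -- `z` they are the arcs of a path that runs on to `z`. Cycles of a graph and orbits of a map
  -- share this encoding.
  links : List A → A → List (A × A)
  links []           z = []
  links (x ∷ [])     z = (x , z) ∷ []
  links (x ∷ y ∷ xs) z = (x , y) ∷ links (y ∷ xs) z

  links-fst : ∀ xs z → map proj₁ (links xs z) ≡ xs
  links-fst []           z = refl
  links-fst (x ∷ [])     z = refl
  links-fst (x ∷ y ∷ xs) z = cong (x ∷_) (links-fst (y ∷ xs) z)

  links-snd : ∀ x xs z → map proj₂ (links (x ∷ xs) z) ≡ xs ++ [ z ]
  links-snd x []       z = refl
  links-snd x (y ∷ xs) z = cong (y ∷_) (links-snd y xs z)

  links-∈ : ∀ xs z {u v} → (u , v) ∈ links xs z → u ∈ xs × (v ∈ xs ⊎ v ≡ z)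
  links-∈ (x ∷ [])     z (here refl) = here refl , inj₂ refl
  links-∈ (x ∷ y ∷ xs) z (here refl) = here refl , inj₁ (there (here refl))
  links-∈ (x ∷ y ∷ xs) z (there m) with links-∈ (y ∷ xs) z m
  ... | u∈ , inj₁ v∈ = there u∈ , inj₁ (there v∈)
  ... | u∈ , inj₂ eq = there u∈ , inj₂ eq

  links-next : ∀ xs z {u} → u ∈ xs → ∃[ v ] (u , v) ∈ links xs z
  links-next (x ∷ [])     z (here refl) = z , here refl
  links-next (x ∷ y ∷ xs) z (here refl) = y , here refl
  links-next (x ∷ y ∷ xs) z (there m) with links-next (y ∷ xs) z m
  ... | v , q = v , there q

  links-prev : ∀ x xs z {v} → v ∈ xs ++ [ z ] → ∃[ u ] (u , v) ∈ links (x ∷ xs) z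
  links-prev x []       z (here refl) = x , here refl
  links-prev x (y ∷ xs) z (here refl) = x , here refl
  links-prev x (y ∷ xs) z (there m) with links-prev y xs z m
  ... | u , q = u , there q

  links-++ : ∀ xs y ys z → links (xs ++ y ∷ ys) z ≡ links xs y ++ links (y ∷ ys) z
  links-++ []           y ys z = refl
  links-++ (x ∷ [])     y ys z = refl
  links-++ (x ∷ w ∷ xs) y ys z = cong ((x , w) ∷_) (links-++ (w ∷ xs) y ys z)

  unique-fst : ∀ {B : Set} {ps : List (A × B)} → Unique (map proj₁ ps) →
               ∀ {x y y'} → (x , y) ∈ ps → (x , y') ∈ ps → y ≡ y'
  unique-fst (_ ∷ u)  (here refl) (here refl) = refl
  unique-fst (x∉ ∷ u) (here refl) (there q)   = contradiction refl (All.lookup x∉ (∈-map⁺ proj₁ q))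
  unique-fst (x∉ ∷ u) (there p)   (here refl) = contradiction refl (All.lookup x∉ (∈-map⁺ proj₁ p))
  unique-fst (_ ∷ u)  (there p)   (there q)   = unique-fst u p q

  unique-snd : ∀ {B : Set} {ps : List (B × A)} → Unique (map proj₂ ps) →
               ∀ {x x' y} → (x , y) ∈ ps → (x' , y) ∈ ps → x ≡ x'
  unique-snd (_ ∷ u)  (here refl) (here refl) = refl
  unique-snd (x∉ ∷ u) (here refl) (there q)   = contradiction refl (All.lookup x∉ (∈-map⁺ proj₂ q))
  unique-snd (x∉ ∷ u) (there p)   (here refl) = contradiction refl (All.lookup x∉ (∈-map⁺ proj₂ p))
  unique-snd (_ ∷ u)  (there p)   (there q)   = unique-snd u p q

module ConsecProperties {n : ℕ} (G : Graph n) where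

  links⁻ : ∀ xs z → Consec G (xs ++ [ z ]) → ∀ {u v} → (u , v) ∈ links xs z → Adj G u v
  links⁻ (x ∷ [])     z (e , _) (here refl) = e
  links⁻ (x ∷ y ∷ xs) z (e , _) (here refl) = e
  links⁻ (x ∷ y ∷ xs) z (_ , c) (there m)   = links⁻ (y ∷ xs) z c m

  links⁺ : ∀ xs z → (∀ {u v} → (u , v) ∈ links xs z → Adj G u v) → Consec G (xs ++ [ z ])
  links⁺ []           z f = tt
  links⁺ (x ∷ [])     z f = f (here refl) , tt
  links⁺ (x ∷ y ∷ xs) z f = f (here refl) , links⁺ (y ∷ xs) z (f ∘ there)

module Cycle {A : Set} (first : A) (rest : List A) (long : 2 ≤ length rest)
             (uniq : Unique (first ∷ rest)) where

  verts : List A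
  verts = first ∷ rest

  arcs : List (A × A)
  arcs = links verts first

  Next : A → A → Set
  Next u v = (u , v) ∈ arcs

  next : ∀ {u} → u ∈ verts → ∃[ v ] Next u v
  next = links-next verts first

  rotated : rest ++ [ first ] ↭ verts
  rotated = ↭-sym (∷↭∷ʳ first rest)

  prev : ∀ {v} → v ∈ verts → ∃[ u ] Next u v
  prev v∈ = links-prev first rest first (∈-resp-↭ (↭-sym rotated) v∈)

  next-src : ∀ {u v} → Next u v → u ∈ verts
  next-src m = proj₁ (links-∈ verts first m)

  next-functional : ∀ {u v v'} → Next u v → Next u v' → v ≡ v'
  next-functional = unique-fst (subst Unique (sym (links-fst verts first)) uniq)

  snd-unique : Unique (map proj₂ arcs)
  snd-unique = subst Unique (sym (links-snd first rest first)) (Unique-resp-↭ (↭-sym rotated) uniq)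

  next-injective : ∀ {u u' v} → Next u v → Next u' v → u ≡ u'
  next-injective = unique-snd snd-unique

  private
    forwardFrom : (P : A → Set) → ∀ xs → (∀ {u v} → (u , v) ∈ links xs first → P u → P v) →
                  ∀ {x} {ys} → xs ≡ x ∷ ys → P x → ∀ {y} → y ∈ xs → P y
    forwardFrom P (x ∷ [])     f refl px (here refl) = px
    forwardFrom P (x ∷ y ∷ ys) f refl px (here refl) = px
    forwardFrom P (x ∷ y ∷ ys) f refl px (there m) =
      forwardFrom P (y ∷ ys) (f ∘ there) refl (f (here refl) px) m

    backwardFrom : (P : A → Set) → ∀ xs → (∀ {u v} → (u , v) ∈ links xs first → P v → P u) →
                   ∀ {x} {ys} → xs ≡ x ∷ ys → ∀ {y} → y ∈ xs → P y → P x
    backwardFrom P (x ∷ [])     f refl (here refl) py = py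
    backwardFrom P (x ∷ y ∷ ys) f refl (here refl) py = py
    backwardFrom P (x ∷ y ∷ ys) f refl (there m) py =
      f (here refl) (backwardFrom P (y ∷ ys) (f ∘ there) refl m py)

  forward : (P : A → Set) → (∀ {u v} → Next u v → P u → P v) → P first → ∀ {y} → y ∈ verts → P y
  forward P f p = forwardFrom P verts f refl p

  backward : (P : A → Set) → (∀ {u v} → Next u v → P v → P u) → ∀ {y} → y ∈ verts → P y → P first
  backward P f = backwardFrom P verts f refl

  -- The set of `x` and `y` would be closed under successors and predecessors, so it would contain
  -- every vertex of the cycle, and there are at least three.
  no-2-cycle : ∀ {x y} → Next x y → Next y x → ⊥
  no-2-cycle {x} {y} xy yx = three long uniq allxy
    where
    P : A → Set
    P z = z ≡ x ⊎ z ≡ y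
    fw : ∀ {u v} → Next u v → P u → P v
    fw uv (inj₁ refl) = inj₂ (next-functional uv xy)
    fw uv (inj₂ refl) = inj₁ (next-functional uv yx)
    bw : ∀ {u v} → Next u v → P v → P u
    bw uv (inj₁ refl) = inj₂ (next-injective uv yx)
    bw uv (inj₂ refl) = inj₁ (next-injective uv xy)
    allxy : ∀ {z} → z ∈ verts → P z
    allxy = forward P fw (backward P bw (next-src xy) (inj₁ refl))
    three : ∀ {c r} → 2 ≤ length r → Unique (c ∷ r) → (∀ {z} → z ∈ c ∷ r → P z) → ⊥
    three {c} {d ∷ e ∷ _} _ ((c≢d ∷ c≢e ∷ _) ∷ (d≢e ∷ _) ∷ _) f
      with f (here refl) | f (there (here refl)) | f (there (there (here refl)))
    ... | inj₁ refl | inj₁ refl | _         = c≢d refl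
    ... | inj₁ refl | inj₂ refl | inj₁ refl = c≢e refl
    ... | inj₁ refl | inj₂ refl | inj₂ refl = d≢e refl
    ... | inj₂ refl | inj₂ refl | _         = c≢d refl
    ... | inj₂ refl | inj₁ refl | inj₁ refl = d≢e refl
    ... | inj₂ refl | inj₁ refl | inj₂ refl = c≢e refl
    three {r = []}    () _ _
    three {r = _ ∷ []} (s≤s ()) _ _

  arcs-unique : Unique arcs
  arcs-unique = Uniqueₚ.map⁻ {f = proj₁} (subst Unique (sym (links-fst verts first)) uniq)

  arcs-length : length arcs ≡ length verts
  arcs-length = trans (sym (length-map proj₁ arcs)) (cong length (links-fst verts first))

-- Counting

module _ {A : Set} where

  total : (A → ℕ) → List A → ℕ
  total f xs = sum (map f xs)

  total-↭ : ∀ f {xs ys} → xs ↭ ys → total f xs ≡ total f ys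
  total-↭ f p = sum-↭ (↭-map⁺ f p)

  total-++ : ∀ f xs ys → total f (xs ++ ys) ≡ total f xs + total f ys
  total-++ f []       ys = refl
  total-++ f (x ∷ xs) ys = trans (cong (f x +_) (total-++ f xs ys)) (sym (+-assoc (f x) _ _))

  total-cong : ∀ {f g} xs → (∀ {x} → x ∈ xs → f x ≡ g x) → total f xs ≡ total g xs
  total-cong []       h = refl
  total-cong (x ∷ xs) h = cong₂ _+_ (h (here refl)) (total-cong xs (h ∘ there))

  total-const : ∀ {f} c xs → (∀ {x} → x ∈ xs → f x ≡ c) → total f xs ≡ length xs * c
  total-const c []       h = refl
  total-const c (x ∷ xs) h = cong₂ _+_ (h (here refl)) (total-const c xs (h ∘ there))

  total-1 : ∀ {f} xs → (∀ {x} → x ∈ xs → f x ≡ 1) → total f xs ≡ length xs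
  total-1 []       h = refl
  total-1 (x ∷ xs) h = cong₂ _+_ (h (here refl)) (total-1 xs (h ∘ there))

  total-0 : ∀ {f} xs → (∀ {x} → x ∈ xs → f x ≡ 0) → total f xs ≡ 0
  total-0 []       h = refl
  total-0 (x ∷ xs) h = cong₂ _+_ (h (here refl)) (total-0 xs (h ∘ there))

  total-+ : ∀ f g xs → total (λ x → f x + g x) xs ≡ total f xs + total g xs
  total-+ f g []       = refl
  total-+ f g (x ∷ xs) rewrite total-+ f g xs =
    solve 4 (λ a b c d → (a :+ b) :+ (c :+ d) := (a :+ c) :+ (b :+ d)) refl (f x) (g x) (total f xs) (total g xs)
    where open +-*-Solver using (solve; _:+_; _:*_; _:=_; con)

total-map : ∀ {A B : Set} (f : B → ℕ) (g : A → B) xs → total f (map g xs) ≡ total (f ∘ g) xs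
total-map f g []       = refl
total-map f g (x ∷ xs) = cong (f (g x) +_) (total-map f g xs)

total-concat : ∀ {A : Set} (f : A → ℕ) xss → total f (concat xss) ≡ total (total f) xss
total-concat f []         = refl
total-concat f (xs ∷ xss) = trans (total-++ f xs (concat xss)) (cong (total f xs +_) (total-concat f xss))

⟦_⟧ : {P : Set} → Dec P → ℕ
⟦ p ⟧ = if does p then 1 else 0

⟦⟧-yes : {P : Set} (d : Dec P) → P → ⟦ d ⟧ ≡ 1
⟦⟧-yes d p rewrite dec-true d p = refl

⟦⟧-no : {P : Set} (d : Dec P) → ¬ P → ⟦ d ⟧ ≡ 0
⟦⟧-no d p rewrite dec-false d p = refl

module _ {A : Set} (_≟ᴬ_ : DecidableEquality A) where

  -- A connected graph with t edges has at most t + 1 vertices, for all components at once: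
  -- r sends every point to a representative of its component under the given edges.
  components : (univ : List A) → Unique univ → (es : List (A × A)) →
    Σ (A → A) λ r → (∀ {x y} → (x , y) ∈ es → r x ≡ r y) ×
      (∀ κ → total (λ x → ⟦ r x ≟ᴬ κ ⟧) univ ≤ 1 + total (λ e → ⟦ r (proj₁ e) ≟ᴬ κ ⟧) es)
  components univ uniq [] = id , (λ ()) , λ κ → atMostOne κ univ uniq
    where
    atMostOne : ∀ κ xs → Unique xs → total (λ x → ⟦ x ≟ᴬ κ ⟧) xs ≤ 1
    atMostOne κ [] _ = z≤n
    atMostOne κ (x ∷ xs) (x∉ ∷ u) with x ≟ᴬ κ
    ... | yes refl = ≤-reflexive (cong suc (total-0 xs λ {y} y∈ →
                       ⟦⟧-no (y ≟ᴬ x) λ { refl → contradiction refl (All.lookup x∉ y∈) }))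
    ... | no _ = atMostOne κ xs u
  components univ uniq ((f , g) ∷ es) with components univ uniq es
  ... | r , glue , bound with r f ≟ᴬ r g
  ... | yes eq = r , (λ { (here refl) → eq ; (there m) → glue m }) ,
                 λ κ → ≤-trans (bound κ) (s≤s (m≤n+m _ _))
  ... | no rf≢rg = r' , glue' , bound'
    where
    -- The new edge merges two classes: the representative of `f` is redirected to that of `g`.
    r' : A → A
    r' x = if does (r x ≟ᴬ r f) then r g else r x

    r'f : ∀ {x} → r x ≡ r f → r' x ≡ r g
    r'f {x} eq rewrite dec-true (r x ≟ᴬ r f) eq = refl

    r'≢ : ∀ {x} → r x ≢ r f → r' x ≡ r x
    r'≢ {x} neq rewrite dec-false (r x ≟ᴬ r f) neq = refl

    glue' : ∀ {x y} → (x , y) ∈ (f , g) ∷ es → r' x ≡ r' y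
    glue' (here refl) = trans (r'f refl) (sym (r'≢ (rf≢rg ∘ sym)))
    glue' (there m)   = cong (λ z → if does (z ≟ᴬ r f) then r g else z) (glue m)

    split : ∀ x → ⟦ r' x ≟ᴬ r g ⟧ ≡ ⟦ r x ≟ᴬ r f ⟧ + ⟦ r x ≟ᴬ r g ⟧
    split x with r x ≟ᴬ r f
    ... | yes eq = trans (⟦⟧-yes (r g ≟ᴬ r g) refl)
                         (cong suc (sym (⟦⟧-no (r x ≟ᴬ r g) λ e → rf≢rg (trans (sym eq) e))))
    ... | no _ = refl

    empty : ∀ x → ⟦ r' x ≟ᴬ r f ⟧ ≡ 0
    empty x with r x ≟ᴬ r f
    ... | yes eq = ⟦⟧-no (r g ≟ᴬ r f) (rf≢rg ∘ sym)
    ... | no neq = ⟦⟧-no (r x ≟ᴬ r f) neq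

    same : ∀ κ → κ ≢ r f → κ ≢ r g → ∀ x → ⟦ r' x ≟ᴬ κ ⟧ ≡ ⟦ r x ≟ᴬ κ ⟧
    same κ κf κg x with r x ≟ᴬ r f
    ... | yes eq = trans (⟦⟧-no (r g ≟ᴬ κ) (κg ∘ sym)) (sym (⟦⟧-no (r x ≟ᴬ κ) λ e → κf (trans (sym e) eq)))
    ... | no neq = refl

    open ≤-Reasoning

    bound' : ∀ κ → total (λ x → ⟦ r' x ≟ᴬ κ ⟧) univ ≤
                   1 + (⟦ r' f ≟ᴬ κ ⟧ + total (λ e → ⟦ r' (proj₁ e) ≟ᴬ κ ⟧) es)
    bound' κ with κ ≟ᴬ r g
    -- The two parts of the merged class have the bounds 1 + F and 1 + G; the new edge pays for the
    -- surplus 1.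
    ... | yes refl = begin
      total (λ x → ⟦ r' x ≟ᴬ r g ⟧) univ
        ≡⟨ total-cong univ (λ {x} _ → split x) ⟩
      total (λ x → ⟦ r x ≟ᴬ r f ⟧ + ⟦ r x ≟ᴬ r g ⟧) univ
        ≡⟨ total-+ _ _ univ ⟩
      total (λ x → ⟦ r x ≟ᴬ r f ⟧) univ + total (λ x → ⟦ r x ≟ᴬ r g ⟧) univ
        ≤⟨ +-mono-≤ (bound (r f)) (bound (r g)) ⟩
      (1 + F) + (1 + G)
        ≡⟨ solve 2 (λ a b → (con 1 :+ a) :+ (con 1 :+ b) := con 1 :+ (con 1 :+ (a :+ b))) refl F G ⟩
      1 + (1 + (F + G))
        ≡⟨ cong suc (cong₂ _+_ (sym (⟦⟧-yes (r' f ≟ᴬ r g) (r'f refl)))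
             (sym (trans (total-cong es (λ {e} _ → split (proj₁ e))) (total-+ _ _ es)))) ⟩
      1 + (⟦ r' f ≟ᴬ r g ⟧ + total (λ e → ⟦ r' (proj₁ e) ≟ᴬ r g ⟧) es) ∎
      where
      open +-*-Solver using (solve; _:+_; _:*_; _:=_; con)
      F = total (λ e → ⟦ r (proj₁ e) ≟ᴬ r f ⟧) es
      G = total (λ e → ⟦ r (proj₁ e) ≟ᴬ r g ⟧) es
    ... | no κg with κ ≟ᴬ r f
    ... | yes refl = ≤-trans (≤-reflexive (total-0 univ (λ {x} _ → empty x))) z≤n
    ... | no κf = begin
      total (λ x → ⟦ r' x ≟ᴬ κ ⟧) univ                ≡⟨ total-cong univ (λ {x} _ → same κ κf κg x) ⟩
      total (λ x → ⟦ r x ≟ᴬ κ ⟧) univ                 ≤⟨ bound κ ⟩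
      1 + total (λ e → ⟦ r (proj₁ e) ≟ᴬ κ ⟧) es       ≡⟨ cong suc (sym (total-cong es (λ {e} _ → same κ κf κg (proj₁ e)))) ⟩
      1 + total (λ e → ⟦ r' (proj₁ e) ≟ᴬ κ ⟧) es      ≤⟨ s≤s (m≤n+m _ _) ⟩
      1 + (⟦ r' f ≟ᴬ κ ⟧ + total (λ e → ⟦ r' (proj₁ e) ≟ᴬ κ ⟧) es) ∎

-- Darts, faces and embeddings

Dart : ℕ → Set
Dart n = Fin n × Fin n

_≟ᴰ_ : ∀ {n} → DecidableEquality (Dart n)
_≟ᴰ_ = ×-≡-dec _≟_ _≟_

-- The empty list is excluded because every listed face counts in Euler's formula.
Orbit : {A : Set} → (A → A) → List A → Set
Orbit f []       = ⊥
Orbit f (x ∷ xs) = All (λ e → f (proj₁ e) ≡ proj₂ e) (links (x ∷ xs) x)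

orbit-step : ∀ {A : Set} {f : A → A} xs → Orbit f xs → ∀ {d} → d ∈ xs → f d ∈ xs
orbit-step {f = f} (x ∷ xs) o d∈ with links-next (x ∷ xs) x d∈
... | d' , m with links-∈ (x ∷ xs) x m
... | _ , inj₁ d'∈ = subst (_∈ x ∷ xs) (sym (All.lookup o m)) d'∈
... | _ , inj₂ refl = subst (_∈ x ∷ xs) (sym (All.lookup o m)) (here refl)

-- m stands for the number of vertices in Euler's formula, so that isolated vertices may be ignored.
record Embedding {n : ℕ} (m : ℕ) (G : Graph n) (faces : List (List (Dart n))) : Set where
  field
    rotation : RotationSystem G
    orbits   : All (Orbit (RotationSystem.faceStep rotation)) faces
    unique   : Unique (concat faces)
    sound    : ∀ {u v} → (u , v) ∈ concat faces → Adj G u v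
    complete : ∀ {u v} → Adj G u v → (u , v) ∈ concat faces
    -- Euler's formula is doubled, since the faces list both darts of each edge, and written without
    -- subtraction.
    euler    : (m + length faces) * 2 ≡ length (concat faces) + 4

-- In contrast to `links` there is no closing pair. A face of length l thus gets l - 1 joins, a
-- spanning tree of its darts.
chain : {A : Set} → List A → List (A × A)
chain []           = []
chain (x ∷ [])     = []
chain (x ∷ y ∷ xs) = (x , y) ∷ chain (y ∷ xs)

chain-const : ∀ {A B : Set} (r : A → B) x xs → (∀ {u v} → (u , v) ∈ chain (x ∷ xs) → r u ≡ r v) →
              ∀ {y} → y ∈ x ∷ xs → r y ≡ r x
chain-const r x xs h (here refl) = refl
chain-const r x (y ∷ xs) h (there m) =
  trans (chain-const r y xs (h ∘ there) m) (sym (h (here refl)))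

chain-fst : ∀ {A : Set} x (xs : List A) {u v} → (u , v) ∈ chain (x ∷ xs) → u ∈ x ∷ xs
chain-fst x (y ∷ xs) (here refl) = here refl
chain-fst x (y ∷ xs) (there m)   = there (chain-fst y xs m)

chain-length : ∀ {A : Set} (x : A) xs → length (chain (x ∷ xs)) ≡ length xs
chain-length x []       = refl
chain-length x (y ∷ xs) = cong suc (chain-length y xs)

faceSide : {A : Set} → (A → Bool) → List A → Bool
faceSide f []      = false
faceSide f (x ∷ _) = f x

swap-∈ : ∀ {A : Set} {xs : List (A × A)} {u v} → (u , v) ∈ map swap xs → (v , u) ∈ xs
swap-∈ m with ∈-map⁻ swap m
... | _ , m' , refl = m'

swap-unique : ∀ {A : Set} {xs : List (A × A)} → Unique xs → Unique (map swap xs)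
swap-unique = Uniqueₚ.map⁺ (λ { {_ , _} {_ , _} refl → refl })

total-swap : ∀ {A : Set} (f : A × A → ℕ) xs → (∀ {u v} → (u , v) ∈ xs → f (u , v) ≡ f (v , u)) →
             total f (map swap xs) ≡ total f xs
total-swap f xs h = trans (total-map f swap xs) (total-cong xs (sym ∘ h))

-- Grinberg's criterion. Joining the darts of each face, and the two darts of each edge off the cycle,
-- leaves by Euler's formula exactly two components, the two sides of the cycle, and each of them
-- is a tree of faces.
module Grinberg {n m : ℕ} {G : Graph n} {faces : List (List (Dart n))} (emb : Embedding m G faces)
  (first : Fin n) (rest : List (Fin n)) (long : 2 ≤ length rest) (uniq : Unique (first ∷ rest))
  (edges : Consec G (first ∷ rest ++ first ∷ []))
  (spans : ∀ {u v} → Adj G u v → u ∈ first ∷ rest)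
  (m≡ : m ≡ length (first ∷ rest)) where

  open Embedding emb
  open RotationSystem rotation
  open Cycle first rest long uniq public
  open DecMembership (_≟ᴰ_ {n}) using (_∈?_)
  open +-*-Solver using (solve; _:+_; _:*_; _:=_; con)

  darts : List (Dart n)
  darts = concat faces

  next-adj : ∀ {u v} → Next u v → Adj G u v
  next-adj = ConsecProperties.links⁻ G verts first edges

  flip : ∀ {u v} → Adj G u v → Adj G v u
  flip {u} {v} = subst T (adj-sym G u v)

  OnCycle : Dart n → Set
  OnCycle d = d ∈ arcs ⊎ swap d ∈ arcs

  onCycle? : ∀ d → Dec (OnCycle d)
  onCycle? d = (d ∈? arcs) ⊎-dec (swap d ∈? arcs)

  -- The comparison picks one of the two darts of each edge off the cycle, so that `chords` counts
  -- edges.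
  Chord : Dart n → Set
  Chord d = ¬ OnCycle d × toℕ (proj₁ d) < toℕ (proj₂ d)

  chord? : ∀ d → Dec (Chord d)
  chord? d = ¬? (onCycle? d) ×-dec (toℕ (proj₁ d) <? toℕ (proj₂ d))

  chords : List (Dart n)
  chords = filter chord? darts

  chord-∈ : ∀ {d} → d ∈ darts → Chord d → d ∈ chords
  chord-∈ = ∈-filter⁺ chord?

  chord-∈⁻ : ∀ {d} → d ∈ chords → d ∈ darts × Chord d
  chord-∈⁻ = ∈-filter⁻ chord?

  adj-≢ : ∀ {u v} → Adj G u v → toℕ u ≢ toℕ v
  adj-≢ {u} uv eq with toℕ-injective eq
  ... | refl with () ← subst T (irrefl G u) uv

  -- Every edge lies on the cycle or is a chord, and contributes its two darts. The arcs are
  -- disjoint from their reverses by `no-2-cycle`, and the chords from theirs by the order of the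
  -- ends.
  darts-↭ : darts ↭ (arcs ++ map swap arcs) ++ (chords ++ map swap chords)
  darts-↭ = unique-↭ unique
      (Uniqueₚ.++⁺ (Uniqueₚ.++⁺ arcs-unique (swap-unique arcs-unique) disj₁)
                   (Uniqueₚ.++⁺ chords-unique (swap-unique chords-unique) disj₂) disj₃)
      to from
    where
    chords-unique : Unique chords
    chords-unique = Uniqueₚ.filter⁺ chord? unique
    disj₁ : ∀ {d} → ¬ (d ∈ arcs × d ∈ map swap arcs)
    disj₁ (a , b) = no-2-cycle a (swap-∈ b)
    disj₂ : ∀ {d} → ¬ (d ∈ chords × d ∈ map swap chords)
    disj₂ (a , b) = <-asym (proj₂ (proj₂ (chord-∈⁻ a))) (proj₂ (proj₂ (chord-∈⁻ (swap-∈ b))))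
    arcs⁻ : ∀ {d} → d ∈ arcs ++ map swap arcs → OnCycle d
    arcs⁻ m with ∈-++⁻ arcs m
    ... | inj₁ a = inj₁ a
    ... | inj₂ b = inj₂ (swap-∈ b)
    swapCycle : ∀ {u v} → OnCycle (u , v) → OnCycle (v , u)
    swapCycle (inj₁ a) = inj₂ a
    swapCycle (inj₂ a) = inj₁ a
    disj₃ : ∀ {d} → ¬ (d ∈ arcs ++ map swap arcs × d ∈ chords ++ map swap chords)
    disj₃ (a , b) with ∈-++⁻ chords b
    ... | inj₁ c = proj₁ (proj₂ (chord-∈⁻ c)) (arcs⁻ a)
    ... | inj₂ c = proj₁ (proj₂ (chord-∈⁻ (swap-∈ c))) (swapCycle (arcs⁻ a))
    to : ∀ {d} → d ∈ darts → d ∈ (arcs ++ map swap arcs) ++ (chords ++ map swap chords)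
    to {u , v} d∈ with onCycle? (u , v)
    ... | yes (inj₁ a) = ∈-++⁺ˡ (∈-++⁺ˡ a)
    ... | yes (inj₂ a) = ∈-++⁺ˡ (∈-++⁺ʳ arcs (∈-map⁺ swap a))
    ... | no ¬c with <-cmp (toℕ u) (toℕ v)
    ...   | tri< lt _ _ = ∈-++⁺ʳ (arcs ++ map swap arcs) (∈-++⁺ˡ (chord-∈ d∈ (¬c , lt)))
    ...   | tri≈ _ eq _ = contradiction eq (adj-≢ (sound d∈))
    ...   | tri> _ _ gt = ∈-++⁺ʳ (arcs ++ map swap arcs) (∈-++⁺ʳ chords
                            (∈-map⁺ swap (chord-∈ (complete (flip (sound d∈))) (¬c ∘ swapCycle , gt))))
    from : ∀ {d} → d ∈ (arcs ++ map swap arcs) ++ (chords ++ map swap chords) → d ∈ darts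
    from {d} m with ∈-++⁻ (arcs ++ map swap arcs) m
    ... | inj₁ a with arcs⁻ a
    ...   | inj₁ a' = complete (next-adj a')
    ...   | inj₂ a' = complete (flip (next-adj a'))
    from {d} m | inj₂ b with ∈-++⁻ chords b
    ...   | inj₁ c = proj₁ (chord-∈⁻ c)
    ...   | inj₂ c = complete (flip (sound (proj₁ (chord-∈⁻ (swap-∈ c)))))

  joins : List (Dart n × Dart n)
  joins = concat (map chain faces) ++ map (λ d → d , swap d) chords

  private
    comp = components (_≟ᴰ_ {n}) darts unique joins

  r : Dart n → Dart n
  r = proj₁ comp

  r-face : ∀ {X d d'} → X ∈ faces → d ∈ X → d' ∈ X → r d ≡ r d'
  r-face {x ∷ xs} X∈ d∈ d'∈ = trans (const d∈) (sym (const d'∈))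
    where
    const = chain-const r x xs λ m → proj₁ (proj₂ comp)
              (∈-++⁺ˡ (∈-concat⁺′ m (∈-map⁺ chain X∈)))

  r-step : ∀ {u v} → Adj G u v → r (v , rot v u) ≡ r (u , v)
  r-step uv with ∈-concat⁻′ faces (complete uv)
  ... | X , d∈ , X∈ = r-face X∈ (orbit-step X (All.lookup orbits X∈) d∈) d∈

  r-chord : ∀ {u v} → Adj G u v → ¬ OnCycle (u , v) → r (u , v) ≡ r (v , u)
  r-chord {u} {v} uv ¬c with <-cmp (toℕ u) (toℕ v)
  ... | tri< lt _ _ = proj₁ (proj₂ comp) (∈-++⁺ʳ (concat (map chain faces))
                        (∈-map⁺ (λ d → d , swap d) (chord-∈ (complete uv) (¬c , lt))))
  ... | tri≈ _ eq _ = contradiction eq (adj-≢ uv)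
  ... | tri> _ _ gt = sym (proj₁ (proj₂ comp) (∈-++⁺ʳ (concat (map chain faces))
                        (∈-map⁺ (λ d → d , swap d) (chord-∈ (complete (flip uv))
                          ((λ { (inj₁ a) → ¬c (inj₂ a) ; (inj₂ a) → ¬c (inj₁ a) }) , gt)))))

  iter-adj : ∀ {v x} k → Adj G v x → Adj G v (iter G (rot v) k x)
  iter-adj zero    a = a
  iter-adj (suc k) a = closed _ _ (iter-adj k a)

  -- Turning about `v` from `a` to `b` meets only chords in between. Both darts of a chord have the
  -- same class, and a face step leads from the incoming dart of one spoke to the outgoing dart of
  -- the next.
  across : ∀ {v a b} → Adj G v a → Adj G v b → (∀ {x} → OnCycle (v , x) → x ≡ a ⊎ x ≡ b) →
           r (a , v) ≡ r (v , b)
  across {v} {a} {b} va vb only with cyclic v (rot v a) b (closed v a va) vb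
  ... | k , eq with go k
    where
    go : ∀ k → r (v , b) ≡ r (a , v) ⊎ r (v , iter G (rot v) k (rot v a)) ≡ r (a , v)
    go zero = inj₂ (r-step (flip va))
    go (suc k) with go k
    ... | inj₁ h = inj₁ h
    ... | inj₂ h with onCycle? (v , iter G (rot v) k (rot v a))
    ...   | no ¬c = let x∼ = iter-adj k (closed v a va) in
                    inj₂ (trans (r-step (flip x∼)) (trans (sym (r-chord x∼ ¬c)) h))
    ...   | yes c with only c
    -- If the turn has come round to `a`, it starts over from the face step of (a , v).
    ...     | inj₁ x≡a rewrite x≡a = inj₂ (r-step (flip va))
    ...     | inj₂ x≡b rewrite x≡b = inj₁ h
  ... | inj₁ h = sym h
  ... | inj₂ h = trans (sym h) (cong (λ x → r (v , x)) eq)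

  onCycle-at : ∀ {p v s} → Next p v → Next v s → ∀ {x} → OnCycle (v , x) → x ≡ s ⊎ x ≡ p
  onCycle-at pv vs (inj₁ a) = inj₁ (next-functional a vs)
  onCycle-at pv vs (inj₂ a) = inj₂ (next-injective a pv)

  -- The turn about `v` from `p` to `s` sweeps one side of the cycle, and the turn from `s` to `p`,
  -- used in `behind`, sweeps the other. Chained around the cycle they show that each side has a
  -- single class.
  ahead : ∀ {p v s} → Next p v → Next v s → r (p , v) ≡ r (v , s)
  ahead pv vs = across (flip (next-adj pv)) (next-adj vs) (⊎-swap ∘ onCycle-at pv vs)

  behind : ∀ {p v s} → Next p v → Next v s → r (s , v) ≡ r (v , p)
  behind pv vs = across (next-adj vs) (flip (next-adj pv)) (onCycle-at pv vs)

  second : Fin n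
  second = proj₁ (next (here refl))

  first-second : Next first second
  first-second = proj₂ (next (here refl))

  κᴸ κᴿ : Dart n
  κᴸ = r (first , second)
  κᴿ = r (second , first)

  r-arc : ∀ {u v} → Next u v → r (u , v) ≡ κᴸ × r (v , u) ≡ κᴿ
  r-arc uv = forward P onward start (next-src uv) uv
    where
    P : Fin n → Set
    P u = ∀ {v} → Next u v → r (u , v) ≡ κᴸ × r (v , u) ≡ κᴿ
    start : P first
    start m with next-functional m first-second
    ... | refl = refl , refl
    onward : ∀ {u v} → Next u v → P u → P v
    onward uv pu vs = trans (sym (ahead uv vs)) (proj₁ (pu uv)) , trans (behind uv vs) (proj₂ (pu uv))

  -- The vertex at which the dart starts lies on the cycle. In the turn about it the class can
  -- change only when a cycle edge is crossed, and the classes on both sides of such an edge are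
  -- known from `r-arc`.
  r-dart : ∀ {u v} → Adj G u v → r (u , v) ≡ κᴸ ⊎ r (u , v) ≡ κᴿ
  r-dart {v} {x} vx with next (spans vx) | prev (spans vx)
  ... | s , vs | p , pv with cyclic v s x (next-adj vs) vx
  ... | k , refl = go k
    where
    go : ∀ k → r (v , iter G (rot v) k s) ≡ κᴸ ⊎ r (v , iter G (rot v) k s) ≡ κᴿ
    go zero = inj₁ (proj₁ (r-arc vs))
    go (suc k) with onCycle? (v , iter G (rot v) k s)
    ... | no ¬c rewrite r-step (flip (iter-adj k (next-adj vs))) | sym (r-chord (iter-adj k (next-adj vs)) ¬c) = go k
    ... | yes c with onCycle-at pv vs c
    ...   | inj₁ x≡s rewrite x≡s = inj₂ (trans (r-step (flip (next-adj vs))) (proj₂ (r-arc vs)))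
    ...   | inj₂ x≡p rewrite x≡p = inj₁ (trans (r-step (next-adj pv)) (proj₁ (r-arc pv)))

  inClass : Dart n → Dart n → ℕ
  inClass κ d = ⟦ r d ≟ᴰ κ ⟧

  hit : Dart n → List (Dart n) → ℕ
  hit κ []      = 0
  hit κ (x ∷ _) = inClass κ x

  faceCount chordCount dartCount : Dart n → ℕ
  faceCount κ  = total (hit κ) faces
  chordCount κ = total (inClass κ) chords
  dartCount κ  = total (λ X → length X * hit κ X) faces

  inClass-face : ∀ κ {x xs} → x ∷ xs ∈ faces → ∀ {d} → d ∈ x ∷ xs → inClass κ d ≡ inClass κ x
  inClass-face κ X∈ d∈ = cong (λ z → ⟦ z ≟ᴰ κ ⟧) (r-face X∈ d∈ (here refl))

  darts-total : ∀ κ → total (inClass κ) darts ≡ dartCount κ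
  darts-total κ = trans (total-concat (inClass κ) faces) (total-cong faces λ {X} → one X)
    where
    one : ∀ X → X ∈ faces → total (inClass κ) X ≡ length X * hit κ X
    one []       X∈ = refl
    one (x ∷ xs) X∈ = total-const _ (x ∷ xs) (inClass-face κ X∈)

  -- A face has one join fewer than darts, so that adding one for each face restores the number of
  -- darts.
  chains-total : ∀ κ → total (inClass κ ∘ proj₁) (concat (map chain faces)) + faceCount κ ≡ dartCount κ
  chains-total κ = trans (cong (_+ faceCount κ) (trans (total-concat _ (map chain faces)) (total-map _ chain faces)))
                  (trans (sym (total-+ _ (hit κ) faces)) (total-cong faces λ {X} → one X))
    where
    one : ∀ X → X ∈ faces → total (inClass κ ∘ proj₁) (chain X) + hit κ X ≡ length X * hit κ X
    one []       X∈ = refl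
    one (x ∷ xs) X∈ = trans (cong (_+ inClass κ x)
      (trans (total-const (inClass κ x) (chain (x ∷ xs)) (λ m → inClass-face κ X∈ (chain-fst x xs m)))
             (cong (_* inClass κ x) (chain-length x xs)))) (+-comm _ (inClass κ x))

  -- A class has at most one dart more than it has joins. The joins within faces number darts minus
  -- faces, so the darts cancel. What remains says that the faces of a class, connected through its
  -- chords, exceed those by at most one.
  faces≤chords : ∀ κ → faceCount κ ≤ 1 + chordCount κ
  faces≤chords κ = +-cancelˡ-≤ C _ _ (begin
      C + faceCount κ                                  ≡⟨ chains-total κ ⟩
      dartCount κ                                      ≡⟨ sym (darts-total κ) ⟩
      total (inClass κ) darts                          ≤⟨ proj₂ (proj₂ comp) κ ⟩
      1 + total (inClass κ ∘ proj₁) joins              ≡⟨ cong suc (trans (total-++ _ (concat (map chain faces)) _)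
                                                            (cong (C +_) (total-map _ (λ d → d , swap d) chords))) ⟩
      1 + (C + chordCount κ)                           ≡⟨ solve 2 (λ a b → con 1 :+ (a :+ b) := a :+ (con 1 :+ b)) refl C (chordCount κ) ⟩
      C + (1 + chordCount κ) ∎)
    where
    open ≤-Reasoning
    C = total (inClass κ ∘ proj₁) (concat (map chain faces))

  head-adj : ∀ {x xs} → x ∷ xs ∈ faces → Adj G (proj₁ x) (proj₂ x)
  head-adj X∈ = sound (∈-concat⁺′ (here refl) X∈)

  darts-length : length darts ≡ (m + m) + (length chords + length chords)
  darts-length = trans (↭-length darts-↭) (trans (length-++ (arcs ++ map swap arcs))
    (cong₂ _+_ (trans (length-++ arcs) (cong₂ _+_ arcs≡m (trans (length-map swap arcs) arcs≡m)))
               (trans (length-++ chords) (cong (length chords +_) (length-map swap chords)))))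
    where
    arcs≡m : length arcs ≡ m
    arcs≡m = trans arcs-length (sym m≡)

  -- The cycle has as many edges as vertices, so `m` drops out of Euler's formula.
  faces-chords : length faces ≡ 2 + length chords
  faces-chords = *-cancelʳ-≡ _ _ 2 (+-cancelˡ-≡ (m * 2) _ _ (trans (solve 2 (λ a b → a :* con 2 :+ b :* con 2 := (a :+ b) :* con 2) refl m (length faces))
    (trans euler (trans (cong (_+ 4) darts-length)
    (solve 2 (λ a c → ((a :+ a) :+ (c :+ c)) :+ con 4 := a :* con 2 :+ (con 2 :+ c) :* con 2) refl m (length chords))))))

  total≤length : ∀ κ (xs : List (Dart n)) → total (inClass κ) xs ≤ length xs
  total≤length κ [] = z≤n
  total≤length κ (x ∷ xs) with r x ≟ᴰ κ
  ... | yes _ = s≤s (total≤length κ xs)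
  ... | no _  = ≤-trans (total≤length κ xs) (n≤1+n _)

  -- This stands in for the Jordan curve theorem. If the two sides had the same class, it would
  -- contain all faces, two more than there are chords, against `faces≤chords`.
  κᴸ≢κᴿ : κᴸ ≢ κᴿ
  κᴸ≢κᴿ eq = 1+n≰n (begin
      2 + length chords          ≡⟨ sym faces-chords ⟩
      length faces               ≡⟨ sym (total-1 faces λ {X} → hit-one X) ⟩
      faceCount κᴸ               ≤⟨ faces≤chords κᴸ ⟩
      1 + chordCount κᴸ          ≤⟨ s≤s (total≤length κᴸ chords) ⟩
      1 + length chords ∎)
    where
    open ≤-Reasoning
    hit-one : ∀ X → X ∈ faces → hit κᴸ X ≡ 1
    hit-one [] X∈ with () ← All.lookup orbits X∈
    hit-one (x ∷ xs) X∈ with r-dart (head-adj X∈)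
    ... | inj₁ e = ⟦⟧-yes (r x ≟ᴰ κᴸ) e
    ... | inj₂ e = ⟦⟧-yes (r x ≟ᴰ κᴸ) (trans e (sym eq))

  either : ∀ {u v} → Adj G u v → inClass κᴸ (u , v) + inClass κᴿ (u , v) ≡ 1
  either {u} {v} uv with r-dart uv
  ... | inj₁ e = cong₂ _+_ (⟦⟧-yes (r (u , v) ≟ᴰ κᴸ) e) (⟦⟧-no (r (u , v) ≟ᴰ κᴿ) λ e' → κᴸ≢κᴿ (trans (sym e) e'))
  ... | inj₂ e = cong₂ _+_ (⟦⟧-no (r (u , v) ≟ᴰ κᴸ) λ e' → κᴸ≢κᴿ (trans (sym e') e)) (⟦⟧-yes (r (u , v) ≟ᴰ κᴿ) e)

  faces-both : faceCount κᴸ + faceCount κᴿ ≡ length faces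
  faces-both = trans (sym (total-+ _ _ faces)) (total-1 faces λ {X} → one X)
    where
    one : ∀ X → X ∈ faces → hit κᴸ X + hit κᴿ X ≡ 1
    one [] X∈ with () ← All.lookup orbits X∈
    one (x ∷ xs) X∈ = either (head-adj X∈)

  chords-both : chordCount κᴸ + chordCount κᴿ ≡ length chords
  chords-both = trans (sym (total-+ _ _ chords)) (total-1 chords λ m → either (sound (proj₁ (chord-∈⁻ m))))

  both : faceCount κᴸ + faceCount κᴿ ≡ (1 + chordCount κᴸ) + (1 + chordCount κᴿ)
  both = trans faces-both (trans faces-chords (trans (cong (2 +_) (sym chords-both))
    (solve 2 (λ a b → con 2 :+ (a :+ b) := (con 1 :+ a) :+ (con 1 :+ b)) refl (chordCount κᴸ) (chordCount κᴿ))))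

  squeeze : ∀ {a b c d} → a ≤ c → b ≤ d → a + b ≡ c + d → a ≡ c × b ≡ d
  squeeze {a} {b} {c} {d} a≤c b≤d eq =
    ≤-antisym a≤c (+-cancelʳ-≤ b c a (≤-trans (+-monoʳ-≤ c b≤d) (≤-reflexive (sym eq)))) ,
    ≤-antisym b≤d (+-cancelˡ-≤ a d b (≤-trans (+-mono-≤ a≤c ≤-refl) (≤-reflexive (sym eq))))

  -- The bounds of `faces≤chords` for the two sides add up to the equality `both`, so neither of
  -- them can be strict.
  tree : faceCount κᴸ ≡ 1 + chordCount κᴸ × faceCount κᴿ ≡ 1 + chordCount κᴿ
  tree = squeeze (faces≤chords κᴸ) (faces≤chords κᴿ) both

  -- A side owns one dart of each cycle edge and both darts of each of its chords, hence `m` plus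
  -- twice the chords; the tree equation then trades chords for faces.
  formula : ∀ κ → total (inClass κ) (arcs ++ map swap arcs) ≡ m → faceCount κ ≡ 1 + chordCount κ →
            dartCount κ + 2 ≡ m + faceCount κ * 2
  formula κ onArcs t = trans (cong (_+ 2) (trans (sym (darts-total κ)) (trans (total-↭ (inClass κ) darts-↭)
      (trans (total-++ _ (arcs ++ map swap arcs) _) (cong₂ _+_ onArcs (trans (total-++ _ chords _)
        (cong (chordCount κ +_) (total-swap (inClass κ) chords (λ m → cong (λ z → ⟦ z ≟ᴰ κ ⟧) (sym-chord m))))))))))
    (trans (solve 2 (λ a c → (a :+ (c :+ c)) :+ con 2 := a :+ (con 1 :+ c) :* con 2) refl m (chordCount κ))
           (cong (λ z → m + z * 2) (sym t)))
    where
    sym-chord : ∀ {u v} → (u , v) ∈ chords → r (u , v) ≡ r (v , u)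
    sym-chord m = let d∈ , ¬c , _ = chord-∈⁻ m in r-chord (sound d∈) ¬c

  arcs-class : ∀ κ {a b} → (∀ {u v} → Next u v → inClass κ (u , v) ≡ a × inClass κ (v , u) ≡ b) → a + b ≡ 1 →
               total (inClass κ) (arcs ++ map swap arcs) ≡ m
  arcs-class κ {a} {b} h ab = trans (total-++ _ arcs _) (trans (cong₂ _+_
      (total-const a arcs (λ m → proj₁ (h m)))
      (trans (total-map _ swap arcs) (total-const b arcs (λ m → proj₂ (h m)))))
    (trans (solve 3 (λ l a b → l :* a :+ l :* b := l :* (a :+ b)) refl (length arcs) a b)
    (trans (cong (length arcs *_) ab) (trans (solve 1 (λ l → l :* con 1 := l) refl (length arcs)) (trans arcs-length (sym m≡))))))

  side : Dart n → Bool
  side d = does (r d ≟ᴰ κᴸ)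

  onSide : Bool → List (Dart n) → ℕ
  onSide b X = ⟦ faceSide side X ≟ᵇ b ⟧

  side-arc : ∀ {u v} → Next u v → side (u , v) ≡ true × side (v , u) ≡ false
  side-arc {u} {v} uv = dec-true (r (u , v) ≟ᴰ κᴸ) (proj₁ (r-arc uv)) ,
                        dec-false (r (v , u) ≟ᴰ κᴸ) (λ e → κᴸ≢κᴿ (trans (sym e) (proj₂ (r-arc uv))))

  side-face : ∀ {X} → X ∈ faces → ∀ {d} → d ∈ X → side d ≡ faceSide side X
  side-face {x ∷ xs} X∈ d∈ = cong (λ z → does (z ≟ᴰ κᴸ)) (r-face X∈ d∈ (here refl))

  hit-onSide : ∀ X → X ∈ faces → hit κᴸ X ≡ onSide true X × hit κᴿ X ≡ onSide false X
  hit-onSide [] X∈ with () ← All.lookup orbits X∈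
  hit-onSide (x ∷ xs) X∈ with r x ≟ᴰ κᴸ | r x ≟ᴰ κᴿ | r-dart (head-adj X∈)
  ... | yes e | yes e' | _       = contradiction (trans (sym e) e') κᴸ≢κᴿ
  ... | yes e | no _   | _       = refl , refl
  ... | no _  | yes _  | _       = refl , refl
  ... | no ¬e | no _   | inj₁ e  = contradiction e ¬e
  ... | no _  | no ¬e  | inj₂ e  = contradiction e ¬e

  -- This is Grinberg's formula, by which length minus two, summed over the faces of a side, gives m
  -- - 2; both subtractions are moved across.
  criterion : ∀ b → total (λ X → length X * onSide b X) faces + 2 ≡ m + total (onSide b) faces * 2
  criterion true = subst₂ (λ x y → x + 2 ≡ m + y * 2)
    (total-cong faces λ {X} X∈ → cong (length X *_) (proj₁ (hit-onSide X X∈)))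
    (total-cong faces λ {X} X∈ → proj₁ (hit-onSide X X∈))
    (formula κᴸ (arcs-class κᴸ (λ {u} {v} uv → ⟦⟧-yes (r (u , v) ≟ᴰ κᴸ) (proj₁ (r-arc uv)) ,
        ⟦⟧-no (r (v , u) ≟ᴰ κᴸ) (λ e → κᴸ≢κᴿ (trans (sym e) (proj₂ (r-arc uv))))) refl) (proj₁ tree))
  criterion false = subst₂ (λ x y → x + 2 ≡ m + y * 2)
    (total-cong faces λ {X} X∈ → cong (length X *_) (proj₂ (hit-onSide X X∈)))
    (total-cong faces λ {X} X∈ → proj₂ (hit-onSide X X∈))
    (formula κᴿ (arcs-class κᴿ (λ {u} {v} uv → ⟦⟧-no (r (u , v) ≟ᴰ κᴿ) (λ e → κᴸ≢κᴿ (trans (sym (proj₁ (r-arc uv))) e)) ,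
        ⟦⟧-yes (r (v , u) ≟ᴰ κᴿ) (proj₂ (r-arc uv))) refl) (proj₂ tree))

-- Drawing an edge into a face

flip-adj : ∀ {n} (G : Graph n) {u v} → Adj G u v → Adj G v u
flip-adj G {u} {v} = subst T (adj-sym G u v)

irrefl-adj : ∀ {n} (G : Graph n) {u v} → Adj G u v → u ≢ v
irrefl-adj G {u} uv refl with () ← subst T (irrefl G u) uv

same? : ∀ {n} (x y : Fin n) → x ≡ y ⊎ x ≢ y
same? x y with x ≟ y
... | yes e = inj₁ e
... | no ¬e = inj₂ ¬e

_==_ : ∀ {n} → Fin n → Fin n → Bool
x == y = does (x ≟ y)

==-sound : ∀ {n} {x y : Fin n} → T (x == y) → x ≡ y
==-sound {x = x} {y} t with x ≟ y
... | yes e = e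

==-refl : ∀ {n} (x : Fin n) → T (x == x)
==-refl x = subst T (sym (dec-true (x ≟ x) refl)) _

∧-intro : ∀ {a b} → T a → T b → T (a ∧ b)
∧-intro p q = Equivalence.from T-∧ (p , q)

∧-elim : ∀ {a b} → T (a ∧ b) → T a × T b
∧-elim = Equivalence.to T-∧

∨-elim : ∀ {a b} → T (a ∨ b) → T a ⊎ T b
∨-elim = Equivalence.to T-∨

∨-introˡ : ∀ {a b} → T a → T (a ∨ b)
∨-introˡ = Equivalence.from T-∨ ∘ inj₁

∨-introʳ : ∀ {a b} → T b → T (a ∨ b)
∨-introʳ {a} = Equivalence.from (T-∨ {a}) ∘ inj₂

module _ {n : ℕ} where

  joined : (a b x y : Fin n) → Bool
  joined a b x y = ((x == a) ∧ (y == b)) ∨ ((y == a) ∧ (x == b))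

  addEdge : (G : Graph n) (a b : Fin n) → a ≢ b → Graph n
  addEdge G a b a≢b = record
    { adj    = λ x y → adj G x y ∨ joined a b x y
    ; sym    = λ x y → cong₂ _∨_ (adj-sym G x y) (∨-comm ((x == a) ∧ (y == b)) ((y == a) ∧ (x == b)))
    ; irrefl = λ v → trans (cong (_∨ joined a b v v) (irrefl G v)) (no-loop v)
    }
    where
    no-loop : ∀ v → joined a b v v ≡ false
    no-loop v with v ≟ a | v ≟ b
    ... | yes refl | yes refl = contradiction refl a≢b
    ... | yes _    | no _     = refl
    ... | no _     | yes _    = refl
    ... | no _     | no _     = refl

  module _ (G : Graph n) {a b : Fin n} (a≢b : a ≢ b) where

    addEdge-old : ∀ {x y} → Adj G x y → Adj (addEdge G a b a≢b) x y
    addEdge-old = ∨-introˡ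

    addEdge-new : Adj (addEdge G a b a≢b) a b
    addEdge-new = ∨-introʳ {adj G a b} (∨-introˡ (∧-intro (==-refl a) (==-refl b)))

    addEdge-cases : ∀ {x y} → Adj (addEdge G a b a≢b) x y →
                    Adj G x y ⊎ (x ≡ a × y ≡ b) ⊎ (x ≡ b × y ≡ a)
    addEdge-cases {x} {y} t with ∨-elim {adj G x y} t
    ... | inj₁ old = inj₁ old
    ... | inj₂ j with ∨-elim {(x == a) ∧ (y == b)} j
    ...   | inj₁ e = let p , q = ∧-elim e in inj₂ (inj₁ (==-sound p , ==-sound q))
    ...   | inj₂ e = let p , q = ∧-elim e in inj₂ (inj₂ (==-sound q , ==-sound p))

  pendantAdj : Graph n → Fin n → Fin (suc n) → Fin (suc n) → Bool
  pendantAdj G v zero    zero    = false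
  pendantAdj G v zero    (suc y) = y == v
  pendantAdj G v (suc x) zero    = x == v
  pendantAdj G v (suc x) (suc y) = adj G x y

  addPendant : Graph n → Fin n → Graph (suc n)
  addPendant G v = record { adj = pendantAdj G v ; sym = s ; irrefl = i }
    where
    s : ∀ x y → pendantAdj G v x y ≡ pendantAdj G v y x
    s zero    zero    = refl
    s zero    (suc y) = refl
    s (suc x) zero    = refl
    s (suc x) (suc y) = adj-sym G x y
    i : ∀ x → pendantAdj G v x x ≡ false
    i zero    = refl
    i (suc x) = irrefl G x

-- `iter` adds its steps at the far end. Here they start at the source, which lets a walk be
-- followed step by step when `f` is modified at a few points.
data Reaches {A : Set} (f : A → A) : A → A → Set where
  stop : ∀ {x} → Reaches f x x
  move : ∀ {x y} → Reaches f (f x) y → Reaches f x y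

reaches-trans : ∀ {A : Set} {f : A → A} {x y z} → Reaches f x y → Reaches f y z → Reaches f x z
reaches-trans stop     q = q
reaches-trans (move p) q = move (reaches-trans p q)

reaches⇒iter : ∀ {n} (G : Graph n) {f : Fin n → Fin n} {x y} → Reaches f x y → ∃[ k ] iter G f k x ≡ y
reaches⇒iter G stop = 0 , refl
reaches⇒iter G {f} {x} (move p) with reaches⇒iter G p
... | k , refl = suc k , commute k
  where
  commute : ∀ k → f (iter G f k x) ≡ iter G f k (f x)
  commute zero    = refl
  commute (suc k) = cong f (commute k)

iter⇒reaches : ∀ {n} (G : Graph n) {f : Fin n → Fin n} {x} k → Reaches f x (iter G f k x)
iter⇒reaches G zero    = stop
iter⇒reaches G (suc k) = reaches-trans (iter⇒reaches G k) (move stop)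

record CyclicOn {A : Set} (N : A → Set) (f : A → A) : Set where
  field
    closed : ∀ {x} → N x → N (f x)
    inj    : ∀ {x y} → N x → N y → f x ≡ f y → x ≡ y
    reach  : ∀ {x y} → N x → N y → Reaches f x y

cyclicAt : ∀ {n} {G : Graph n} (R : RotationSystem G) v → CyclicOn (Adj G v) (RotationSystem.rot R v)
cyclicAt {G = G} R v = record
  { closed = closed v _
  ; inj    = inj v _ _
  ; reach  = λ {x} {y} p q → let k , e = cyclic v x y p q in subst (Reaches _ _) e (iter⇒reaches G k)
  }
  where open RotationSystem R

rotationSystem : ∀ {n} {G : Graph n} (rot : Fin n → Fin n → Fin n) →
                 (∀ v → CyclicOn (Adj G v) (rot v)) → RotationSystem G
rotationSystem {G = G} rot c = record
  { rot    = rot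
  ; closed = λ v u → CyclicOn.closed (c v)
  ; inj    = λ v u u' → CyclicOn.inj (c v)
  ; cyclic = λ v u u' p q → reaches⇒iter G (CyclicOn.reach (c v) p q)
  }

cyclicOn-⇔ : ∀ {A : Set} {N N' : A → Set} {f} → (∀ {x} → N x → N' x) → (∀ {x} → N' x → N x) →
             CyclicOn N f → CyclicOn N' f
cyclicOn-⇔ to from c = record
  { closed = to ∘ C.closed ∘ from
  ; inj    = λ p q → C.inj (from p) (from q)
  ; reach  = λ p q → C.reach (from p) (from q)
  }
  where module C = CyclicOn c

module _ {n : ℕ} where

  insertAfter : (z w : Fin n) → (Fin n → Fin n) → Fin n → Fin n
  insertAfter z w f x = if x == w then f z else if x == z then w else f x

  module _ (z w : Fin n) (f : Fin n → Fin n) where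

    insert-new : insertAfter z w f w ≡ f z
    insert-new rewrite dec-true (w ≟ w) refl = refl

    insert-at : z ≢ w → insertAfter z w f z ≡ w
    insert-at z≢w rewrite dec-false (z ≟ w) z≢w | dec-true (z ≟ z) refl = refl

    insert-else : ∀ {x} → x ≢ w → x ≢ z → insertAfter z w f x ≡ f x
    insert-else {x} x≢w x≢z rewrite dec-false (x ≟ w) x≢w | dec-false (x ≟ z) x≢z = refl

    insert-cyclic : ∀ {N : Fin n → Set} → CyclicOn N f → N z → ¬ N w →
                    CyclicOn (λ x → N x ⊎ x ≡ w) (insertAfter z w f)
    insert-cyclic {N} c Nz ¬Nw = record { closed = closed' ; inj = inj' ; reach = reach' }
      where
      open CyclicOn c
      g : Fin n → Fin n
      g = insertAfter z w f
      N≢w : ∀ {x} → N x → x ≢ w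
      N≢w Nx refl = ¬Nw Nx
      z≢w : z ≢ w
      z≢w = N≢w Nz
      closed' : ∀ {x} → N x ⊎ x ≡ w → N (g x) ⊎ g x ≡ w
      closed' (inj₂ refl) = inj₁ (subst N (sym insert-new) (closed Nz))
      closed' {x} (inj₁ Nx) with same? x z
      ... | inj₁ refl = inj₂ (insert-at z≢w)
      ... | inj₂ x≢z   = inj₁ (subst N (sym (insert-else (N≢w Nx) x≢z)) (closed Nx))
      inj' : ∀ {x y} → N x ⊎ x ≡ w → N y ⊎ y ≡ w → g x ≡ g y → x ≡ y
      inj' (inj₂ refl) (inj₂ refl) e = refl
      inj' {x} (inj₁ Nx) (inj₂ refl) e with same? x z
      ... | inj₁ refl = contradiction (trans (sym (insert-at z≢w)) (trans e insert-new)) (N≢w (closed Nz) ∘ sym)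
      ... | inj₂ x≢z = contradiction (inj Nx Nz (trans (sym (insert-else (N≢w Nx) x≢z)) (trans e insert-new))) x≢z
      inj' (inj₂ refl) (inj₁ Ny) e = sym (inj' (inj₁ Ny) (inj₂ refl) (sym e))
      inj' {x} {y} (inj₁ Nx) (inj₁ Ny) e with same? x z | same? y z
      ... | inj₁ refl | inj₁ refl = refl
      ... | inj₁ refl | inj₂ y≢z = contradiction (trans (sym (insert-else (N≢w Ny) y≢z)) (trans (sym e) (insert-at z≢w))) (N≢w (closed Ny))
      ... | inj₂ x≢z | inj₁ refl = contradiction (trans (sym (insert-else (N≢w Nx) x≢z)) (trans e (insert-at z≢w))) (N≢w (closed Nx))
      ... | inj₂ x≢z | inj₂ y≢z = inj Nx Ny (trans (sym (insert-else (N≢w Nx) x≢z)) (trans e (insert-else (N≢w Ny) y≢z)))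
      -- A step of `f` from `z` becomes two steps of `g`, by way of `w`; all others stay.
      lift : ∀ {x y} → N x → Reaches f x y → Reaches g x y
      lift Nx stop = stop
      lift {x} {y} Nx (move p) with same? x z
      ... | inj₁ refl = move (subst (λ q → Reaches g q y) (sym (insert-at z≢w))
                         (move (subst (λ q → Reaches g q y) (sym insert-new) (lift (closed Nx) p))))
      ... | inj₂ x≢z   = move (subst (λ q → Reaches g q y) (sym (insert-else (N≢w Nx) x≢z)) (lift (closed Nx) p))
      to-w : ∀ {x} → N x → Reaches g x w
      to-w Nx = reaches-trans (lift Nx (reach Nx Nz)) (move (subst (λ q → Reaches g q w) (sym (insert-at z≢w)) stop))
      reach' : ∀ {x y} → N x ⊎ x ≡ w → N y ⊎ y ≡ w → Reaches g x y
      reach' (inj₁ Nx)   (inj₁ Ny)   = lift Nx (reach Nx Ny)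
      reach' (inj₁ Nx)   (inj₂ refl) = to-w Nx
      reach' (inj₂ refl) (inj₂ refl) = stop
      reach' {y = y} (inj₂ refl) (inj₁ Ny) =
        move (subst (λ q → Reaches g q y) (sym insert-new) (lift (closed Nz) (reach (closed Nz) Ny)))

module _ {A : Set} where

  Path : (A → A) → List A → A → Set
  Path f xs z = All (λ e → f (proj₁ e) ≡ proj₂ e) (links xs z)

  path-++⁻ : ∀ {f} xs y ys z → Path f (xs ++ y ∷ ys) z → Path f xs y × Path f (y ∷ ys) z
  path-++⁻ xs y ys z p = Allₚ.++⁻ (links xs y) (subst (All _) (links-++ xs y ys z) p)

  path-++⁺ : ∀ {f} xs y ys z → Path f xs y → Path f (y ∷ ys) z → Path f (xs ++ y ∷ ys) z
  path-++⁺ xs y ys z p q = subst (All _) (sym (links-++ xs y ys z)) (Allₚ.++⁺ p q)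

  path-cong : ∀ {f g : A → A} xs z → (∀ {x} → x ∈ xs → g x ≡ f x) → Path f xs z → Path g xs z
  path-cong xs z h p = All.tabulate λ m → trans (h (proj₁ (links-∈ xs z m))) (All.lookup p m)

  orbit-cong : ∀ {f g : A → A} xs → (∀ {x} → x ∈ xs → g x ≡ f x) → Orbit f xs → Orbit g xs
  orbit-cong (x ∷ xs) h o = path-cong (x ∷ xs) x h o

  -- The default covers an empty list before the last dart `d`: a face of a single dart has `d` as
  -- its own successor.
  headOr : List A → A → A
  headOr []      d = d
  headOr (x ∷ _) d = x

  orbit-snoc⁻ : ∀ {f} xs d → Orbit f (xs ++ [ d ]) → Path f xs d × f d ≡ headOr xs d
  orbit-snoc⁻ []       d (e ∷ []) = [] , e
  orbit-snoc⁻ (x ∷ xs) d o with path-++⁻ (x ∷ xs) d [] x o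
  ... | p , e ∷ [] = p , e

  orbit-snoc⁺ : ∀ {f} xs d → Path f xs d → f d ≡ headOr xs d → Orbit f (xs ++ [ d ])
  orbit-snoc⁺ []       d p e = e ∷ []
  orbit-snoc⁺ (x ∷ xs) d p e = path-++⁺ (x ∷ xs) d [] x p (e ∷ [])

  orbit-rotate : ∀ {f} xs ys → Orbit f (xs ++ ys) → Orbit f (ys ++ xs)
  orbit-rotate []       ys       o = subst (Orbit _) (sym (++-identityʳ ys)) o
  orbit-rotate (x ∷ xs) []       o = subst (Orbit _) (++-identityʳ (x ∷ xs)) o
  orbit-rotate (x ∷ xs) (y ∷ ys) o with path-++⁻ (x ∷ xs) y ys x o
  ... | p , q = path-++⁺ (y ∷ ys) x xs y q p

  unique-mid : ∀ {xs : List A} {d ys} → Unique (xs ++ d ∷ ys) → ∀ {e} → e ∈ xs ++ ys → e ≢ d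
  unique-mid {xs} {d} {ys} u e∈ refl with Unique-resp-↭ (shift d xs ys) u
  ... | d∉ ∷ _ = All.lookup d∉ e∈ refl

path-map : ∀ {A B : Set} {f : A → A} {g : B → B} {s : A → B} xs z →
           (∀ {x} → x ∈ xs → g (s x) ≡ s (f x)) → Path f xs z → Path g (map s xs) (s z)
path-map []           z h p        = []
path-map {s = s} (x ∷ [])     z h (e ∷ []) = trans (h (here refl)) (cong s e) ∷ []
path-map {s = s} (x ∷ y ∷ xs) z h (e ∷ p)  = trans (h (here refl)) (cong s e) ∷ path-map (y ∷ xs) z (h ∘ there) p

orbit-map : ∀ {A B : Set} {f : A → A} {g : B → B} {s : A → B} xs →
            (∀ {x} → x ∈ xs → g (s x) ≡ s (f x)) → Orbit f xs → Orbit g (map s xs)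
orbit-map (x ∷ xs) h o = path-map (x ∷ xs) x h o

-- Faces are cyclic, but the surgery below cuts their lists at fixed places, so the corners in
-- question must first be moved there.
rotateFace : ∀ {n m} {G : Graph n} xs ys {fs} → Embedding m G ((xs ++ ys) ∷ fs) → Embedding m G ((ys ++ xs) ∷ fs)
rotateFace {m = m} xs ys {fs} emb with Embedding.orbits emb
... | o ∷ os = record
  { rotation = rotation
  ; orbits   = orbit-rotate xs ys o ∷ os
  ; unique   = Unique-resp-↭ perm unique
  ; sound    = sound ∘ ∈-resp-↭ (↭-sym perm)
  ; complete = ∈-resp-↭ perm ∘ complete
  ; euler    = trans euler (cong (_+ 4) (↭-length perm))
  }
  where
  open Embedding emb
  perm : (xs ++ ys) ++ concat fs ↭ (ys ++ xs) ++ concat fs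
  perm = ++⁺ʳ (concat fs) (++-comm xs ys)

-- Two corners of a face, at v after the dart (p , v) and at v' after (p' , v'), are joined by an edge.
module _ {n m : ℕ} {G : Graph n} {xs ys : List (Dart n)} {p v p' v' : Fin n} {fs : List (List (Dart n))}
         (v≢v' : v ≢ v') (¬vv' : ¬ Adj G v v') where

  embed-addEdge : Embedding m G (((xs ++ [ p , v ]) ++ (ys ++ [ p' , v' ])) ∷ fs) →
    Embedding m (addEdge G v v' v≢v')
      (((xs ++ [ p , v ]) ++ [ v , v' ]) ∷ ((ys ++ [ p' , v' ]) ++ [ v' , v ]) ∷ fs)
  embed-addEdge emb with Embedding.orbits emb
  ... | o ∷ os = record
    { rotation = R'
    ; orbits   = o₁ ∷ o₂ ∷ os'
    ; unique   = Unique-resp-↭ (↭-sym perm) unique'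
    ; sound    = sound' ∘ ∈-resp-↭ perm
    ; complete = ∈-resp-↭ (↭-sym perm) ∘ complete'
    -- There is one more face, and there are two more darts.
    ; euler    = trans (cong (_* 2) (+-suc m (suc (length fs))))
                   (trans (cong (2 +_) euler) (cong (_+ 4) (sym (↭-length perm))))
    }
    where
    open Embedding emb
    open RotationSystem rotation renaming (faceStep to φ)
    G' : Graph n
    G' = addEdge G v v' v≢v'
    A B : List (Dart n)
    A = xs ++ [ p , v ]
    B = ys ++ [ p' , v' ]
    C = concat fs

    in-A : ∀ {d} → d ∈ A → Adj G (proj₁ d) (proj₂ d)
    in-A d∈ = sound (∈-++⁺ˡ (∈-++⁺ˡ d∈))
    in-B : ∀ {d} → d ∈ B → Adj G (proj₁ d) (proj₂ d)
    in-B d∈ = sound (∈-++⁺ˡ (∈-++⁺ʳ A d∈))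
    pv : Adj G p v
    pv = in-A (∈-insert xs)
    p'v' : Adj G p' v'
    p'v' = in-B (∈-insert ys)

    -- The face step sends (p , v) to (v , rot v p). With `v'` inserted right after `p` in the
    -- rotation at `v`, the dart (p , v) is followed by (v , v'), and likewise at `v'`.
    rot' : Fin n → Fin n → Fin n
    rot' x = if x == v then insertAfter p v' (rot v) else if x == v' then insertAfter p' v (rot v') else rot x

    rot-v : rot' v ≡ insertAfter p v' (rot v)
    rot-v rewrite dec-true (v ≟ v) refl = refl
    rot-v' : rot' v' ≡ insertAfter p' v (rot v')
    rot-v' rewrite dec-false (v' ≟ v) (v≢v' ∘ sym) | dec-true (v' ≟ v') refl = refl
    rot-else : ∀ {x} → x ≢ v → x ≢ v' → rot' x ≡ rot x
    rot-else {x} a b rewrite dec-false (x ≟ v) a | dec-false (x ≟ v') b = refl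

    cyc : ∀ x → CyclicOn (Adj G' x) (rot' x)
    cyc x with same? x v
    ... | inj₁ refl = subst (CyclicOn _) (sym rot-v) (cyclicOn-⇔ to from (insert-cyclic p v' (rot v) (cyclicAt rotation v) (flip-adj G pv) ¬vv'))
      where
      to : ∀ {y} → Adj G v y ⊎ y ≡ v' → Adj G' v y
      to (inj₁ a)    = addEdge-old G v≢v' a
      to (inj₂ refl) = addEdge-new G v≢v'
      from : ∀ {y} → Adj G' v y → Adj G v y ⊎ y ≡ v'
      from t with addEdge-cases G v≢v' t
      ... | inj₁ a               = inj₁ a
      ... | inj₂ (inj₁ (_ , e))  = inj₂ e
      ... | inj₂ (inj₂ (e , _))  = contradiction e v≢v'
    ... | inj₂ x≢v with same? x v'
    ... | inj₁ refl = subst (CyclicOn _) (sym rot-v') (cyclicOn-⇔ to from (insert-cyclic p' v (rot v') (cyclicAt rotation v') (flip-adj G p'v') (¬vv' ∘ flip-adj G)))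
      where
      to : ∀ {y} → Adj G v' y ⊎ y ≡ v → Adj G' v' y
      to (inj₁ a)    = addEdge-old G v≢v' a
      to (inj₂ refl) = flip-adj G' (addEdge-new G v≢v')
      from : ∀ {y} → Adj G' v' y → Adj G v' y ⊎ y ≡ v
      from t with addEdge-cases G v≢v' t
      ... | inj₁ a               = inj₁ a
      ... | inj₂ (inj₁ (e , _))  = contradiction (sym e) v≢v'
      ... | inj₂ (inj₂ (_ , e))  = inj₂ e
    ... | inj₂ x≢v' = subst (CyclicOn _) (sym (rot-else x≢v x≢v')) (cyclicOn-⇔ (addEdge-old G v≢v') from (cyclicAt rotation x))
      where
      from : ∀ {y} → Adj G' x y → Adj G x y
      from t with addEdge-cases G v≢v' t
      ... | inj₁ a              = a
      ... | inj₂ (inj₁ (e , _)) = contradiction e x≢v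
      ... | inj₂ (inj₂ (e , _)) = contradiction e x≢v'

    R' : RotationSystem G'
    R' = rotationSystem rot' cyc

    φ' : Dart n → Dart n
    φ' = RotationSystem.faceStep R'

    φ'-old : ∀ {d} → Adj G (proj₁ d) (proj₂ d) → d ≢ (p , v) → d ≢ (p' , v') → φ' d ≡ φ d
    φ'-old {x , y} xy ≢pv ≢p'v' = cong (y ,_) (by-cases (y ≟ v) (y ≟ v'))
      where
      by-cases : Dec (y ≡ v) → Dec (y ≡ v') → rot' y x ≡ rot y x
      by-cases (yes refl) _ = trans (cong (λ f → f x) rot-v)
        (insert-else p v' (rot v) (λ { refl → ¬vv' (flip-adj G xy) }) (λ { refl → ≢pv refl }))
      by-cases (no _) (yes refl) = trans (cong (λ f → f x) rot-v')
        (insert-else p' v (rot v') (λ { refl → ¬vv' xy }) (λ { refl → ≢p'v' refl }))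
      by-cases (no a) (no b) = cong (λ f → f x) (rot-else a b)

    φ'-pv : φ' (p , v) ≡ (v , v')
    φ'-pv = cong (v ,_) (trans (cong (λ f → f p) rot-v) (insert-at p v' (rot v) λ { refl → ¬vv' (flip-adj G pv) }))
    φ'-p'v' : φ' (p' , v') ≡ (v' , v)
    φ'-p'v' = cong (v' ,_) (trans (cong (λ f → f p') rot-v') (insert-at p' v (rot v') λ { refl → ¬vv' p'v' }))
    φ'-vv' : φ' (v , v') ≡ φ (p' , v')
    φ'-vv' = cong (v' ,_) (trans (cong (λ f → f v) rot-v') (insert-new p' v (rot v')))
    φ'-v'v : φ' (v' , v) ≡ φ (p , v)
    φ'-v'v = cong (v ,_) (trans (cong (λ f → f v') rot-v) (insert-new p v' (rot v)))

    uniqAB : Unique (xs ++ (p , v) ∷ (B ++ C))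
    uniqAB = subst Unique (trans (++-assoc A B C) (++-assoc xs _ (B ++ C))) unique
    uniqB : Unique ((A ++ ys) ++ (p' , v') ∷ C)
    uniqB = subst Unique (trans (++-assoc A B C) (trans (cong (A ++_) (++-assoc ys _ C)) (sym (++-assoc A ys _)))) unique

    ≢pv : ∀ {d} → d ∈ xs ++ (B ++ C) → d ≢ (p , v)
    ≢pv = unique-mid uniqAB
    ≢p'v' : ∀ {d} → d ∈ (A ++ ys) ++ C → d ≢ (p' , v')
    ≢p'v' = unique-mid uniqB

    φ'-xs : ∀ {d} → d ∈ xs → φ' d ≡ φ d
    φ'-xs d∈ = φ'-old (in-A (∈-++⁺ˡ d∈)) (≢pv (∈-++⁺ˡ d∈)) (≢p'v' (∈-++⁺ˡ (∈-++⁺ˡ (∈-++⁺ˡ d∈))))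
    φ'-ys : ∀ {d} → d ∈ ys → φ' d ≡ φ d
    φ'-ys d∈ = φ'-old (in-B (∈-++⁺ˡ d∈)) (≢pv (∈-++⁺ʳ xs (∈-++⁺ˡ (∈-++⁺ˡ d∈)))) (≢p'v' (∈-++⁺ˡ (∈-++⁺ʳ A d∈)))
    φ'-fs : ∀ {X d} → X ∈ fs → d ∈ X → φ' d ≡ φ d
    φ'-fs X∈ d∈ = φ'-old (sound (∈-++⁺ʳ (A ++ B) d∈C)) (≢pv (∈-++⁺ʳ xs (∈-++⁺ʳ B d∈C))) (≢p'v' (∈-++⁺ʳ (A ++ ys) d∈C))
      where d∈C = ∈-concat⁺′ d∈ X∈

    -- The old face is cut after its two corner darts. The new dart (v , v') takes over the
    -- successor of (p' , v'), which is where the first half begins, and so closes that half; (v' ,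
    -- v) closes the other.
    halves : (Path φ xs (p , v) × φ (p , v) ≡ headOr ys (p' , v')) × (Path φ ys (p' , v') × φ (p' , v') ≡ headOr xs (p , v))
    halves = split xs ys o
      where
      split : ∀ xs ys → Orbit φ ((xs ++ [ p , v ]) ++ (ys ++ [ p' , v' ])) →
        (Path φ xs (p , v) × φ (p , v) ≡ headOr ys (p' , v')) × (Path φ ys (p' , v') × φ (p' , v') ≡ headOr xs (p , v))
      split xs ys o with orbit-snoc⁻ ((xs ++ [ p , v ]) ++ ys) (p' , v') (subst (Orbit φ) (sym (++-assoc (xs ++ [ p , v ]) ys _)) o)
      ... | path , e = first ys (subst (λ l → Path φ l (p' , v')) (++-assoc xs _ ys) path) , second ys (subst (λ l → Path φ l (p' , v')) (++-assoc xs _ ys) path) , trans e (hd xs)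
        where
        hd : ∀ xs → headOr ((xs ++ [ p , v ]) ++ ys) (p' , v') ≡ headOr xs (p , v)
        hd []      = refl
        hd (_ ∷ _) = refl
        first : ∀ ys → Path φ (xs ++ (p , v) ∷ ys) (p' , v') → Path φ xs (p , v) × φ (p , v) ≡ headOr ys (p' , v')
        first ys q with path-++⁻ xs (p , v) ys (p' , v') q
        first []       q | a , b ∷ _ = a , b
        first (y ∷ ys) q | a , b ∷ _ = a , b
        second : ∀ ys → Path φ (xs ++ (p , v) ∷ ys) (p' , v') → Path φ ys (p' , v')
        second ys q with path-++⁻ xs (p , v) ys (p' , v') q
        second []       q | _ = []
        second (y ∷ ys) q | _ , _ ∷ b = b

    close : ∀ zs {d e} → Path φ zs d → (∀ {x} → x ∈ zs → φ' x ≡ φ x) → φ' d ≡ e → φ' e ≡ headOr zs d →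
            Orbit φ' ((zs ++ [ d ]) ++ [ e ])
    close zs {d} {e} path h de ez = orbit-snoc⁺ (zs ++ [ d ]) e
      (path-++⁺ zs d [] e (path-cong zs d h path) (de ∷ []))
      (trans ez (sym (hd zs)))
      where
      hd : ∀ zs → headOr (zs ++ [ d ]) e ≡ headOr zs d
      hd []      = refl
      hd (_ ∷ _) = refl

    o₁ : Orbit φ' (A ++ [ v , v' ])
    o₁ = close xs (proj₁ (proj₁ halves)) φ'-xs φ'-pv (trans φ'-vv' (proj₂ (proj₂ halves)))
    o₂ : Orbit φ' (B ++ [ v' , v ])
    o₂ = close ys (proj₁ (proj₂ halves)) φ'-ys φ'-p'v' (trans φ'-v'v (proj₂ (proj₁ halves)))
    os' : All (Orbit φ') fs
    os' = All.tabulate λ {X} X∈ → orbit-cong X (φ'-fs X∈) (All.lookup os X∈)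

    perm : (A ++ [ v , v' ]) ++ (B ++ [ v' , v ]) ++ C ↭ (v , v') ∷ (v' , v) ∷ (A ++ B) ++ C
    perm = ↭-trans (↭-reflexive (++-assoc A _ _)) (↭-trans (shift (v , v') A _) (prep (v , v')
      (↭-trans (++⁺ˡ A (↭-trans (↭-reflexive (++-assoc B _ C)) (shift (v' , v) B C)))
      (↭-trans (shift (v' , v) A (B ++ C)) (prep (v' , v) (↭-reflexive (sym (++-assoc A B C))))))))

    unique' : Unique ((v , v') ∷ (v' , v) ∷ (A ++ B) ++ C)
    unique' = ((λ { refl → v≢v' refl }) ∷ All.tabulate (λ { d∈ refl → ¬vv' (sound d∈) }))
            ∷ All.tabulate (λ { d∈ refl → ¬vv' (flip-adj G (sound d∈)) })
            ∷ unique

    sound' : ∀ {x y} → (x , y) ∈ (v , v') ∷ (v' , v) ∷ (A ++ B) ++ C → Adj G' x y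
    sound' (here refl)         = addEdge-new G v≢v'
    sound' (there (here refl)) = flip-adj G' (addEdge-new G v≢v')
    sound' (there (there d∈))  = addEdge-old G v≢v' (sound d∈)

    complete' : ∀ {x y} → Adj G' x y → (x , y) ∈ (v , v') ∷ (v' , v) ∷ (A ++ B) ++ C
    complete' t with addEdge-cases G v≢v' t
    ... | inj₁ a                      = there (there (complete a))
    ... | inj₂ (inj₁ (refl , refl))   = here refl
    ... | inj₂ (inj₂ (refl , refl))   = there (here refl)

raise : ∀ {n} → Dart n → Dart (suc n)
raise (x , y) = suc x , suc y

Up : ∀ {n} → (Fin n → Set) → Fin (suc n) → Set
Up N zero    = ⊥
Up N (suc x) = N x

liftRot : ∀ {n} → (Fin n → Fin n) → Fin (suc n) → Fin (suc n)
liftRot f zero    = zero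
liftRot f (suc x) = suc (f x)

lift-cyclic : ∀ {n} {N : Fin n → Set} {f} → CyclicOn N f → CyclicOn (Up N) (liftRot f)
lift-cyclic {N = N} {f} c = record { closed = λ {x} → cl x ; inj = λ {x} {y} → ij x y ; reach = λ {x} {y} → rc x y }
  where
  open CyclicOn c
  cl : ∀ x → Up N x → Up N (liftRot f x)
  cl (suc x) p = closed p
  ij : ∀ x y → Up N x → Up N y → liftRot f x ≡ liftRot f y → x ≡ y
  ij (suc x) (suc y) p q e = cong suc (inj p q (suc-injective e))
  up : ∀ {x y} → Reaches f x y → Reaches (liftRot f) (suc x) (suc y)
  up stop     = stop
  up (move r) = move (up r)
  rc : ∀ x y → Up N x → Up N y → Reaches (liftRot f) x y
  rc (suc x) (suc y) p q = up (reach p q)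

-- A pendant edge is drawn into the corner at v after the dart (p , v).
module _ {n m : ℕ} {G : Graph n} {xs : List (Dart n)} {p v : Fin n} {fs : List (List (Dart n))} where

  embed-addPendant : Embedding m G ((xs ++ [ p , v ]) ∷ fs) →
    Embedding (suc m) (addPendant G v)
      (((map raise (xs ++ [ p , v ]) ++ [ suc v , zero ]) ++ [ zero , suc v ]) ∷ map (map raise) fs)
  embed-addPendant emb with Embedding.orbits emb
  ... | o ∷ os = record
    { rotation = R'
    ; orbits   = o' ∷ os'
    ; unique   = Unique-resp-↭ (↭-sym perm) unique'
    ; sound    = sound' ∘ ∈-resp-↭ perm
    ; complete = ∈-resp-↭ (↭-sym perm) ∘ complete'
    -- There is one more vertex, there are two more darts, and the number of faces stays.
    ; euler    = trans (cong (λ k → (suc m + suc k) * 2) (length-map (map raise) fs))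
                   (trans (cong (2 +_) euler) (cong (_+ 4) (sym (trans (↭-length perm)
                     (cong (2 +_) (length-map raise (A ++ C)))))))
    }
    where
    open Embedding emb
    open RotationSystem rotation renaming (faceStep to φ)
    G' : Graph (suc n)
    G' = addPendant G v
    A C : List (Dart n)
    A = xs ++ [ p , v ]
    C = concat fs

    in-A : ∀ {d} → d ∈ A → Adj G (proj₁ d) (proj₂ d)
    in-A d∈ = sound (∈-++⁺ˡ d∈)
    pv : Adj G p v
    pv = in-A (∈-insert xs)

    rot' : Fin (suc n) → Fin (suc n) → Fin (suc n)
    rot' zero    x = suc v
    rot' (suc y) x = (if y == v then insertAfter (suc p) zero (liftRot (rot v)) else liftRot (rot y)) x

    rot-v : rot' (suc v) ≡ insertAfter (suc p) zero (liftRot (rot v))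
    rot-v rewrite dec-true (v ≟ v) refl = refl
    rot-else : ∀ {y} → y ≢ v → rot' (suc y) ≡ liftRot (rot y)
    rot-else {y} a rewrite dec-false (y ≟ v) a = refl

    cyc : ∀ y → CyclicOn (Adj G' y) (rot' y)
    cyc zero = record
      { closed = λ _ → ==-refl v
      ; inj    = λ {x} {y} → ij x y
      ; reach  = λ {x} {y} → rc x y
      }
      where
      ij : ∀ x y → Adj G' zero x → Adj G' zero y → suc v ≡ suc v → x ≡ y
      ij (suc x) (suc y) a b _ = cong suc (trans (==-sound a) (sym (==-sound b)))
      rc : ∀ x y → Adj G' zero x → Adj G' zero y → Reaches (λ _ → suc v) x y
      rc (suc x) (suc y) a b with ==-sound {x = x} a | ==-sound {x = y} b
      ... | refl | refl = stop
    cyc (suc y) with same? y v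
    ... | inj₁ refl = subst (CyclicOn _) (sym rot-v)
          (cyclicOn-⇔ (λ {x} → to x) (λ {x} → from x)
            (insert-cyclic (suc p) zero (liftRot (rot v)) (lift-cyclic (cyclicAt rotation v)) (flip-adj G pv) id))
      where
      to : ∀ x → Up (Adj G v) x ⊎ x ≡ zero → Adj G' (suc v) x
      to (suc x) (inj₁ a)    = a
      to zero    (inj₂ refl) = ==-refl v
      from : ∀ x → Adj G' (suc v) x → Up (Adj G v) x ⊎ x ≡ zero
      from zero    _ = inj₂ refl
      from (suc x) a = inj₁ a
    ... | inj₂ y≢v = subst (CyclicOn _) (sym (rot-else y≢v))
          (cyclicOn-⇔ (λ {x} → to x) (λ {x} → from x) (lift-cyclic (cyclicAt rotation y)))
      where
      to : ∀ x → Up (Adj G y) x → Adj G' (suc y) x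
      to (suc x) a = a
      from : ∀ x → Adj G' (suc y) x → Up (Adj G y) x
      from zero    a = y≢v (==-sound a)
      from (suc x) a = a

    R' : RotationSystem G'
    R' = rotationSystem rot' cyc

    φ' : Dart (suc n) → Dart (suc n)
    φ' = RotationSystem.faceStep R'

    φ'-old : ∀ {d} → d ≢ (p , v) → φ' (raise d) ≡ raise (φ d)
    φ'-old {x , y} ≢pv = cong (suc y ,_) (by-cases (same? y v))
      where
      by-cases : y ≡ v ⊎ y ≢ v → rot' (suc y) (suc x) ≡ suc (rot y x)
      by-cases (inj₁ refl) = trans (cong (λ f → f (suc x)) rot-v)
        (insert-else (suc p) zero (liftRot (rot v)) (λ ()) (λ { refl → ≢pv refl }))
      by-cases (inj₂ a) = cong (λ f → f (suc x)) (rot-else a)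

    φ'-pv : φ' (suc p , suc v) ≡ (suc v , zero)
    φ'-pv = cong (suc v ,_) (trans (cong (λ f → f (suc p)) rot-v) (insert-at (suc p) zero (liftRot (rot v)) λ ()))
    φ'-back : φ' (zero , suc v) ≡ raise (φ (p , v))
    φ'-back = cong (suc v ,_) (trans (cong (λ f → f zero) rot-v) (insert-new (suc p) zero (liftRot (rot v))))

    ≢pv : ∀ {d} → d ∈ xs ++ C → d ≢ (p , v)
    ≢pv = unique-mid (subst Unique (++-assoc xs _ C) unique)

    o' : Orbit φ' ((map raise A ++ [ suc v , zero ]) ++ [ zero , suc v ])
    o' = subst (λ l → Orbit φ' ((l ++ [ suc v , zero ]) ++ [ zero , suc v ])) (sym (map-++ raise xs _)) (orbit-snoc⁺ ((map raise xs ++ [ raise (p , v) ]) ++ [ suc v , zero ]) _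
      (path-++⁺ (map raise xs ++ [ raise (p , v) ]) _ [] _
        (path-++⁺ (map raise xs) _ [] _
          (path-map xs (p , v) (λ d∈ → φ'-old (≢pv (∈-++⁺ˡ d∈))) (proj₁ pieces)) (φ'-pv ∷ []))
        (refl ∷ []))
      (trans φ'-back (trans (cong raise (proj₂ pieces)) (hd xs))))
      where
      pieces : Path φ xs (p , v) × φ (p , v) ≡ headOr xs (p , v)
      pieces = orbit-snoc⁻ xs (p , v) o
      hd : ∀ xs → raise (headOr xs (p , v)) ≡ headOr ((map raise xs ++ [ raise (p , v) ]) ++ [ suc v , zero ]) (zero , suc v)
      hd []      = refl
      hd (_ ∷ _) = refl

    os' : All (Orbit φ') (map (map raise) fs)
    os' = Allₚ.map⁺ (All.tabulate λ {X} X∈ →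
      orbit-map X (λ d∈ → φ'-old (≢pv (∈-++⁺ʳ xs (∈-concat⁺′ d∈ X∈)))) (All.lookup os X∈))

    perm : ((map raise A ++ [ suc v , zero ]) ++ [ zero , suc v ]) ++ concat (map (map raise) fs)
           ↭ (suc v , zero) ∷ (zero , suc v) ∷ map raise (A ++ C)
    perm = ↭-trans (↭-reflexive (trans (++-assoc (map raise A ++ [ suc v , zero ]) _ _) (++-assoc (map raise A) _ _)))
      (↭-trans (shift _ (map raise A) _) (prep _ (↭-trans (shift _ (map raise A) _) (prep _ (↭-reflexive
        (trans (cong (map raise A ++_) (concat-map fs)) (sym (map-++ raise A C))))))))

    unique' : Unique ((suc v , zero) ∷ (zero , suc v) ∷ map raise (A ++ C))
    unique' = ((λ ()) ∷ All.tabulate not-zero₂) ∷ All.tabulate not-zero₁ ∷ Uniqueₚ.map⁺ (λ { {_ , _} {_ , _} refl → refl }) unique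
      where
      not-zero₁ : ∀ {d} → d ∈ map raise (A ++ C) → (zero , suc v) ≢ d
      not-zero₁ d∈ refl with ∈-map⁻ raise d∈
      ... | _ , _ , ()
      not-zero₂ : ∀ {d} → d ∈ map raise (A ++ C) → (suc v , zero) ≢ d
      not-zero₂ d∈ refl with ∈-map⁻ raise d∈
      ... | _ , _ , ()

    sound' : ∀ {x y} → (x , y) ∈ (suc v , zero) ∷ (zero , suc v) ∷ map raise (A ++ C) → Adj G' x y
    sound' (here refl)         = ==-refl v
    sound' (there (here refl)) = ==-refl v
    sound' (there (there d∈)) with ∈-map⁻ raise d∈
    ... | _ , d∈' , refl = sound d∈'

    complete' : ∀ {x y} → Adj G' x y → (x , y) ∈ (suc v , zero) ∷ (zero , suc v) ∷ map raise (A ++ C)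
    complete' {suc x} {suc y} a = there (there (∈-map⁺ raise (complete a)))
    complete' {zero}  {suc y} a with ==-sound {x = y} a
    ... | refl = there (here refl)
    complete' {suc x} {zero}  a with ==-sound {x = x} a
    ... | refl = here refl

-- Planarity from a list of faces

bit : Bool → ℕ
bit b = if b then 1 else 0

bit-true : ∀ {b} → T b → bit b ≡ 1
bit-true {true} _ = refl

bit-false : ∀ {b} → ¬ T b → bit b ≡ 0
bit-false {true}  h = contradiction _ h
bit-false {false} _ = refl

total-one : ∀ {A : Set} {f : A → ℕ} {xs} → Unique xs → ∀ {x} → x ∈ xs → f x ≡ 1 →
            (∀ {y} → y ∈ xs → y ≢ x → f y ≡ 0) → total f xs ≡ 1
total-one {xs = x ∷ xs} (x∉ ∷ u) (here refl) fx others =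
  cong₂ _+_ fx (total-0 xs λ y∈ → others (there y∈) λ { refl → All.lookup x∉ y∈ refl })
total-one {xs = x ∷ xs} (x∉ ∷ u) (there m) fx others =
  cong₂ _+_ (others (here refl) λ { refl → All.lookup x∉ m refl }) (total-one u m fx (others ∘ there))

total-filter : ∀ {A : Set} (p q : A → Bool) xs →
               total (λ x → bit (p x ∧ q x)) xs ≡ total (bit ∘ q) (filter (T? ∘ p) xs)
total-filter p q [] = refl
total-filter p q (x ∷ xs) with p x
... | true  = cong (bit (q x) +_) (total-filter p q xs)
... | false = total-filter p q xs

least : ∀ {A : Set} (k : A → ℕ) x xs → ∃[ y ] y ∈ x ∷ xs × (∀ {z} → z ∈ x ∷ xs → k y ≤ k z)
least k x [] = x , here refl , λ { (here refl) → ≤-refl }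
least k x (y ∷ ys) with least k y ys
... | w , w∈ , lo with ≤-total (k x) (k w)
... | inj₁ x≤w = x , here refl , λ { (here refl) → ≤-refl ; (there z∈) → ≤-trans x≤w (lo z∈) }
... | inj₂ w≤x = w , there w∈ , λ { (here refl) → w≤x ; (there z∈) → lo z∈ }

and-upTo⁺ : ∀ N (p : ℕ → Bool) → (∀ {k} → k < N → T (p k)) → T (and (map p (upTo N)))
and-upTo⁺ N p h = go (upTo N) λ k∈ → h (∈-upTo⁻ k∈)
  where
  go : ∀ ks → (∀ {k} → k ∈ ks → T (p k)) → T (and (map p ks))
  go []       h = _
  go (k ∷ ks) h = ∧-intro (h (here refl)) (go ks (h ∘ there))

and-upTo⁻ : ∀ N (p : ℕ → Bool) → T (and (map p (upTo N))) → ∀ {k} → k < N → T (p k)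
and-upTo⁻ N p t k<N = go (upTo N) t (∈-upTo⁺ k<N)
  where
  go : ∀ ks → T (and (map p ks)) → ∀ {k} → k ∈ ks → T (p k)
  go (k ∷ ks) t (here refl) = proj₁ (∧-elim {p k} t)
  go (k ∷ ks) t (there m)   = go ks (proj₂ (∧-elim {p k} t)) m

module _ {n : ℕ} {G : Graph n} {faces : List (List (Dart n))} (emb : Embedding n G faces) where
  open Embedding emb

  private
    φ : Dart n → Dart n
    φ = RotationSystem.faceStep rotation

    darts : List (Dart n)
    darts = concat faces

    pairs : List (Dart n)
    pairs = allPairs G

    isDart : Dart n → Bool
    isDart (u , v) = adj G u v

    pairs-all : ∀ d → d ∈ pairs
    pairs-all (u , v) = ∈-concat⁺′ (∈-map⁺ (u ,_) (∈-allFin v)) (∈-map⁺ _ (∈-allFin u))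

    pairs-unique : Unique pairs
    pairs-unique = go (allFin n) (Uniqueₚ.allFin⁺ n)
      where
      go : ∀ us → Unique us → Unique (concatMap (λ u → map (u ,_) (allFin n)) us)
      go []       _        = []
      go (u ∷ us) (u∉ ∷ q) = Uniqueₚ.++⁺ (Uniqueₚ.map⁺ (λ { refl → refl }) (Uniqueₚ.allFin⁺ n)) (go us q) disjoint
        where
        disjoint : ∀ {d} → ¬ (d ∈ map (u ,_) (allFin n) × d ∈ concatMap (λ u → map (u ,_) (allFin n)) us)
        disjoint (a , b) with ∈-map⁻ (u ,_) a | ∈-concat⁻′ (map (λ u → map (u ,_) (allFin n)) us) b
        ... | _ , _ , refl | X , d∈ , X∈ with ∈-map⁻ _ X∈
        ... | u' , u'∈ , refl with ∈-map⁻ (u' ,_) d∈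
        ... | _ , _ , refl = All.lookup u∉ u'∈ refl

    pairs-length : length pairs ≡ n * n
    pairs-length = trans (go (allFin n)) (cong (_* n) (length-tabulate {n = n} id))
      where
      go : ∀ us → length (concatMap (λ u → map (u ,_) (allFin n)) us) ≡ length us * n
      go []       = refl
      go (u ∷ us) = trans (length-++ (map (u ,_) (allFin n)))
        (cong₂ _+_ (trans (length-map (u ,_) (allFin n)) (length-tabulate {n = n} id)) (go us))

    darts-↭ : filter (T? ∘ isDart) pairs ↭ darts
    darts-↭ = unique-↭ (Uniqueₚ.filter⁺ (T? ∘ isDart) pairs-unique) unique
      (λ { {_ , _} m → complete (proj₂ (∈-filter⁻ (T? ∘ isDart) {xs = pairs} m)) })
      (λ { {u , v} m → ∈-filter⁺ (T? ∘ isDart) (pairs-all (u , v)) (sound m) })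

    count-darts : ∀ q → total (λ d → bit (isDart d ∧ q d)) pairs ≡ total (bit ∘ q) darts
    count-darts q = trans (total-filter isDart q pairs) (total-↭ (bit ∘ q) darts-↭)

    ascending : Dart n → Bool
    ascending (u , v) = toℕ u <ᵇ toℕ v

    up : List (Dart n)
    up = filter (T? ∘ ascending) darts

    up-∈ : ∀ {d} → d ∈ up → d ∈ darts × T (ascending d)
    up-∈ = ∈-filter⁻ (T? ∘ ascending)

    asc-asym : ∀ {u v : Fin n} → T (ascending (u , v)) → ¬ T (ascending (v , u))
    asc-asym {u} {v} p q = <-asym (<ᵇ⇒< (toℕ u) (toℕ v) p) (<ᵇ⇒< (toℕ v) (toℕ u) q)

    up-↭ : darts ↭ up ++ map swap up
    up-↭ = unique-↭ unique
      (Uniqueₚ.++⁺ up-unique (Uniqueₚ.map⁺ (λ { {_ , _} {_ , _} refl → refl }) up-unique) disj) to from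
      where
      up-unique = Uniqueₚ.filter⁺ (T? ∘ ascending) unique
      disj : ∀ {d} → ¬ (d ∈ up × d ∈ map swap up)
      disj {u , v} (a , b) = asc-asym {u} {v} (proj₂ (up-∈ a)) (proj₂ (up-∈ (swap-∈ b)))
      to : ∀ {d} → d ∈ darts → d ∈ up ++ map swap up
      to {u , v} d∈ with <-cmp (toℕ u) (toℕ v)
      ... | tri< lt _ _ = ∈-++⁺ˡ (∈-filter⁺ (T? ∘ ascending) d∈ (<⇒<ᵇ lt))
      ... | tri≈ _ eq _ = contradiction (toℕ-injective eq) (irrefl-adj G (sound d∈))
      ... | tri> _ _ gt = ∈-++⁺ʳ up (∈-map⁺ swap (∈-filter⁺ (T? ∘ ascending) (complete (flip-adj G (sound d∈))) (<⇒<ᵇ gt)))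
      from : ∀ {d} → d ∈ up ++ map swap up → d ∈ darts
      from {u , v} m with ∈-++⁻ up m
      ... | inj₁ a = proj₁ (up-∈ a)
      ... | inj₂ b = complete (flip-adj G (sound (proj₁ (up-∈ (swap-∈ b)))))

    -- The reverse of an ascending dart is descending, so each edge is counted through exactly one
    -- of its darts.
    numEdges≡ : numEdges G ≡ length up
    numEdges≡ = trans (total-cong pairs (λ { {_ , _} _ → refl })) (trans (count-darts ascending)
      (trans (total-↭ (bit ∘ ascending) up-↭) (trans (total-++ (bit ∘ ascending) up (map swap up))
      (trans (cong₂ _+_ (total-1 up (λ m → bit-true (proj₂ (up-∈ m))))
                        (total-0 (map swap up) λ { {u , v} m → bit-false (asc-asym {v} {u} (proj₂ (up-∈ (swap-∈ m)))) }))
             (+-identityʳ (length up))))))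

    darts≡ : length darts ≡ numEdges G * 2
    darts≡ = trans (↭-length up-↭) (trans (length-++ up) (trans (cong (length up +_) (length-map swap up))
      (trans (solve 1 (λ a → a :+ a := a :* con 2) refl (length up)) (cong (_* 2) (sym numEdges≡)))))
      where open +-*-Solver using (solve; _:+_; _:*_; _:=_; con)

    key-injective : ∀ {d e} → key G d ≡ key G e → d ≡ e
    key-injective {u , v} {u' , v'} eq =
      let p , q = combine-injective u v u' v' (toℕ-injective (trans (toℕ-combine u v)
                    (trans (cong (_+ toℕ v) (*-comm n (toℕ u))) (trans eq
                    (trans (cong (_+ toℕ v') (*-comm (toℕ u') n)) (sym (toℕ-combine u' v')))))))
      in cong₂ _,_ p q

    iterate : ℕ → Dart n → Dart n
    iterate = iterD G φ

    isLeast : Dart n → Bool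
    isLeast d = and (map (λ k → key G d ≤ᵇ key G (iterate k d)) (upTo (n * n)))

    iterate-suc : ∀ k d → iterate (suc k) d ≡ iterate k (φ d)
    iterate-suc zero    d = refl
    iterate-suc (suc k) d = cong φ (iterate-suc k d)

    iterate-∈ : ∀ {X} → Orbit φ X → ∀ k {d} → d ∈ X → iterate k d ∈ X
    iterate-∈ o zero    d∈ = d∈
    iterate-∈ o (suc k) d∈ = orbit-step _ o (iterate-∈ o k d∈)

    along : ∀ x xs z → Path φ (x ∷ xs) z → ∀ {y} → y ∈ x ∷ xs → ∃[ k ] k < length (x ∷ xs) × iterate k x ≡ y
    along x xs       z p (here refl) = 0 , s≤s z≤n , refl
    along x (w ∷ xs) z (e ∷ p) (there m) with along w xs z p m
    ... | k , k< , eq = suc k , s≤s k< , trans (iterate-suc k x) (trans (cong (iterate k) e) eq)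

    reachIn : ∀ {X} → Orbit φ X → ∀ {d e} → d ∈ X → e ∈ X → ∃[ k ] k < length X × iterate k d ≡ e
    reachIn o {d} d∈ e∈ with ∈-∃++ d∈
    ... | ys , zs , refl with along d (zs ++ ys) d (orbit-rotate ys (d ∷ zs) o) (∈-resp-↭ (++-comm ys (d ∷ zs)) e∈)
    ... | k , k< , eq = k , <-≤-trans k< (≤-reflexive (↭-length (++-comm (d ∷ zs) ys))) , eq

    -- Thus the n * n iterates inspected by `numFaces` run through the whole face.
    face-short : ∀ {X} → X ∈ faces → length X ≤ n * n
    face-short {X} X∈ with ∈-∃++ X∈
    ... | Xs , Ys , refl = ≤-trans (≤-trans (within Xs) (≤-reflexive (sym (↭-length darts-↭))))
                             (≤-trans (length-filter (T? ∘ isDart) pairs) (≤-reflexive pairs-length))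
      where
      within : ∀ Xs → length X ≤ length (concat (Xs ++ X ∷ Ys))
      within []       = ≤-trans (m≤m+n _ _) (≤-reflexive (sym (length-++ X)))
      within (Z ∷ Xs) = ≤-trans (within Xs) (≤-trans (m≤n+m _ (length Z)) (≤-reflexive (sym (length-++ Z))))

    -- Keys are injective and every dart of a face reaches every other, so only the dart with the
    -- least key passes the test. Summed over the faces, this turns the count of `numFaces` into the
    -- number of listed faces.
    one-least : ∀ {X} → X ∈ faces → total (bit ∘ isLeast) X ≡ 1
    one-least {[]} X∈ with () ← All.lookup orbits X∈
    one-least {x ∷ xs} X∈ with least (key G) x xs
    ... | y , y∈ , lo = total-one X-unique y∈ (bit-true y-least) others
      where
      o = All.lookup orbits X∈
      X-unique : Unique (x ∷ xs)
      X-unique = part faces unique X∈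
        where
        ++-unique : ∀ {A : Set} (as : List A) {bs} → Unique (as ++ bs) → Unique as × Unique bs
        ++-unique []       u       = [] , u
        ++-unique (a ∷ as) (p ∷ u) = let q , r = ++-unique as u in (Allₚ.++⁻ˡ as p ∷ q) , r
        part : ∀ Xs → Unique (concat Xs) → ∀ {X} → X ∈ Xs → Unique X
        part (X ∷ Xs) u (here refl) = proj₁ (++-unique X u)
        part (X ∷ Xs) u (there m)   = part Xs (proj₂ (++-unique X u)) m
      y-least : T (isLeast y)
      y-least = and-upTo⁺ (n * n) _ λ {k} _ → ≤⇒≤ᵇ (lo (iterate-∈ o k y∈))
      others : ∀ {z} → z ∈ x ∷ xs → z ≢ y → bit (isLeast z) ≡ 0
      others {z} z∈ z≢y = bit-false λ t → case-reach t (reachIn o z∈ y∈)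
        where
        case-reach : T (isLeast z) → ∃[ k ] k < length (x ∷ xs) × iterate k z ≡ y → ⊥
        case-reach t (k , k< , eq) = z≢y (key-injective (≤-antisym
          (subst (λ w → key G z ≤ key G w) eq (≤ᵇ⇒≤ _ _ (and-upTo⁻ (n * n) _ t (<-≤-trans k< (face-short X∈)))))
          (lo z∈)))

    numFaces≡ : numFaces G rotation ≡ length faces
    numFaces≡ = trans (count-darts isLeast) (trans (total-concat _ faces) (total-1 faces one-least))

  planar : Planar G
  planar = inj₂ (rotation , trans (cong (n +_) numFaces≡) (*-cancelʳ-≡ _ _ 2
    (trans euler (trans (cong (_+ 4) darts≡) (solve 1 (λ e → e :* con 2 :+ con 4 := (e :+ con 2) :* con 2) refl (numEdges G))))))
    where open +-*-Solver using (solve; _:+_; _:*_; _:=_; con)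

-- Thomassen's operation

EndsAt : ∀ {n} → List (Dart n) → Fin n → Set
EndsAt T v = ∃[ T₀ ] ∃[ p ] T ≡ T₀ ++ [ p , v ]

endsAt-raise : ∀ {n} {T : List (Dart n)} {v} → EndsAt T v → EndsAt (map raise T) (suc v)
endsAt-raise (T₀ , p , refl) = map raise T₀ , suc p , map-++ raise T₀ _

endsAt-++ : ∀ {n} S {T : List (Dart n)} {v} → EndsAt T v → EndsAt (S ++ T) v
endsAt-++ S (T₀ , p , refl) = S ++ T₀ , p , sym (++-assoc S T₀ _)

rotateTo : ∀ {n m} {G : Graph n} {X Y} S T {fs} → X ≡ S ++ T → T ++ S ≡ Y →
           Embedding m G (X ∷ fs) → Embedding m G (Y ∷ fs)
rotateTo S T refl refl = rotateFace S T

spur : ∀ {n} → Fin n → List (Dart (suc n))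
spur v = (suc v , zero) ∷ (zero , suc v) ∷ []

-- The boundary of the face comes in four pieces. The pendant edge is drawn at the end of the last
-- piece, which then moves to the front, so that four uses in a row serve the four corners.
pendantLast : ∀ {n m} {G : Graph n} S₁ S₂ S₃ {T v fs} → EndsAt T v →
  Embedding m G ((S₁ ++ S₂ ++ S₃ ++ T) ∷ fs) →
  Embedding (suc m) (addPendant G v)
    (((map raise T ++ spur v) ++ map raise S₁ ++ map raise S₂ ++ map raise S₃) ∷ map (map raise) fs)
pendantLast S₁ S₂ S₃ {v = v} (T₀ , p , refl) emb =
  rotateTo (map raise (S₁ ++ S₂ ++ S₃)) (map raise (T₀ ++ [ p , v ]) ++ spur v) front
    (cong ((map raise (T₀ ++ [ p , v ]) ++ spur v) ++_) (trans (map-++ raise S₁ _) (cong (map raise S₁ ++_) (map-++ raise S₂ S₃))))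
    (embed-addPendant (subst (λ X → Embedding _ _ (X ∷ _)) regroup emb))
  where
  S = S₁ ++ S₂ ++ S₃
  regroup : S₁ ++ S₂ ++ S₃ ++ T₀ ++ [ p , v ] ≡ (S ++ T₀) ++ [ p , v ]
  regroup = trans (cong (S₁ ++_) (sym (++-assoc S₂ S₃ _))) (trans (sym (++-assoc S₁ _ _)) (sym (++-assoc S T₀ _)))
  front : (map raise ((S ++ T₀) ++ [ p , v ]) ++ [ suc v , zero ]) ++ [ zero , suc v ]
        ≡ map raise S ++ map raise (T₀ ++ [ p , v ]) ++ spur v
  front = trans (++-assoc (map raise ((S ++ T₀) ++ [ p , v ])) _ _)
    (trans (cong (λ l → map raise l ++ spur v) (++-assoc S T₀ _))
    (trans (cong (_++ spur v) (map-++ raise S _)) (++-assoc (map raise S) _ _)))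

joinCorners : ∀ {n m} {G : Graph n} {A B v v' fs} (v≢v' : v ≢ v') → ¬ Adj G v v' → EndsAt A v → EndsAt B v' →
  Embedding m G ((A ++ B) ∷ fs) →
  Embedding m (addEdge G v v' v≢v') ((A ++ [ v , v' ]) ∷ (B ++ [ v' , v ]) ∷ fs)
joinCorners v≢v' ¬vv' (_ , _ , refl) (_ , _ , refl) = embed-addEdge v≢v' ¬vv'

↑_ : ∀ {n} → Fin n → Fin (4 + n)
↑ x = suc (suc (suc (suc x)))

pattern 1′ = zero
pattern 2′ = suc zero
pattern 3′ = suc (suc zero)
pattern 4′ = suc (suc (suc zero))

module _ {n : ℕ} (H : Graph n) (a b c d : Fin n) where

  rails : Graph (4 + n)
  -- Each new leaf gets the number 0. Starting with the leaf at `d` and ending with that at `a`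
  -- numbers a', b', c', d' from 0 to 3.
  rails = addPendant (addPendant (addPendant (addPendant H d) (suc c)) (suc (suc b))) (suc (suc (suc a)))

  rung₁ : Graph (4 + n)
  rung₁ = addEdge rails 2′ 3′ (λ ())

  -- The rungs are b'c' and d'a'. The new quadrilateral lacks a'b' and c'd' just as the old one
  -- lacks ab and cd, so the operation can be repeated.
  extend : Graph (4 + n)
  extend = addEdge rung₁ 4′ 1′ (λ ())

  -- The face that remains when the edges ab and cd of the quadrilateral abcd are deleted.
  Frame : (P Q : List (Dart n)) (fs : List (List (Dart n))) → Set
  Frame P Q fs = EndsAt P b × EndsAt Q d × Embedding n H ((P ++ (b , c) ∷ Q ++ [ d , a ]) ∷ fs)

module _ {n : ℕ} {H : Graph n} {a b c d : Fin n} where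

  -- All six edges are drawn inside the frame. The rungs cut off the quadrilaterals on bc and on da,
  -- and the remaining face is again a frame: `P` has grown by a'a and bb', and `Q` by c'c and dd'.
  extend-frame : ∀ {P Q fs} → Frame H a b c d P Q fs →
    ∃[ P' ] ∃[ Q' ] ∃[ fs' ] Frame (extend H a b c d) 1′ 2′ 3′ 4′ P' Q' fs'
  extend-frame {P} {Q} {fs} (endP , endQ , emb) =
    P' , Q' , _ , endsAt-++ ((1′ , ↑ a) ∷ P₄) ([] , ↑ b , refl) , endsAt-++ ((3′ , ↑ c) ∷ Q₄) ([] , ↑ d , refl) , e₆
    where
    P₄ Q₄ P' Q' : List (Dart (4 + n))
    P₄ = map raise (map raise (map raise (map raise P)))
    Q₄ = map raise (map raise (map raise (map raise Q)))
    P' = (1′ , ↑ a) ∷ P₄ ++ [ ↑ b , 2′ ]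
    Q' = (3′ , ↑ c) ∷ Q₄ ++ [ ↑ d , 4′ ]

    e₀ : Embedding n H (([ d , a ] ++ P ++ [ b , c ] ++ Q) ∷ fs)
    e₀ = rotateTo (P ++ (b , c) ∷ Q) [ d , a ] (sym (++-assoc P _ _)) refl emb
    e₁ = pendantLast [ d , a ] P [ b , c ] endQ e₀
    e₂ = pendantLast (map raise Q ++ spur d) (map raise [ d , a ]) (map raise P) ([] , suc b , refl) e₁
    e₃ = pendantLast (map raise (map raise [ b , c ]) ++ spur (suc c)) (map raise (map raise Q ++ spur d)) (map raise (map raise [ d , a ])) (endsAt-raise (endsAt-raise endP)) e₂
    e₄ = pendantLast (map raise (map raise (map raise P)) ++ spur (suc (suc b))) (map raise (map raise (map raise [ b , c ]) ++ spur (suc c)))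
           (map raise (map raise (map raise Q ++ spur d))) ([] , suc (suc (suc d)) , refl) e₃

    P-eq : map raise (map raise (map raise (map raise P)) ++ spur (suc (suc b))) ≡ P₄ ++ (↑ b , 2′) ∷ (2′ , ↑ b) ∷ []
    P-eq = map-++ raise (map raise (map raise (map raise P))) _
    Q-eq : map raise (map raise (map raise (map raise Q ++ spur d))) ≡ Q₄ ++ (↑ d , 4′) ∷ (4′ , ↑ d) ∷ []
    Q-eq = trans (cong (map raise ∘ map raise) (map-++ raise (map raise Q) _))
           (trans (cong (map raise) (map-++ raise (map raise (map raise Q)) _))
                  (map-++ raise (map raise (map raise (map raise Q))) _))

    X₄ : List (Dart (4 + n))
    X₄ = (↑ d , ↑ a) ∷ (↑ a , 1′) ∷ (1′ , ↑ a) ∷ (P₄ ++ (↑ b , 2′) ∷ (2′ , ↑ b) ∷ []) ++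
         (↑ b , ↑ c) ∷ (↑ c , 3′) ∷ (3′ , ↑ c) ∷ Q₄ ++ (↑ d , 4′) ∷ (4′ , ↑ d) ∷ []

    e₄' : Embedding (4 + n) (rails H a b c d) (X₄ ∷ _)
    e₄' = subst₂ (λ p q → Embedding _ _ (((↑ d , ↑ a) ∷ (↑ a , 1′) ∷ (1′ , ↑ a) ∷ p ++ (↑ b , ↑ c) ∷ (↑ c , 3′) ∷ (3′ , ↑ c) ∷ q) ∷ _))
                 P-eq Q-eq e₄

    B₅ A₅ : List (Dart (4 + n))
    B₅ = (3′ , ↑ c) ∷ Q₄ ++ (↑ d , 4′) ∷ (4′ , ↑ d) ∷ (↑ d , ↑ a) ∷ (↑ a , 1′) ∷ (1′ , ↑ a) ∷ P₄
    A₅ = B₅ ++ [ ↑ b , 2′ ]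

    e₄'' : Embedding (4 + n) (rails H a b c d) ((A₅ ++ ((2′ , ↑ b) ∷ (↑ b , ↑ c) ∷ [ ↑ c , 3′ ])) ∷ _)
    e₄'' = rotateTo W U
      (cong (λ l → (↑ d , ↑ a) ∷ (↑ a , 1′) ∷ (1′ , ↑ a) ∷ l) (trans (++-assoc P₄ _ _) (sym (++-assoc P₄ _ U))))
      (trans (cong ((3′ , ↑ c) ∷_) (trans (++-assoc Q₄ _ W) (sym (++-assoc Q₄ _ _)))) (sym (++-assoc B₅ [ ↑ b , 2′ ] _)))
      e₄'
      where
      W = (↑ d , ↑ a) ∷ (↑ a , 1′) ∷ (1′ , ↑ a) ∷ P₄ ++ (↑ b , 2′) ∷ (2′ , ↑ b) ∷ (↑ b , ↑ c) ∷ (↑ c , 3′) ∷ []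
      U = (3′ , ↑ c) ∷ Q₄ ++ (↑ d , 4′) ∷ (4′ , ↑ d) ∷ []

    e₅ = joinCorners {A = A₅} {B = (2′ , ↑ b) ∷ (↑ b , ↑ c) ∷ [ ↑ c , 3′ ]} {v = 2′} {v' = 3′}
           (λ ()) (λ ()) (endsAt-++ B₅ ([] , ↑ b , refl)) ((2′ , ↑ b) ∷ (↑ b , ↑ c) ∷ [] , ↑ c , refl) e₄''

    B₆ A₆ : List (Dart (4 + n))
    B₆ = (1′ , ↑ a) ∷ P₄ ++ (↑ b , 2′) ∷ (2′ , 3′) ∷ (3′ , ↑ c) ∷ Q₄
    A₆ = B₆ ++ [ ↑ d , 4′ ]

    e₅' : Embedding (4 + n) (rung₁ H a b c d) ((A₆ ++ ((4′ , ↑ d) ∷ (↑ d , ↑ a) ∷ [ ↑ a , 1′ ])) ∷ _)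
    e₅' = rotateTo W U start
      (trans (cong ((1′ , ↑ a) ∷_) (trans (++-assoc P₄ _ W) (sym (++-assoc P₄ _ _)))) (sym (++-assoc B₆ [ ↑ d , 4′ ] _)))
      e₅
      where
      W = (3′ , ↑ c) ∷ Q₄ ++ (↑ d , 4′) ∷ (4′ , ↑ d) ∷ (↑ d , ↑ a) ∷ (↑ a , 1′) ∷ []
      U = (1′ , ↑ a) ∷ P₄ ++ (↑ b , 2′) ∷ (2′ , 3′) ∷ []
      start : A₅ ++ [ 2′ , 3′ ] ≡ W ++ U
      start = trans (++-assoc B₅ [ ↑ b , 2′ ] _) (trans (cong ((3′ , ↑ c) ∷_) (++-assoc Q₄ ((↑ d , 4′) ∷ (4′ , ↑ d) ∷ (↑ d , ↑ a) ∷ (↑ a , 1′) ∷ (1′ , ↑ a) ∷ P₄) _)) (sym (cong ((3′ , ↑ c) ∷_) (++-assoc Q₄ _ U))))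

    e₆ : Embedding (4 + n) (extend H a b c d) ((P' ++ (2′ , 3′) ∷ Q' ++ [ 4′ , 1′ ]) ∷ _)
    e₆ = subst (λ X → Embedding (4 + n) (extend H a b c d) (X ∷ ((4′ , ↑ d) ∷ (↑ d , ↑ a) ∷ (↑ a , 1′) ∷ [ 1′ , 4′ ]) ∷
        ((2′ , ↑ b) ∷ (↑ b , ↑ c) ∷ (↑ c , 3′) ∷ [ 3′ , 2′ ]) ∷ map (map raise) (map (map raise) (map (map raise) (map (map raise) fs))))) final
      (joinCorners {A = A₆} {B = (4′ , ↑ d) ∷ (↑ d , ↑ a) ∷ [ ↑ a , 1′ ]} {v = 4′} {v' = 1′} (λ ()) (λ ())
        (endsAt-++ B₆ ([] , ↑ d , refl)) ((4′ , ↑ d) ∷ (↑ d , ↑ a) ∷ [] , ↑ a , refl) e₅')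
      where
      final : A₆ ++ [ 4′ , 1′ ] ≡ P' ++ (2′ , 3′) ∷ Q' ++ [ 4′ , 1′ ]
      final = trans (++-assoc B₆ [ ↑ d , 4′ ] _) (trans (cong ((1′ , ↑ a) ∷_) (++-assoc P₄ ((↑ b , 2′) ∷ (2′ , 3′) ∷ (3′ , ↑ c) ∷ Q₄) _))
        (sym (trans (cong ((1′ , ↑ a) ∷_) (++-assoc P₄ _ _)) (cong (λ l → (1′ , ↑ a) ∷ P₄ ++ (↑ b , 2′) ∷ (2′ , 3′) ∷ (3′ , ↑ c) ∷ l) (++-assoc Q₄ _ _)))))

module _ {n : ℕ} (H : Graph n) {a b c d : Fin n} (a≢b : a ≢ b) (c≢d : c ≢ d) where

  close : Graph n
  close = addEdge (addEdge H a b a≢b) c d c≢d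

  -- The edge ab separates `P` from the frame, and then cd separates `Q`; the quadrilateral is left
  -- over.
  close-embedding : ∀ {m P Q fs} → ¬ Adj H a b → ¬ Adj (addEdge H a b a≢b) c d → EndsAt P b → EndsAt Q d →
    Embedding m H ((P ++ (b , c) ∷ Q ++ [ d , a ]) ∷ fs) →
    Embedding m close (((d , a) ∷ (a , b) ∷ (b , c) ∷ [ c , d ]) ∷ (Q ++ [ d , c ]) ∷ (P ++ [ b , a ]) ∷ fs)
  close-embedding {P = P} {Q} {fs} ¬ab ¬cd endP endQ emb =
    joinCorners {A = (d , a) ∷ (a , b) ∷ [ b , c ]} {B = Q} c≢d ¬cd ((d , a) ∷ [ a , b ] , b , refl) endQ
      (rotateTo ((b , c) ∷ Q) ((d , a) ∷ [ a , b ]) (cong ((b , c) ∷_) (++-assoc Q [ d , a ] [ a , b ])) refl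
        (joinCorners {A = (b , c) ∷ Q ++ [ d , a ]} {B = P} a≢b ¬ab ((b , c) ∷ Q , d , refl) endP
          (rotateFace P ((b , c) ∷ Q ++ [ d , a ]) emb)))

-- Contracting Hamiltonian cycles

near : Fin 4 → Fin 4 → Bool
near 1′ 2′ = true
near 1′ 4′ = true
near 2′ 1′ = true
near 2′ 3′ = true
near 3′ 2′ = true
near 3′ 4′ = true
near 4′ 3′ = true
near 4′ 1′ = true
near _  _  = false

near-sym : ∀ i j → T (near i j) → T (near j i)
near-sym = from-yes (all? λ i → all? λ j → T? (near i j) →-dec T? (near j i))

-- On a 4-cycle the vertex opposite to the middle of a path i, j, k has only the two ends as
-- neighbours.
fourth : ∀ i j k → T (near i j) → T (near j k) → k ≢ i →
         ∃[ l ] l ≢ j × (∀ q → T (near q l) → q ≡ i ⊎ q ≡ k)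
fourth = from-yes (all? λ i → all? λ j → all? λ k → T? (near i j) →-dec (T? (near j k) →-dec (¬? (k ≟ i) →-dec
  any? λ l → ¬? (l ≟ j) ×-dec all? λ q → T? (near q l) →-dec ((q ≟ i) ⊎-dec (q ≟ k)))))

-- A path that never turns back runs once around the 4-cycle.
around : ∀ i j k l → T (near i j) → T (near j k) → T (near k l) → k ≢ i → l ≢ j → T (near i l)
around = from-yes (all? λ i → all? λ j → all? λ k → all? λ l → T? (near i j) →-dec (T? (near j k) →-dec
  (T? (near k l) →-dec (¬? (k ≟ i) →-dec (¬? (l ≟ j) →-dec T? (near i l))))))

no-fifth : ∀ i j k l m → T (near i j) → T (near j k) → T (near k l) → k ≢ i → l ≢ j → T (near l m) → m ≢ k → m ≡ i
no-fifth = from-yes (all? λ i → all? λ j → all? λ k → all? λ l → all? λ m → T? (near i j) →-dec (T? (near j k) →-dec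
  (T? (near k l) →-dec (¬? (k ≟ i) →-dec (¬? (l ≟ j) →-dec (T? (near l m) →-dec (¬? (m ≟ k) →-dec (m ≟ i))))))))

chain-snoc : ∀ {A : Set} xs (z : A) → chain (xs ++ [ z ]) ≡ links xs z
chain-snoc []           z = refl
chain-snoc (x ∷ [])     z = refl
chain-snoc (x ∷ y ∷ xs) z = cong ((x , y) ∷_) (chain-snoc (y ∷ xs) z)

-- Contraction reads the cycle from an old vertex on, so that no segment of new vertices is broken
-- by the ends of the list.
startAt : ∀ {n} {G : Graph n} {S} (C : SpanningCycleOn G S) {x} → S x →
          Σ (SpanningCycleOn G S) λ C' → SpanningCycleOn.first C' ≡ x
startAt {n} {G} {S} C {x} Sx with ∈-∃++ (proj₂ (SpanningCycleOn.cover C x) Sx)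
... | [] , zs , refl = C , refl
... | y ∷ ys , zs , refl = C' , refl
  where
  open SpanningCycleOn C
  perm : (y ∷ ys) ++ x ∷ zs ↭ x ∷ zs ++ y ∷ ys
  perm = ++-comm (y ∷ ys) (x ∷ zs)
  arcs-eq : ∀ {e} → e ∈ links (x ∷ zs ++ y ∷ ys) x → e ∈ links ((y ∷ ys) ++ x ∷ zs) y
  arcs-eq {e} m = subst (e ∈_) (sym (links-++ (y ∷ ys) x zs y))
    (swap++ (subst (e ∈_) (links-++ (x ∷ zs) y ys x) m))
    where
    swap++ : e ∈ links (x ∷ zs) y ++ links (y ∷ ys) x → e ∈ links (y ∷ ys) x ++ links (x ∷ zs) y
    swap++ = ∈-resp-↭ (++-comm (links (x ∷ zs) y) (links (y ∷ ys) x))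
  C' : SpanningCycleOn G S
  C' = record
    { first = x
    ; rest  = zs ++ y ∷ ys
    ; long  = subst (2 ≤_) (cong Data.Nat.pred (↭-length perm)) long
    ; uniq  = Unique-resp-↭ perm uniq
    ; cover = λ v → proj₁ (cover v) ∘ ∈-resp-↭ (↭-sym perm) , ∈-resp-↭ perm ∘ proj₂ (cover v)
    ; edges = ConsecProperties.links⁺ G (x ∷ zs ++ y ∷ ys) x
                (λ m → ConsecProperties.links⁻ G ((y ∷ ys) ++ x ∷ zs) y edges (arcs-eq m))
    }

module _ {n : ℕ} where

  ι : Fin 4 → Fin (4 + n)
  ι i = i ↑ˡ n

  data View : Fin (4 + n) → Set where
    new : ∀ i → View (ι i)
    old : ∀ x → View (↑ x)

  view : ∀ z → View z
  view 1′ = new 1′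
  view 2′ = new 2′
  view 3′ = new 3′
  view 4′ = new 4′
  view (suc (suc (suc (suc x)))) = old x

  ι≢↑ : ∀ {i} {x : Fin n} → ι i ≢ ↑ x
  ι≢↑ {1′} ()
  ι≢↑ {2′} ()
  ι≢↑ {3′} ()
  ι≢↑ {4′} ()

  ι-injective : ∀ {i j} → ι i ≡ ι j → i ≡ j
  ι-injective = Data.Fin.Properties.↑ˡ-injective n _ _

  olds : List (Fin (4 + n)) → List (Fin n)
  olds []         = []
  olds (1′ ∷ zs)  = olds zs
  olds (2′ ∷ zs)  = olds zs
  olds (3′ ∷ zs)  = olds zs
  olds (4′ ∷ zs)  = olds zs
  olds (suc (suc (suc (suc x))) ∷ zs) = x ∷ olds zs

  olds-new : ∀ i zs → olds (ι i ∷ zs) ≡ olds zs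
  olds-new 1′ zs = refl
  olds-new 2′ zs = refl
  olds-new 3′ zs = refl
  olds-new 4′ zs = refl

  olds-++ : ∀ zs zs' → olds (zs ++ zs') ≡ olds zs ++ olds zs'
  olds-++ []         zs' = refl
  olds-++ (z ∷ zs)   zs' with view z
  ... | new i rewrite olds-new i (zs ++ zs') | olds-new i zs = olds-++ zs zs'
  ... | old x = cong (x ∷_) (olds-++ zs zs')

  olds-∈ : ∀ zs {x} → x ∈ olds zs → ↑ x ∈ zs
  olds-∈ (z ∷ zs) m with view z
  olds-∈ (_ ∷ zs) m           | new i rewrite olds-new i zs = there (olds-∈ zs m)
  olds-∈ (_ ∷ zs) (here refl) | old x = here refl
  olds-∈ (_ ∷ zs) (there m)   | old x = there (olds-∈ zs m)

  ∈-olds : ∀ {zs x} → ↑ x ∈ zs → x ∈ olds zs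
  ∈-olds (here refl) = here refl
  ∈-olds {z ∷ zs} (there m) with view z
  ... | new i rewrite olds-new i zs = ∈-olds m
  ... | old y = there (∈-olds m)

  olds-unique : ∀ {zs} → Unique zs → Unique (olds zs)
  olds-unique [] = []
  olds-unique {z ∷ zs} (z∉ ∷ u) with view z
  ... | new i rewrite olds-new i zs = olds-unique u
  ... | old x = All.tabulate (λ {y} y∈ eq → All.lookup z∉ (olds-∈ zs y∈) (cong ↑_ eq)) ∷ olds-unique u

  EndsOld : List (Fin (4 + n)) → Set
  EndsOld []           = ⊥
  EndsOld (z ∷ [])     = ∃[ x ] z ≡ ↑ x
  EndsOld (z ∷ y ∷ zs) = EndsOld (y ∷ zs)

  endsOld : ∀ zs {x} → EndsOld (zs ++ [ ↑ x ])
  endsOld []           = _ , refl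
  endsOld (z ∷ [])     = _ , refl
  endsOld (z ∷ y ∷ zs) = endsOld (y ∷ zs)

-- A cycle of the extended graph G' runs through the four new vertices in segments whose ends are
-- neighbours on the new quadrilateral, so deleting the new vertices leaves a cycle of G.
module Contract {n : ℕ} (G : Graph n) (G' : Graph (4 + n)) (corner : Fin 4 → Fin n)
  (old-adj    : ∀ {x y} → Adj G' (↑ x) (↑ y) → Adj G x y)
  (rail-adj   : ∀ {x} i → Adj G' (↑ x) (ι i) → x ≡ corner i)
  (new-adj    : ∀ i j → Adj G' (ι i) (ι j) → T (near i j))
  (corner-adj : ∀ i j → T (near i j) → Adj G (corner i) (corner j))
  (S : Fin n → Set) (S' : Fin (4 + n) → Set)
  (S'-new : ∀ i → S' (ι i)) (S⇒ : ∀ {x} → S x → S' (↑ x)) (S⇐ : ∀ {x} → S' (↑ x) → S x)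
  {a b c : Fin n} (Sa : S a) (Sb : S b) (Sc : S c) (a≢b : a ≢ b) (a≢c : a ≢ c) (b≢c : b ≢ c) where

  module Segments (ws : List (Fin (4 + n))) (long : 2 ≤ length ws) (uniq : Unique (↑ a ∷ ws))
    (all-new : ∀ i → ι i ∈ ↑ a ∷ ws)
    (edges : ∀ {u v} → (u , v) ∈ links (↑ a ∷ ws) (↑ a) → Adj G' u v) where

    open Cycle (↑ a) ws long uniq

    rail-next : ∀ {x} i → Next (↑ x) (ι i) → x ≡ corner i
    rail-next i m = rail-adj i (edges m)

    next-rail : ∀ {x} i → Next (ι i) (↑ x) → x ≡ corner i
    next-rail i m = rail-adj i (flip-adj G' (edges m))

    new-next : ∀ i j → Next (ι i) (ι j) → T (near i j)
    new-next i j m = new-adj i j (edges m)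

    Nexts : List (Fin (4 + n)) → Set
    Nexts zs = ∀ {u v} → (u , v) ∈ chain zs → Next u v

    -- A new vertex has a single old neighbour, its corner, so the cycle would enter and leave
    -- through the same edge.
    no-short : ∀ {x i y} → Next (↑ x) (ι i) → Next (ι i) (↑ y) → ⊥
    no-short {x} {i} {y} xi iy with rail-next i xi | next-rail i iy
    ... | refl | refl = no-2-cycle xi iy

    -- The fourth new vertex also lies on the cycle. Its new neighbours `i` and `k` already have
    -- both of their cycle neighbours, so it would form a segment of its own, against `no-short`.
    no-three : ∀ {x i j k y} → Next (↑ x) (ι i) → Next (ι i) (ι j) → Next (ι j) (ι k) → Next (ι k) (↑ y) → ⊥
    no-three {x} {i} {j} {k} {y} xi ij jk ky =
      let l , l≢j , nbrs = fourth i j k (new-next i j ij) (new-next j k jk) (λ { refl → no-2-cycle ij jk })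
          _ , pl = prev (all-new l)
          _ , ls = next (all-new l)
      in isolated l l≢j nbrs pl ls
      where
      isolated : ∀ l → l ≢ j → (∀ q → T (near q l) → q ≡ i ⊎ q ≡ k) → ∀ {p s} → Next p (ι l) → Next (ι l) s → ⊥
      isolated l l≢j nbrs {p} {s} pl ls with view p | view s
      ... | old p' | old s' = no-short pl ls
      ... | new q | _ with nbrs q (new-next q l pl)
      ...   | inj₁ refl = l≢j (ι-injective (next-functional pl ij))
      ...   | inj₂ refl = ι≢↑ (next-functional pl ky)
      isolated l l≢j nbrs {p} {s} pl ls | old p' | new q with nbrs q (near-sym l q (new-next l q ls))
      ...   | inj₁ refl = ι≢↑ (next-injective ls xi)
      ...   | inj₂ refl = l≢j (ι-injective (next-injective ls jk))

    -- The index of the five functions is the number of new vertices met since the old vertex `x`.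
    -- After two or four of them the segment is replaced by an edge of abcd; a segment of one or
    -- three is impossible.
    consec : ∀ x zs → Nexts (↑ x ∷ zs) → EndsOld (↑ x ∷ zs) → Consec G (x ∷ olds zs)
    consec₁ : ∀ x i zs → Next (↑ x) (ι i) → Nexts (ι i ∷ zs) → EndsOld (ι i ∷ zs) → Consec G (x ∷ olds zs)
    consec₂ : ∀ x i j zs → Next (↑ x) (ι i) → Next (ι i) (ι j) → Nexts (ι j ∷ zs) → EndsOld (ι j ∷ zs) →
              Consec G (x ∷ olds zs)
    consec₃ : ∀ x i j k zs → Next (↑ x) (ι i) → Next (ι i) (ι j) → Next (ι j) (ι k) → Nexts (ι k ∷ zs) →
              EndsOld (ι k ∷ zs) → Consec G (x ∷ olds zs)
    consec₄ : ∀ x i j k l zs → Next (↑ x) (ι i) → Next (ι i) (ι j) → Next (ι j) (ι k) → Next (ι k) (ι l) →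
              Nexts (ι l ∷ zs) → EndsOld (ι l ∷ zs) → Consec G (x ∷ olds zs)

    consec x []       h e = tt
    consec x (z ∷ zs) h e with view z
    ... | old y = old-adj (edges (h (here refl))) , consec y zs (h ∘ there) e
    ... | new i rewrite olds-new i zs = consec₁ x i zs (h (here refl)) (h ∘ there) e

    consec₁ x i []       xi h (_ , e) = contradiction e ι≢↑
    consec₁ x i (z ∷ zs) xi h e with view z
    ... | old y = ⊥-elim (no-short xi (h (here refl)))
    ... | new j rewrite olds-new j zs = consec₂ x i j zs xi (h (here refl)) (h ∘ there) e

    consec₂ x i j []       xi ij h (_ , e) = contradiction e ι≢↑
    consec₂ x i j (z ∷ zs) xi ij h e with view z
    ... | old y = subst₂ (Adj G) (sym (rail-next i xi)) (sym (next-rail j (h (here refl))))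
                    (corner-adj i j (new-next i j ij)) , consec y zs (h ∘ there) e
    ... | new k rewrite olds-new k zs = consec₃ x i j k zs xi ij (h (here refl)) (h ∘ there) e

    consec₃ x i j k []       xi ij jk h (_ , e) = contradiction e ι≢↑
    consec₃ x i j k (z ∷ zs) xi ij jk h e with view z
    ... | old y = ⊥-elim (no-three xi ij jk (h (here refl)))
    ... | new l rewrite olds-new l zs = consec₄ x i j k l zs xi ij jk (h (here refl)) (h ∘ there) e

    consec₄ x i j k l []       xi ij jk kl h (_ , e) = contradiction e ι≢↑
    consec₄ x i j k l (z ∷ zs) xi ij jk kl h e with view z
    ... | old y = subst₂ (Adj G) (sym (rail-next i xi)) (sym (next-rail l (h (here refl))))
                    (corner-adj i l (around i j k l (new-next i j ij) (new-next j k jk) (new-next k l kl)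
                      (λ { refl → no-2-cycle ij jk }) (λ { refl → no-2-cycle jk kl }))) ,
                  consec y zs (h ∘ there) e
    ... | new m = ⊥-elim (back (no-fifth i j k l m (new-next i j ij) (new-next j k jk) (new-next k l kl)
                      (λ { refl → no-2-cycle ij jk }) (λ { refl → no-2-cycle jk kl })
                      (new-next l m (h (here refl))) (λ { refl → no-2-cycle kl (h (here refl)) })))
      where
      back : m ≡ i → ⊥
      back refl = ι≢↑ (next-injective (h (here refl)) xi)

  two : ∀ {xs : List (Fin n)} → b ∈ xs → c ∈ xs → 2 ≤ length xs
  two {_ ∷ _ ∷ _} _           _           = s≤s (s≤s z≤n)
  two {_ ∷ []}    (here refl) (here refl) = contradiction refl b≢c

  contract : SpanningCycleOn G' S' → SpanningCycleOn G S
  contract C with startAt C (S⇒ Sa)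
  ... | record { first = .(↑ a) ; rest = ws ; long = long ; uniq = uniq ; cover = cover ; edges = edges } , refl = record
    { first = a
    ; rest  = olds ws
    -- Three corners belong to the old vertices covered, so the contracted cycle is not degenerate.
    ; long  = two (inside Sb a≢b) (inside Sc a≢c)
    ; uniq  = olds-unique uniq
    ; cover = λ v → S⇐ ∘ proj₁ (cover (↑ v)) ∘ olds-∈ (↑ a ∷ ws) , ∈-olds ∘ proj₂ (cover (↑ v)) ∘ S⇒
    ; edges = subst (λ l → Consec G (a ∷ l)) (olds-++ ws [ ↑ a ])
                (consec a (ws ++ [ ↑ a ]) (λ {u} {v} m → subst ((u , v) ∈_) (chain-snoc (↑ a ∷ ws) (↑ a)) m)
                  (endsOld (↑ a ∷ ws)))
    }
    where
    open Segments ws long uniq (λ i → proj₂ (cover (ι i)) (S'-new i))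
           (ConsecProperties.links⁻ G' (↑ a ∷ ws) (↑ a) edges)
    inside : ∀ {x} → S x → a ≢ x → x ∈ olds ws
    inside {x} Sx a≢x with ∈-olds (proj₂ (cover (↑ x)) (S⇒ Sx))
    ... | here refl = contradiction refl a≢x
    ... | there m   = m

-- Expanding Hamiltonian cycles

consec-map : ∀ {n n'} (G : Graph n) (G' : Graph n') (f : Fin n → Fin n') → (∀ {x y} → Adj G x y → Adj G' (f x) (f y)) →
             ∀ xs → Consec G xs → Consec G' (map f xs)
consec-map G G' f h []           c       = tt
consec-map G G' f h (x ∷ [])     c       = tt
consec-map G G' f h (x ∷ y ∷ xs) (e , c) = h e , consec-map G G' f h (y ∷ xs) c

consec-join : ∀ {n} (G : Graph n) xs {y z zs} → Consec G (xs ++ [ y ]) → Adj G y z → Consec G (z ∷ zs) →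
              Consec G ((xs ++ [ y ]) ++ z ∷ zs)
consec-join G []           c       e d = e , d
consec-join G (x ∷ [])     (f , c) e d = f , e , d
consec-join G (x ∷ w ∷ xs) (f , c) e d = f , consec-join G (w ∷ xs) c e d

Trail : ∀ {n} → Graph n → Fin n → Fin n → List (Fin n) → Set
Trail G x y xs = ∃[ mid ] xs ≡ x ∷ mid ++ [ y ] × Consec G xs

trail-map : ∀ {n n'} {G : Graph n} {G' : Graph n'} {f : Fin n → Fin n'} → (∀ {x y} → Adj G x y → Adj G' (f x) (f y)) →
            ∀ {x y xs} → Trail G x y xs → Trail G' (f x) (f y) (map f xs)
trail-map {G = G} {G'} {f} h {x} {y} (mid , refl , c) = map f mid , cong (f x ∷_) (map-++ f mid [ y ]) , consec-map G G' f h (x ∷ mid ++ [ y ]) c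

trail-cons : ∀ {n} {G : Graph n} {x y z xs} → Adj G z x → Trail G x y xs → Trail G z y (z ∷ xs)
trail-cons {x = x} e (mid , refl , c) = x ∷ mid , refl , e , c

trail-snoc : ∀ {n} {G : Graph n} {x y z xs} → Trail G x y xs → Adj G y z → Trail G x z (xs ++ [ z ])
trail-snoc {G = G} {x} {y} (mid , refl , c) e = mid ++ [ y ] , refl , consec-join G (x ∷ mid) c e tt

trail-cycle : ∀ {n} (G : Graph n) {x y xs v} → Trail G x y xs → Adj G y x → 4 ≤ n → v ∷ xs ↭ allFin n → HamiltonianMinus G v
trail-cycle {n} G {x} {y} {v = v} (mid , refl , c) e 4≤n perm = record
  { first = x
  ; rest  = mid ++ [ y ]
  ; long  = enough (≤-trans 4≤n (≤-reflexive (sym (trans (↭-length perm) (Data.List.Properties.length-tabulate id)))))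
  ; uniq  = tail uniq
  ; cover = λ u → (λ u∈ → λ { refl → All.lookup (head uniq) u∈ refl }) , λ u≢v → drop u≢v (∈-resp-↭ (↭-sym perm) (∈-allFin u))
  ; edges = consec-join G (x ∷ mid) c e tt
  }
  where
  enough : ∀ {l} → 4 ≤ suc (suc l) → 2 ≤ l
  enough (s≤s (s≤s h)) = h
  uniq : Unique (v ∷ x ∷ mid ++ [ y ])
  uniq = Unique-resp-↭ (↭-sym perm) (Uniqueₚ.allFin⁺ n)
  head : ∀ {z zs} → Unique {A = Fin n} (z ∷ zs) → All (z ≢_) zs
  head (p ∷ _) = p
  tail : ∀ {z zs} → Unique {A = Fin n} (z ∷ zs) → Unique zs
  tail (_ ∷ p) = p
  drop : ∀ {u zs} → u ≢ v → u ∈ v ∷ zs → u ∈ zs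
  drop u≢v (here e)  = contradiction e u≢v
  drop u≢v (there m) = m

-- The part outside the quadrilateral abcd of a Hamiltonian cycle of G − v that uses the edge ab only,
-- the edge cd only, or both of them.
module _ {n : ℕ} (H : Graph n) (a b c d : Fin n) where

  data Spans (v : Fin n) : Set where
    viaAB : ∀ {xs} → Trail H a b xs → v ∷ xs ↭ allFin n → Spans v
    viaCD : ∀ {xs} → Trail H d c xs → v ∷ xs ↭ allFin n → Spans v
    both  : ∀ {xs ys} → Trail H b c xs → Trail H d a ys → v ∷ xs ++ ys ↭ allFin n → Spans v

  AB CD : Fin n → Set
  AB v = ∃[ xs ] Trail H a b xs × v ∷ xs ↭ allFin n
  CD v = ∃[ xs ] Trail H d c xs × v ∷ xs ↭ allFin n

spans-cycle : ∀ {n} {H : Graph n} {a b c d v} (a≢b : a ≢ b) (c≢d : c ≢ d) → 4 ≤ n → Spans H a b c d v →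
              HamiltonianMinus (close H a≢b c≢d) v
spans-cycle {H = H} {a} {b} {c} {d} a≢b c≢d 4≤n s = go s
  where
  Hab G : Graph _
  Hab = addEdge H a b a≢b
  G = close H a≢b c≢d
  up : ∀ {x y} → Adj H x y → Adj G x y
  up e = addEdge-old Hab c≢d (addEdge-old H a≢b e)
  lift : ∀ {x y xs} → Trail H x y xs → Trail G x y xs
  lift {x} {y} {xs} (mid , refl , k) = mid , refl , subst (Consec G) (Data.List.Properties.map-id xs) (consec-map H G id up xs k)
  ab : Adj G a b
  ab = addEdge-old Hab c≢d (addEdge-new H a≢b)
  cd : Adj G c d
  cd = addEdge-new Hab c≢d
  go : ∀ {v} → Spans H a b c d v → HamiltonianMinus G v
  go (viaAB t p) = trail-cycle G (lift t) (flip-adj G ab) 4≤n p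
  go (viaCD t p) = trail-cycle G (lift t) cd 4≤n p
  go (both t u p) with lift t | lift u
  ... | m₁ , refl , k₁ | m₂ , refl , k₂ =
    trail-cycle G (m₁ ++ c ∷ d ∷ m₂ , cong (b ∷_) (trans (++-assoc m₁ [ c ] _) (sym (++-assoc m₁ (c ∷ d ∷ m₂) [ a ]))) ,
      consec-join G (b ∷ m₁) k₁ cd k₂) ab 4≤n p

-- Degree and connectivity, and the invariant of the operation

degree-addEdge : ∀ {n} (G : Graph n) {a b w} (a≢b : a ≢ b) → w ≢ a → w ≢ b → degree (addEdge G a b a≢b) w ≡ degree G w
degree-addEdge {n} G {a} {b} {w} a≢b w≢a w≢b = total-cong (allFin n) λ {u} _ → cong bit (away u)
  where
  away : ∀ u → adj (addEdge G a b a≢b) w u ≡ adj G w u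
  away u rewrite dec-false (w ≟ a) w≢a | dec-false (w ≟ b) w≢b with u ≟ a | u ≟ b | adj G w u
  ... | yes _ | _     | true  = refl
  ... | yes _ | _     | false = refl
  ... | no _  | _     | true  = refl
  ... | no _  | _     | false = refl

degree-addPendant : ∀ {n} (G : Graph n) {v w} → w ≢ v → degree (addPendant G v) (suc w) ≡ degree G w
degree-addPendant {n} G {v} {w} w≢v rewrite dec-false (w ≟ v) w≢v =
  trans (cong (total (bit ∘ adj (addPendant G v) (suc w))) (sym (map-tabulate id suc)))
        (total-map (bit ∘ adj (addPendant G v) (suc w)) suc (allFin n))

walk-trans : ∀ {n} {G : Graph n} {x y z} → Walk G x y → Walk G y z → Walk G x z
walk-trans (Walk.here _)   q = q
walk-trans (Walk.step e p) q = Walk.step e (walk-trans p q)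

walk-map : ∀ {n n'} {G : Graph n} {G' : Graph n'} {f : Fin n → Fin n'} → (∀ {x y} → Adj G x y → Adj G' (f x) (f y)) →
           ∀ {x y} → Walk G x y → Walk G' (f x) (f y)
walk-map h (Walk.here v)   = Walk.here _
walk-map h (Walk.step e p) = Walk.step (h e) (walk-map h p)

connected-addEdge : ∀ {n} {G : Graph n} {a b} (a≢b : a ≢ b) → Connected G → Connected (addEdge G a b a≢b)
connected-addEdge {G = G} a≢b con u v = walk-map (addEdge-old G a≢b) (con u v)

connected-addPendant : ∀ {n} {G : Graph n} v → Connected G → Connected (addPendant G v)
connected-addPendant {G = G} v con = go
  where
  G' = addPendant G v
  lift : ∀ x y → Walk G' (suc x) (suc y)
  lift x y = walk-map {G' = G'} (λ e → e) (con x y)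
  go : Connected G'
  go zero    zero    = Walk.here zero
  go zero    (suc y) = Walk.step {v = suc v} (==-refl v) (lift v y)
  go (suc x) zero    = walk-trans (lift x v) (Walk.step (==-refl v) (Walk.here zero))
  go (suc x) (suc y) = lift x y

record Extensible (n : ℕ) : Set where
  field
    H : Graph n
    a b c d w : Fin n
    a≢b : a ≢ b
    a≢c : a ≢ c
    b≢c : b ≢ c
    c≢d : c ≢ d
    d≢a : d ≢ a
    d≢b : d ≢ b
    w≢a : w ≢ a
    w≢b : w ≢ b
    w≢c : w ≢ c
    w≢d : w ≢ d
    bc  : Adj H b c
    da  : Adj H d a
    ¬ab : ¬ Adj H a b
    ¬cd : ¬ Adj H c d
    size       : 4 ≤ n
    connected  : Connected H
    cubic      : degree H w ≡ 3
    frame      : ∃[ P ] ∃[ Q ] ∃[ fs ] Frame H a b c d P Q fs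
    spans      : ∀ v → v ≢ w → Spans H a b c d v
    -- A cycle that misses a or b cannot use ab, and one that misses c or d cannot use cd. Here the
    -- opposite edge is required to occur, so that the cycle can be rerouted through the new
    -- quadrilateral.
    avoiding-a : CD H a b c d a
    avoiding-b : CD H a b c d b
    avoiding-c : AB H a b c d c
    avoiding-d : AB H a b c d d

  G : Graph n
  G = close H a≢b c≢d

  field
    ¬ham  : ¬ Hamiltonian G
    ¬ham⁻ : ¬ HamiltonianMinus G w

Witness : ℕ → Set
Witness n = Σ (Graph n) λ G → Σ (Fin n) λ w → Connected G × Planar G × AlmostHypohamiltonianWith G w × degree G w ≡ 3

witness : ∀ {n} → Extensible n → Witness n
witness E = G , w
  , connected-addEdge c≢d (connected-addEdge a≢b connected)
  , (let P , Q , fs , endP , endQ , emb = frame in planar (close-embedding H a≢b c≢d ¬ab ¬cd' endP endQ emb))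
  , (¬ham , ¬ham⁻ , λ v v≢w → spans-cycle a≢b c≢d size (spans v v≢w))
  , trans (degree-addEdge (addEdge H a b a≢b) c≢d w≢c w≢d) (trans (degree-addEdge H a≢b w≢a w≢b) cubic)
  where
  open Extensible E
  ¬cd' : ¬ Adj (addEdge H a b a≢b) c d
  ¬cd' t with addEdge-cases H a≢b t
  ... | inj₁ e                = ¬cd e
  ... | inj₂ (inj₁ (e , _))   = a≢c (sym e)
  ... | inj₂ (inj₂ (e , _))   = b≢c (sym e)

module Routes {n : ℕ} {H : Graph n} {a b c d : Fin n} (bc : Adj H b c) (da : Adj H d a) (H' : Graph (4 + n))
  (up : ∀ {x y} → Adj H x y → Adj H' (↑ x) (↑ y))
  (r₁ : Adj H' 1′ (↑ a)) (r₂ : Adj H' 2′ (↑ b)) (r₃ : Adj H' 3′ (↑ c)) (r₄ : Adj H' 4′ (↑ d))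
  (s₂₃ : Adj H' 2′ 3′) (s₄₁ : Adj H' 4′ 1′) where

  rev : ∀ {x y} → Adj H' x y → Adj H' y x
  rev = flip-adj H'

  raiseTrail : ∀ {x y xs} → Trail H x y xs → Trail H' (↑ x) (↑ y) (map ↑_ xs)
  raiseTrail = trail-map up

  open CMSolver (++-commutativeMonoid {A = Fin (4 + n)}) using (solve; _⊕_; _⊜_)

  one two three four : List (Fin (4 + n))
  one   = [ 1′ ]
  two   = [ 2′ ]
  three = [ 3′ ]
  four  = [ 4′ ]

  with-new : ∀ {v xs} → v ∷ xs ↭ allFin n → 1′ ∷ 2′ ∷ 3′ ∷ 4′ ∷ ↑ v ∷ map ↑_ xs ↭ allFin (4 + n)
  with-new p = prep 1′ (prep 2′ (prep 3′ (prep 4′ (↭-trans (↭-map⁺ ↑_ p) (↭-reflexive (map-tabulate id ↑_))))))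

  -- If ab is used alone, it becomes the detour a a' d' c' b' b over all new vertices, which
  -- contains c'd' but not a'b'; hence the two types are exchanged. If both edges are used, ab
  -- becomes a a' b' b and cd becomes c c' d' d.
  spans-old : ∀ {v} → Spans H a b c d v → Spans H' 1′ 2′ 3′ 4′ (↑ v)
  spans-old {v} (viaAB {xs} t p) = viaCD
    (trail-cons s₄₁ (trail-cons r₁ (trail-snoc (trail-snoc (raiseTrail t) (rev r₂)) s₂₃)))
    (↭-trans (solve 6 (λ v m i j k l → v ⊕ (l ⊕ (i ⊕ ((m ⊕ j) ⊕ k))) ⊜ i ⊕ (j ⊕ (k ⊕ (l ⊕ (v ⊕ m))))) ↭-refl
      [ ↑ v ] (map ↑_ xs) one two three four) (with-new p))
  spans-old {v} (viaCD {xs} t p) = viaAB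
    (trail-cons (rev s₄₁) (trail-cons r₄ (trail-snoc (trail-snoc (raiseTrail t) (rev r₃)) (rev s₂₃))))
    (↭-trans (solve 6 (λ v m i j k l → v ⊕ (i ⊕ (l ⊕ ((m ⊕ k) ⊕ j))) ⊜ i ⊕ (j ⊕ (k ⊕ (l ⊕ (v ⊕ m))))) ↭-refl
      [ ↑ v ] (map ↑_ xs) one two three four) (with-new p))
  spans-old {v} (both {xs} {ys} t u p) = both
    (trail-cons r₂ (trail-snoc (raiseTrail t) (rev r₃)))
    (trail-cons r₄ (trail-snoc (raiseTrail u) (rev r₁)))
    (↭-trans (solve 7 (λ v m m' i j k l → v ⊕ ((j ⊕ (m ⊕ k)) ⊕ (l ⊕ (m' ⊕ i))) ⊜ i ⊕ (j ⊕ (k ⊕ (l ⊕ (v ⊕ (m ⊕ m')))))) ↭-refl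
      [ ↑ v ] (map ↑_ xs) (map ↑_ ys) one two three four)
      (↭-trans (↭-reflexive (cong (λ l → 1′ ∷ 2′ ∷ 3′ ∷ 4′ ∷ ↑ v ∷ l) (sym (map-++ ↑_ xs ys)))) (with-new p)))

  -- In the cycle that misses b, the edge cd is replaced by c b b' c' d' d, which picks up b and
  -- every new vertex but a'. The other three corners are alike, and each time the old cycle misses
  -- the neighbour on ab or cd.
  avoiding-1 : CD H a b c d b → CD H' 1′ 2′ 3′ 4′ 1′
  avoiding-1 (xs , t , p) = _ ,
    trail-cons r₄ (trail-snoc (trail-snoc (trail-snoc (raiseTrail t) (up (flip-adj H bc))) (rev r₂)) s₂₃) ,
    ↭-trans (solve 6 (λ v m i j k l → i ⊕ (l ⊕ (((m ⊕ v) ⊕ j) ⊕ k)) ⊜ i ⊕ (j ⊕ (k ⊕ (l ⊕ (v ⊕ m))))) ↭-refl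
      [ ↑ b ] (map ↑_ xs) one two three four) (with-new p)

  avoiding-2 : CD H a b c d a → CD H' 1′ 2′ 3′ 4′ 2′
  avoiding-2 (xs , t , p) = _ ,
    trail-cons s₄₁ (trail-cons r₁ (trail-cons (up (flip-adj H da)) (trail-snoc (raiseTrail t) (rev r₃)))) ,
    ↭-trans (solve 6 (λ v m i j k l → j ⊕ (l ⊕ (i ⊕ (v ⊕ (m ⊕ k)))) ⊜ i ⊕ (j ⊕ (k ⊕ (l ⊕ (v ⊕ m))))) ↭-refl
      [ ↑ a ] (map ↑_ xs) one two three four) (with-new p)

  avoiding-3 : AB H a b c d d → AB H' 1′ 2′ 3′ 4′ 3′
  avoiding-3 (xs , t , p) = _ ,
    trail-cons (rev s₄₁) (trail-cons r₄ (trail-cons (up da) (trail-snoc (raiseTrail t) (rev r₂)))) ,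
    ↭-trans (solve 6 (λ v m i j k l → k ⊕ (i ⊕ (l ⊕ (v ⊕ (m ⊕ j)))) ⊜ i ⊕ (j ⊕ (k ⊕ (l ⊕ (v ⊕ m))))) ↭-refl
      [ ↑ d ] (map ↑_ xs) one two three four) (with-new p)

  avoiding-4 : AB H a b c d c → AB H' 1′ 2′ 3′ 4′ 4′
  avoiding-4 (xs , t , p) = _ ,
    trail-cons r₁ (trail-snoc (trail-snoc (trail-snoc (raiseTrail t) (up bc)) (rev r₃)) (rev s₂₃)) ,
    ↭-trans (solve 6 (λ v m i j k l → l ⊕ (i ⊕ (((m ⊕ v) ⊕ k) ⊕ j)) ⊜ i ⊕ (j ⊕ (k ⊕ (l ⊕ (v ⊕ m))))) ↭-refl
      [ ↑ c ] (map ↑_ xs) one two three four) (with-new p)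

module _ {n : ℕ} (E : Extensible n) where
  open Extensible E

  private
    K₀ K₁ H' : Graph (4 + n)
    K₀ = rails H a b c d
    K₁ = rung₁ H a b c d
    H' = extend H a b c d

    1≢2 : _≢_ {A = Fin (4 + n)} 1′ 2′
    1≢2 ()
    2≢3 : _≢_ {A = Fin (4 + n)} 2′ 3′
    2≢3 ()
    3≢4 : _≢_ {A = Fin (4 + n)} 3′ 4′
    3≢4 ()
    4≢1 : _≢_ {A = Fin (4 + n)} 4′ 1′
    4≢1 ()

    G' : Graph (4 + n)
    G' = close H' {1′} {2′} {3′} {4′} 1≢2 3≢4

    fromRails : ∀ x y → Adj K₀ x y → Adj H' x y
    fromRails x y e = addEdge-old K₁ {4′} {1′} 4≢1 {x} {y} (addEdge-old K₀ {2′} {3′} 2≢3 {x} {y} e)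

    s₂₃ : Adj H' 2′ 3′
    s₂₃ = addEdge-old K₁ {4′} {1′} 4≢1 {2′} {3′} (addEdge-new K₀ {2′} {3′} 2≢3)
    s₄₁ : Adj H' 4′ 1′
    s₄₁ = addEdge-new K₁ {4′} {1′} 4≢1

    module R = Routes {H = H} bc da H' (λ {x} {y} → fromRails (↑ x) (↑ y))
      (fromRails 1′ (↑ a) (==-refl (suc (suc (suc a))))) (fromRails 2′ (↑ b) (==-refl (suc (suc b))))
      (fromRails 3′ (↑ c) (==-refl (suc c))) (fromRails 4′ (↑ d) (==-refl d)) s₂₃ s₄₁

    spans' : ∀ v → v ≢ ↑ w → Spans H' 1′ 2′ 3′ 4′ v
    spans' 1′ _ = let _ , t , p = R.avoiding-1 avoiding-b in viaCD t p
    spans' 2′ _ = let _ , t , p = R.avoiding-2 avoiding-a in viaCD t p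
    spans' 3′ _ = let _ , t , p = R.avoiding-3 avoiding-d in viaAB t p
    spans' 4′ _ = let _ , t , p = R.avoiding-4 avoiding-c in viaAB t p
    spans' (suc (suc (suc (suc v)))) v≢w = R.spans-old (spans v λ e → v≢w (cong ↑_ e))

    corner : Fin 4 → Fin n
    corner 1′ = a
    corner 2′ = b
    corner 3′ = c
    corner 4′ = d

    -- The four edges of the new quadrilateral have no old ends, so an edge at an old vertex is an
    -- old edge or a rail.
    peel : ∀ x z → Adj G' (↑ x) z → Adj K₀ (↑ x) z
    peel x z t with addEdge-cases (addEdge H' 1′ 2′ 1≢2) {3′} {4′} 3≢4 {↑ x} {z} t
    ... | inj₂ (inj₁ (() , _))
    ... | inj₂ (inj₂ (() , _))
    ... | inj₁ t with addEdge-cases H' {1′} {2′} 1≢2 {↑ x} {z} t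
    ... | inj₂ (inj₁ (() , _))
    ... | inj₂ (inj₂ (() , _))
    ... | inj₁ t with addEdge-cases K₁ {4′} {1′} 4≢1 {↑ x} {z} t
    ... | inj₂ (inj₁ (() , _))
    ... | inj₂ (inj₂ (() , _))
    ... | inj₁ t with addEdge-cases K₀ {2′} {3′} 2≢3 {↑ x} {z} t
    ... | inj₂ (inj₁ (() , _))
    ... | inj₂ (inj₂ (() , _))
    ... | inj₁ t = t

    rail-adj : ∀ {x} i → Adj G' (↑ x) (ι i) → x ≡ corner i
    rail-adj {x} 1′ t = suc-injective (suc-injective (suc-injective (==-sound {x = suc (suc (suc x))} {suc (suc (suc a))} (peel x 1′ t))))
    rail-adj {x} 2′ t = suc-injective (suc-injective (==-sound {x = suc (suc x)} {suc (suc b)} (peel x 2′ t)))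
    rail-adj {x} 3′ t = suc-injective (==-sound {x = suc x} {suc c} (peel x 3′ t))
    rail-adj {x} 4′ t = ==-sound {x = x} {d} (peel x 4′ t)

    new-adj : ∀ i j → Adj G' (ι i) (ι j) → T (near i j)
    new-adj 1′ 1′ t = t
    new-adj 1′ 2′ t = t
    new-adj 1′ 3′ t = t
    new-adj 1′ 4′ t = t
    new-adj 2′ 1′ t = t
    new-adj 2′ 2′ t = t
    new-adj 2′ 3′ t = t
    new-adj 2′ 4′ t = t
    new-adj 3′ 1′ t = t
    new-adj 3′ 2′ t = t
    new-adj 3′ 3′ t = t
    new-adj 3′ 4′ t = t
    new-adj 4′ 1′ t = t
    new-adj 4′ 2′ t = t
    new-adj 4′ 3′ t = t
    new-adj 4′ 4′ t = t

    old-adj : ∀ {x y} → Adj H x y → Adj G x y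
    old-adj e = addEdge-old (addEdge H a b a≢b) c≢d (addEdge-old H a≢b e)

    ab : Adj G a b
    ab = addEdge-old (addEdge H a b a≢b) c≢d (addEdge-new H a≢b)
    cd : Adj G c d
    cd = addEdge-new (addEdge H a b a≢b) c≢d

    corner-adj : ∀ i j → T (near i j) → Adj G (corner i) (corner j)
    corner-adj 1′ 2′ _ = ab
    corner-adj 2′ 1′ _ = flip-adj G ab
    corner-adj 2′ 3′ _ = old-adj bc
    corner-adj 3′ 2′ _ = old-adj (flip-adj H bc)
    corner-adj 3′ 4′ _ = cd
    corner-adj 4′ 3′ _ = flip-adj G cd
    corner-adj 4′ 1′ _ = old-adj da
    corner-adj 1′ 4′ _ = old-adj (flip-adj H da)

    contracted : (S : Fin n → Set) (S' : Fin (4 + n) → Set) → (∀ i → S' (ι i)) → (∀ {x} → S x → S' (↑ x)) →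
                 (∀ {x} → S' (↑ x) → S x) → S a → S b → S c → SpanningCycleOn G' S' → SpanningCycleOn G S
    contracted S S' h to from Sa Sb Sc = Contract.contract G G' corner (λ {x} {y} t → old-adj (peel x (↑ y) t)) rail-adj new-adj
      corner-adj S S' h to from Sa Sb Sc a≢b a≢c b≢c

  extension : Extensible (4 + n)
  extension = record
    { H = H' ; a = 1′ ; b = 2′ ; c = 3′ ; d = 4′ ; w = ↑ w
    ; a≢b = 1≢2 ; a≢c = λ () ; b≢c = λ () ; c≢d = 3≢4 ; d≢a = λ () ; d≢b = λ ()
    ; w≢a = λ () ; w≢b = λ () ; w≢c = λ () ; w≢d = λ ()
    ; bc = s₂₃ ; da = s₄₁ ; ¬ab = λ () ; ¬cd = λ ()
    ; size = ≤-trans size (m≤n+m n 4)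
    ; connected = connected-addEdge {G = K₁} {4′} {1′} 4≢1 (connected-addEdge {G = K₀} {2′} {3′} 2≢3
                    (connected-addPendant {G = L₃} (suc (suc (suc a))) (connected-addPendant {G = L₂} (suc (suc b))
                    (connected-addPendant {G = L₁} (suc c) (connected-addPendant {G = H} d connected)))))
    ; cubic = trans (degree-addEdge K₁ {4′} {1′} {↑ w} 4≢1 (λ ()) (λ ())) (trans (degree-addEdge K₀ {2′} {3′} {↑ w} 2≢3 (λ ()) (λ ()))
              (trans (degree-addPendant L₃ {suc (suc (suc a))} {suc (suc (suc w))} (λ e → w≢a (suc-injective (suc-injective (suc-injective e)))))
              (trans (degree-addPendant L₂ {suc (suc b)} {suc (suc w)} (λ e → w≢b (suc-injective (suc-injective e))))
              (trans (degree-addPendant L₁ {suc c} {suc w} (λ e → w≢c (suc-injective e))) (trans (degree-addPendant H w≢d) cubic)))))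
    ; frame = let P , Q , fs , f = frame in extend-frame f
    ; spans = spans'
    ; avoiding-a = R.avoiding-1 avoiding-b
    ; avoiding-b = R.avoiding-2 avoiding-a
    ; avoiding-c = R.avoiding-3 avoiding-d
    ; avoiding-d = R.avoiding-4 avoiding-c
    ; ¬ham  = ¬ham ∘ contracted _ _ (λ _ → tt) id id tt tt tt
    ; ¬ham⁻ = ¬ham⁻ ∘ contracted _ _ (λ i → ι≢↑ {i = i}) (λ x≢w e → x≢w (↑-injective e)) (λ h e → h (cong ↑_ e))
                (w≢a ∘ sym) (w≢b ∘ sym) (w≢c ∘ sym)
    }
    where
    L₁ : Graph (1 + n)
    L₁ = addPendant H d
    L₂ : Graph (2 + n)
    L₂ = addPendant L₁ (suc c)
    L₃ : Graph (3 + n)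
    L₃ = addPendant L₂ (suc (suc b))
    ↑-injective : ∀ {x y : Fin n} → ↑ x ≡ ↑ y → x ≡ y
    ↑-injective e = suc-injective (suc-injective (suc-injective (suc-injective e)))

-- Checking explicit plane graphs

module _ {n : ℕ} (G : Graph n) where

  consec? : ∀ xs → Dec (Consec G xs)
  consec? []           = yes tt
  consec? (x ∷ [])     = yes tt
  consec? (x ∷ y ∷ xs) = T? (adj G x y) ×-dec consec? (y ∷ xs)

  consec-walk : ∀ x xs → Consec G (x ∷ xs) → ∀ {y} → y ∈ x ∷ xs → Walk G x y
  consec-walk x xs       c       (here refl) = Walk.here x
  consec-walk x (z ∷ xs) (e , c) (there m)   = Walk.step e (consec-walk z xs c m)

  walk-reverse : ∀ {x y} → Walk G x y → Walk G y x
  walk-reverse (Walk.here v)   = Walk.here v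
  walk-reverse (Walk.step e p) = walk-trans (walk-reverse p) (Walk.step (flip-adj G e) (Walk.here _))

  connected-from : ∀ r → (∀ v → Walk G r v) → Connected G
  connected-from r f u v = walk-trans (walk-reverse (f u)) (f v)

endsAt-links : ∀ {n} xs (z b : Fin n) → EndsAt (links (xs ++ [ z ]) b) b
endsAt-links xs z b = links xs z , z , links-++ xs z [] b

-- By the pigeonhole principle `xs` has no room for repetitions or for further entries.
cover-↭ : ∀ {A : Set} {xs ys : List A} → Unique ys → (∀ {y} → y ∈ ys → y ∈ xs) → length xs ≡ length ys → xs ↭ ys
cover-↭ {xs = []}    {[]}     _       _ _ = ↭-refl
cover-↭ {xs = _ ∷ _} {[]}     _       _ ()
cover-↭ {xs = xs}    {y ∷ ys} (y∉ ∷ u) h e with ∈-∃++ (h (here refl))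
... | as , bs , refl = ↭-trans (shift y as bs) (prep y (cover-↭ u rest (ℕ-suc-injective (trans (sym (↭-length (shift y as bs))) e))))
  where
  rest : ∀ {z} → z ∈ ys → z ∈ as ++ bs
  rest z∈ with ∈-resp-↭ (shift y as bs) (h (there z∈))
  ... | here refl = contradiction refl (All.lookup y∉ z∈)
  ... | there m   = m

-- Boolean tests, which evaluate faster than the decision procedures of the library.

_≡ᶠ_ : ∀ {n} → Fin n → Fin n → Bool
zero  ≡ᶠ zero  = true
zero  ≡ᶠ suc y = false
suc x ≡ᶠ zero  = false
suc x ≡ᶠ suc y = x ≡ᶠ y

_≡ᵈ_ : ∀ {n} → Dart n → Dart n → Bool
(u , v) ≡ᵈ (u' , v') = (u ≡ᶠ u') ∧ (v ≡ᶠ v')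

≡ᶠ-sound : ∀ {n} (x y : Fin n) → T (x ≡ᶠ y) → x ≡ y
≡ᶠ-sound zero    zero    t = refl
≡ᶠ-sound (suc x) (suc y) t = cong suc (≡ᶠ-sound x y t)

≡ᶠ-refl : ∀ {n} (x : Fin n) → T (x ≡ᶠ x)
≡ᶠ-refl zero    = tt
≡ᶠ-refl (suc x) = ≡ᶠ-refl x

≡ᵈ-sound : ∀ {n} (d e : Dart n) → T (d ≡ᵈ e) → d ≡ e
≡ᵈ-sound (u , v) (u' , v') t = let p , q = ∧-elim {u ≡ᶠ u'} t in cong₂ _,_ (≡ᶠ-sound u u' p) (≡ᶠ-sound v v' q)

≡ᵈ-refl : ∀ {n} (d : Dart n) → T (d ≡ᵈ d)
≡ᵈ-refl (u , v) = ∧-intro (≡ᶠ-refl u) (≡ᶠ-refl v)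

refute : ∀ {x} → T x → T (not x) → ⊥
refute {true} _ ()

allᶠ : ∀ {n} → (Fin n → Bool) → Bool
allᶠ {zero}  p = true
allᶠ {suc n} p = p zero ∧ allᶠ (p ∘ suc)

allᶠ-sound : ∀ {n} (p : Fin n → Bool) → T (allᶠ p) → ∀ i → T (p i)
allᶠ-sound p t zero    = proj₁ (∧-elim {p zero} t)
allᶠ-sound p t (suc i) = allᶠ-sound (p ∘ suc) (proj₂ (∧-elim {p zero} t)) i

all-sound : ∀ {A : Set} (p : A → Bool) xs → T (all p xs) → ∀ {x} → x ∈ xs → T (p x)
all-sound p xs t = All.lookup (Allₚ.all⁺ p xs t)

module Elem {A : Set} (_≈_ : A → A → Bool) (sound : ∀ x y → T (x ≈ y) → x ≡ y) (reflexive : ∀ x → T (x ≈ x)) where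

  elem : A → List A → Bool
  elem x []       = false
  elem x (y ∷ ys) = (x ≈ y) ∨ elem x ys

  elem-sound : ∀ x xs → T (elem x xs) → x ∈ xs
  elem-sound x (y ∷ ys) t with ∨-elim {x ≈ y} t
  ... | inj₁ e = here (sound x y e)
  ... | inj₂ m = there (elem-sound x ys m)

  elem-complete : ∀ {x xs} → x ∈ xs → T (elem x xs)
  elem-complete {x} (here refl)          = ∨-introˡ (reflexive x)
  elem-complete {x} {y ∷ ys} (there m)   = ∨-introʳ {x ≈ y} (elem-complete m)

  distinct : List A → Bool
  distinct []       = true
  distinct (x ∷ xs) = not (elem x xs) ∧ distinct xs

  distinct-sound : ∀ xs → T (distinct xs) → Unique xs
  distinct-sound []       t = []
  distinct-sound (x ∷ xs) t = let p , q = ∧-elim {not (elem x xs)} t in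
    All.tabulate (λ { y∈ refl → refute (elem-complete y∈) p }) ∷ distinct-sound xs q

module Elemᶠ {n : ℕ} = Elem (_≡ᶠ_ {n}) ≡ᶠ-sound ≡ᶠ-refl
module Elemᵈ {n : ℕ} = Elem (_≡ᵈ_ {n}) ≡ᵈ-sound ≡ᵈ-refl
module Elemⁿ = Elem _≡ᵇ_ ≡ᵇ⇒≡ (λ k → ≡⇒≡ᵇ k k refl)

-- A plane graph given by the cyclic lists of neighbours of its vertices.
module Table {n : ℕ} (row : Fin n → List (Fin n)) where
  open Elemᶠ {n}

  adjacent : Fin n → Fin n → Bool
  adjacent u v = elem v (row u)

  simple : Bool
  simple = allᶠ λ u → all (λ v → adjacent v u ∧ not (v ≡ᶠ u)) (row u)

  -- The first entry is carried along as `h`, to serve as the successor of the last one.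
  after : Fin n → List (Fin n) → Fin n → Fin n
  after h []           u = h
  after h (x ∷ [])     u = h
  after h (x ∷ y ∷ xs) u = if x ≡ᶠ u then y else after h (y ∷ xs) u

  turn : Fin n → Fin n → Fin n
  turn v u with row v
  ... | []     = u
  ... | x ∷ xs = after x (x ∷ xs) u

  reachesIn : ℕ → (f : Fin n → Fin n) (x y : Fin n) → Bool
  reachesIn zero    f x y = x ≡ᶠ y
  reachesIn (suc k) f x y = (x ≡ᶠ y) ∨ reachesIn k f (f x) y

  reachesIn-sound : ∀ k {f x y} → T (reachesIn k f x y) → Reaches f x y
  reachesIn-sound zero {x = x} {y} t with ≡ᶠ-sound x y t
  ... | refl = stop
  reachesIn-sound (suc k) {x = x} {y} t with ∨-elim {x ≡ᶠ y} t
  ... | inj₁ e with ≡ᶠ-sound x y e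
  ...   | refl = stop
  reachesIn-sound (suc k) t | inj₂ r = move (reachesIn-sound k r)

  -- Six steps go around every vertex of degree at most seven; the degrees below are at most four.
  goodPair : (v u u' : Fin n) → Bool
  goodPair v u u' = (not (turn v u ≡ᶠ turn v u') ∨ (u ≡ᶠ u')) ∧ reachesIn 6 (turn v) u u'

  goodTurn : (v u : Fin n) → Bool
  goodTurn v u = elem (turn v u) (row v) ∧ all (goodPair v u) (row v)

  φ : Dart n → Dart n
  φ (u , v) = v , turn v u

  orbit : List (Dart n) → Bool
  orbit []       = false
  orbit (x ∷ xs) = all (λ e → φ (proj₁ e) ≡ᵈ proj₂ e) (links (x ∷ xs) x)

  orbit-sound : ∀ X → T (orbit X) → Orbit φ X
  orbit-sound (x ∷ xs) t = All.tabulate λ {e} e∈ → ≡ᵈ-sound (φ (proj₁ e)) (proj₂ e) (all-sound _ (links (x ∷ xs) x) t e∈)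

  Plane : ℕ → List (List (Dart n)) → Set
  Plane m faces =
    T (allᶠ λ v → all (goodTurn v) (row v)) ×
    T (all orbit faces) ×
    T (Elemᵈ.distinct (concat faces)) ×
    T (all (λ d → adjacent (proj₁ d) (proj₂ d)) (concat faces)) ×
    T (allᶠ λ u → all (λ v → Elemᵈ.elem (u , v) (concat faces)) (row u)) ×
    (m + length faces) * 2 ≡ length (concat faces) + 4

  plane? : ∀ m faces → Dec (Plane m faces)
  plane? m faces = T? _ ×-dec T? _ ×-dec T? _ ×-dec T? _ ×-dec T? _ ×-dec ((m + length faces) * 2 ≟ℕ length (concat faces) + 4)

  module _ (ok : T simple) where

    adj-row : ∀ {u v} → T (adjacent u v) → v ∈ row u
    adj-row {u} {v} = elem-sound v (row u)

    private
      ok-pair : ∀ {u v} → v ∈ row u → T (adjacent v u) × T (not (v ≡ᶠ u))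
      ok-pair {u} {v} v∈ = ∧-elim {adjacent v u} (all-sound _ (row u) (allᶠ-sound _ ok u) v∈)

      bool-ext : ∀ {x y} → (T x → T y) → (T y → T x) → x ≡ y
      bool-ext {true}  {true}  f g = refl
      bool-ext {true}  {false} f g = ⊥-elim (f tt)
      bool-ext {false} {true}  f g = ⊥-elim (g tt)
      bool-ext {false} {false} f g = refl

    graph : Graph n
    graph = record
      { adj    = adjacent
      ; sym    = λ u v → bool-ext (proj₁ ∘ ok-pair ∘ adj-row {u} {v}) (proj₁ ∘ ok-pair ∘ adj-row {v} {u})
      ; irrefl = λ v → bool-ext (λ t → refute (≡ᶠ-refl v) (proj₂ (ok-pair (adj-row {v} {v} t)))) (λ ())
      }

    plane-embedding : ∀ {m faces} → Plane m faces → Embedding m graph faces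
    plane-embedding {m} {faces} (cyc , orb , uniq , snd , cmp , eul) = record
      { rotation = rotationSystem turn cyclicOn
      ; orbits   = All.tabulate λ {X} X∈ → orbit-sound X (all-sound orbit faces orb X∈)
      ; unique   = Elemᵈ.distinct-sound (concat faces) uniq
      ; sound    = all-sound _ (concat faces) snd
      ; complete = λ {u} {v} a → Elemᵈ.elem-sound (u , v) (concat faces) (all-sound _ (row u) (allᶠ-sound _ cmp u) (adj-row {u} {v} a))
      ; euler    = eul
      }
      where
      good : ∀ v {u} → T (adjacent v u) → T (goodTurn v u)
      good v {u} a = all-sound (goodTurn v) (row v) (allᶠ-sound _ cyc v) (adj-row {v} {u} a)
      pair : ∀ v {u u'} → T (adjacent v u) → T (adjacent v u') → T (goodPair v u u')
      pair v {u} {u'} a b = all-sound (goodPair v u) (row v) (proj₂ (∧-elim {elem (turn v u) (row v)} (good v a))) (adj-row {v} {u'} b)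
      cyclicOn : ∀ v → CyclicOn (Adj graph v) (turn v)
      cyclicOn v = record
        { closed = λ {u} a → proj₁ (∧-elim {elem (turn v u) (row v)} (good v {u} a))
        ; inj    = λ {u} {u'} a b e → injective u u' (proj₁ (∧-elim {not (turn v u ≡ᶠ turn v u') ∨ (u ≡ᶠ u')} (pair v {u} {u'} a b))) e
        ; reach  = λ {u} {u'} a b → reachesIn-sound 6 (proj₂ (∧-elim {not (turn v u ≡ᶠ turn v u') ∨ (u ≡ᶠ u')} (pair v {u} {u'} a b)))
        }
        where
        injective : ∀ u u' → T (not (turn v u ≡ᶠ turn v u') ∨ (u ≡ᶠ u')) → turn v u ≡ turn v u' → u ≡ u'
        injective u u' t e with ∨-elim {not (turn v u ≡ᶠ turn v u')} t
        ... | inj₁ no-turn = ⊥-elim (refute (subst (λ z → T (turn v u ≡ᶠ z)) e (≡ᶠ-refl (turn v u))) no-turn)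
        ... | inj₂ same    = ≡ᶠ-sound u u' same

-- Grinberg's criterion modulo 3

total-scale : ∀ {A : Set} (f g : A → ℕ) c xs → All (λ x → f x ≡ c) xs → total (λ x → f x * g x) xs ≡ c * total g xs
total-scale f g c []       []       = *-comm 0 c
total-scale f g c (x ∷ xs) (e ∷ es) rewrite e | total-scale f g c xs es =
  sym (*-distribˡ-+ c (g x) (total g xs))

no-third : ∀ k t → 3 * k + 2 ≢ 3 * t
no-third zero    (suc t) e with () ← trans e (*-suc 3 t)
no-third (suc k) zero    e with () ← trans (sym (cong (_+ 2) (*-suc 3 k))) e
no-third (suc k) (suc t) e = no-third k t (ℕ-suc-injective (ℕ-suc-injective (ℕ-suc-injective
  (trans (sym (cong (_+ 2) (*-suc 3 k))) (trans e (*-suc 3 t))))))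

onSide-≡ : ∀ x b → x ≡ b → ⟦ x ≟ᵇ b ⟧ ≡ 1
onSide-≡ x b e = ⟦⟧-yes (x ≟ᵇ b) e

onSide-≢ : ∀ x b → x ≢ b → ⟦ x ≟ᵇ b ⟧ ≡ 0
onSide-≢ x b e = ⟦⟧-no (x ≟ᵇ b) e

-- By Grinberg's criterion the side of a Hamiltonian cycle away from the quadrilateral Q
-- contains k pentagons with 5k = n + 2k − 2, which is impossible when 3 divides n.
pentagons-¬ham : ∀ {n t} {G : Graph n} {Q fs} → n ≡ 3 * t → Embedding n G (Q ∷ fs) →
                 All (λ X → length X ≡ 5) fs → ¬ Hamiltonian G
pentagons-¬ham {n} {t} {G} {Q} {fs} n≡3t emb five C = contra
  where
  open SpanningCycleOn C
  verts-↭ : first ∷ rest ↭ allFin n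
  verts-↭ = unique-↭ uniq (Uniqueₚ.allFin⁺ n) (λ {v} _ → ∈-allFin v) (λ {v} _ → proj₂ (cover v) tt)
  open Grinberg emb first rest long uniq edges (λ {u} _ → proj₂ (cover u) tt)
         (sym (trans (↭-length verts-↭) (length-tabulate id)))
  b : Bool
  b = not (faceSide side Q)
  k : ℕ
  k = total (onSide b) fs
  away : onSide b Q ≡ 0
  away = onSide-≢ (faceSide side Q) b (x≢not-x (faceSide side Q))
    where
    x≢not-x : ∀ x → x ≢ not x
    x≢not-x true  ()
    x≢not-x false ()
  open +-*-Solver using (solve; _:+_; _:*_; _:=_; con)
  -- Grinberg's formula reads 5k + 2 = n + 2k here; 2k is split off on both sides in order to be
  -- cancelled.
  tally : 3 * k + 2 + k * 2 ≡ 3 * t + k * 2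
  tally = trans (solve 1 (λ k → con 3 :* k :+ con 2 :+ k :* con 2 := con 5 :* k :+ con 2) refl k)
    (trans (cong (_+ 2) (sym (cong₂ _+_ (trans (cong (length Q *_) away) (*-zeroʳ (length Q)))
                                      (total-scale length (onSide b) 5 fs five))))
    (trans (criterion b) (cong₂ _+_ n≡3t (cong (_* 2) (cong (_+ k) away)))))
  contra : ⊥
  contra = no-third k t (+-cancelʳ-≡ (k * 2) _ _ tally)

-- K is G − w. Its vertex a has no neighbours but b and d, so every Hamiltonian cycle of K passes through the edge ab,
-- which separates the quadrilateral Q from the face M that replaces the three pentagons at w.
pentagons-¬ham⁻ : ∀ {m t} {G K : Graph (suc m)} {w a b d : Fin (suc m)} {Q M fs} → suc m ≡ 3 * t → Embedding m K (Q ∷ M ∷ fs) →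
  length Q ≡ 4 → All (λ X → length X ≡ 5) fs → (a , b) ∈ Q → (b , a) ∈ M → a ≢ w →
  (∀ u v → Adj G u v → u ≢ w → v ≢ w → Adj K u v) → (∀ u v → Adj K u v → u ≢ w) →
  (∀ v → Adj K a v → v ≡ b ⊎ v ≡ d) → ¬ HamiltonianMinus G w
pentagons-¬ham⁻ {m} {t} {G} {K} {w} {a} {b} {d} {Q} {M} {fs} n≡3t emb four five ab∈ ba∈ a≢w restrict avoid only C = contra
  where
  open SpanningCycleOn C
  verts-↭ : w ∷ first ∷ rest ↭ allFin (suc m)
  verts-↭ = unique-↭ (All.tabulate (λ { w∈ refl → proj₁ (cover w) w∈ refl }) ∷ uniq) (Uniqueₚ.allFin⁺ (suc m))
    (λ {v} _ → ∈-allFin v) (λ {v} _ → member v)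
    where
    member : ∀ v → v ∈ w ∷ first ∷ rest
    member v with same? v w
    ... | inj₁ refl = here refl
    ... | inj₂ v≢w  = there (proj₂ (cover v) v≢w)
  edges' : Consec K (first ∷ rest ++ first ∷ [])
  edges' = ConsecProperties.links⁺ K (first ∷ rest) first λ {u} {v} e →
    restrict u v (ConsecProperties.links⁻ G (first ∷ rest) first edges e)
      (proj₁ (cover u) (proj₁ (links-∈ (first ∷ rest) first e)))
      (proj₁ (cover v) (target (proj₂ (links-∈ (first ∷ rest) first e))))
    where
    target : ∀ {v} → v ∈ first ∷ rest ⊎ v ≡ first → v ∈ first ∷ rest
    target (inj₁ v∈)  = v∈
    target (inj₂ refl) = here refl
  open Grinberg emb first rest long uniq edges' (λ {u} {v} e → proj₂ (cover u) (avoid u v e))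
         (ℕ-suc-injective (sym (trans (↭-length verts-↭) (length-tabulate id))))
  true≢false : true ≢ false
  true≢false ()
  -- The predecessor and the successor of `a` are among `b` and `d` and cannot coincide, so one of
  -- them is `b`, and the two darts of a cycle edge lie on different sides.
  separated : side (a , b) ≢ side (b , a)
  separated with next (proj₂ (cover a) a≢w) | prev (proj₂ (cover a) a≢w)
  ... | s , as | p , pa with only s (next-adj as) | only p (flip (next-adj pa))
  ... | inj₁ refl | _         = λ e → true≢false (trans (sym (proj₁ (side-arc as))) (trans e (proj₂ (side-arc as))))
  ... | inj₂ refl | inj₁ refl = λ e → true≢false (trans (sym (proj₁ (side-arc pa))) (trans (sym e) (proj₂ (side-arc pa))))
  ... | inj₂ refl | inj₂ refl = ⊥-elim (no-2-cycle as pa)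
  q : Bool
  q = faceSide side Q
  k : ℕ
  k = total (onSide q) fs
  onQ : onSide q Q ≡ 1
  onQ = onSide-≡ q q refl
  onM : onSide q M ≡ 0
  onM = onSide-≢ (faceSide side M) q λ e →
    separated (trans (side-face (here refl) ab∈) (trans (sym e) (sym (side-face (there (here refl)) ba∈))))
  open +-*-Solver using (solve; _:+_; _:*_; _:=_; con)
  -- Grinberg's formula for the side of `Q` reads 4 + 5k + 2 = m + 2(1 + k). It is rearranged so
  -- that the order m + 1 of G, a multiple of 3, appears on the right.
  tally : 3 * (suc k) + 2 + (k * 2 + 1) ≡ 3 * t + (k * 2 + 1)
  tally = trans (solve 1 (λ k → con 3 :* (con 1 :+ k) :+ con 2 :+ (k :* con 2 :+ con 1) := (con 4 :+ con 5 :* k :+ con 2)) refl k)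
    (trans (cong (_+ 2) (sym (cong₂ _+_ (cong₂ _*_ four onQ)
        (cong₂ _+_ (trans (cong (length M *_) onM) (*-zeroʳ (length M))) (total-scale length (onSide q) 5 fs five)))))
    (trans (criterion q) (trans (cong₂ (λ x y → m + (x + (y + k)) * 2) onQ onM)
    (trans (solve 2 (λ m k → m :+ (con 1 :+ k) :* con 2 := con 1 :+ m :+ (k :* con 2 :+ con 1)) refl m k) (cong (_+ (k * 2 + 1)) n≡3t)))))
  contra : ⊥
  contra = no-third (suc k) t (+-cancelʳ-≡ (k * 2 + 1) _ _ tally)

-- Base graphs from numerical data

Distinct : ∀ {n} → (a b c d w : Fin n) → Set
Distinct a b c d w = Unique (a ∷ b ∷ c ∷ d ∷ w ∷ [])

Local : ∀ {n} → Graph n → (a b c d w : Fin n) → Set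
Local {n} H a b c d w = Adj H b c × Adj H d a × ¬ Adj H a b × ¬ Adj H c d × 4 ≤ n × degree H w ≡ 3

local? : ∀ {n} (H : Graph n) (a b c d w : Fin n) → Dec (Local H a b c d w)
local? {n} H a b c d w = T? _ ×-dec T? _ ×-dec ¬? (T? _) ×-dec ¬? (T? _) ×-dec (4 ≤? n) ×-dec (degree H w ≟ℕ 3)

module Assemble {m t : ℕ} (H K : Graph (suc m)) (a b c d w : Fin (suc m)) {P Q quad merged : List (Dart (suc m))}
  {restH restK : List (List (Dart (suc m)))} (endP : EndsAt P b) (endQ : EndsAt Q d) (3∣n : suc m ≡ 3 * t)
  (embH : Embedding (suc m) H ((P ++ (b , c) ∷ Q ++ [ d , a ]) ∷ restH))
  (fiveH : All (λ X → length X ≡ 5) ((Q ++ [ d , c ]) ∷ (P ++ [ b , a ]) ∷ restH))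
  (embK : Embedding m K (quad ∷ merged ∷ restK))
  (fourK : length quad ≡ 4) (fiveK : All (λ X → length X ≡ 5) restK)
  (ab∈ : (a , b) ∈ quad) (ba∈ : (b , a) ∈ merged)
  (restrict : ∀ u v → T ((adj H u v ∨ joined a b u v) ∨ joined c d u v) → u ≢ w → v ≢ w → Adj K u v)
  (avoid : ∀ u v → Adj K u v → u ≢ w) (only : ∀ v → Adj K a v → v ≡ b ⊎ v ≡ d)
  (spanning : ∀ v → v ≢ w → Spans H a b c d v)
  (path-a : CD H a b c d a) (path-b : CD H a b c d b) (path-c : AB H a b c d c) (path-d : AB H a b c d d) where

  assemble : Distinct a b c d w → Local H a b c d w → Extensible (suc m)
  assemble ((a≢b ∷ a≢c ∷ a≢d ∷ a≢w ∷ []) ∷ (b≢c ∷ b≢d ∷ b≢w ∷ []) ∷ (c≢d ∷ c≢w ∷ []) ∷ (d≢w ∷ []) ∷ [] ∷ [])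
           (bc , da , ¬ab , ¬cd , size , cubic) = record
    { H = H ; a = a ; b = b ; c = c ; d = d ; w = w
    ; a≢b = a≢b ; a≢c = a≢c ; b≢c = b≢c ; c≢d = c≢d ; d≢a = a≢d ∘ sym ; d≢b = b≢d ∘ sym
    ; w≢a = a≢w ∘ sym ; w≢b = b≢w ∘ sym ; w≢c = c≢w ∘ sym ; w≢d = d≢w ∘ sym
    ; bc = bc ; da = da ; ¬ab = ¬ab ; ¬cd = ¬cd ; size = size
    ; connected = connected-from H d fromD
    ; cubic = cubic
    ; frame = P , Q , restH , endP , endQ , embH
    ; spans = spanning
    ; avoiding-a = path-a
    ; avoiding-b = path-b
    ; avoiding-c = path-c
    ; avoiding-d = path-d
    ; ¬ham  = pentagons-¬ham {t = t} 3∣n (close-embedding H a≢b c≢d ¬ab ¬cd' endP endQ embH) fiveH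
    ; ¬ham⁻ = pentagons-¬ham⁻ {t = t} 3∣n embK fourK fiveK ab∈ ba∈ a≢w restrict avoid only
    }
    where
    -- The path from `d` to `c` misses only `a`, which is a neighbour of `d`; this makes H
    -- connected.
    fromD′ : CD H a b c d a → ∀ v → Walk H d v
    fromD′ (l , (mid , refl , con) , perm) v with ∈-resp-↭ (↭-sym perm) (∈-allFin v)
    ... | here refl = Walk.step da (Walk.here a)
    ... | there v∈  = consec-walk H d (mid ++ [ c ]) con v∈
    fromD : ∀ v → Walk H d v
    fromD = fromD′ path-a
    ¬cd' : ¬ Adj (addEdge H a b a≢b) c d
    ¬cd' e with addEdge-cases H a≢b e
    ... | inj₁ e'              = ¬cd e'
    ... | inj₂ (inj₁ (e' , _)) = a≢c (sym e')
    ... | inj₂ (inj₂ (e' , _)) = b≢c (sym e')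

-- The inner vertices of a path are written as a numeral: a digit 1 followed by two decimal digits for each vertex.
digits : ℕ → ℕ → List ℕ → List ℕ
digits zero       k acc = acc
-- The leading 1 protects the zeros of a one-digit first vertex, and reaching it ends the decoding.
-- Reading from the right while consing restores the order.
digits (suc fuel) k acc = if k ≡ᵇ 1 then acc else digits fuel (k / 100) (k % 100 ∷ acc)

data Route : Set where
  ab cd : ℕ → Route
  both  : ℕ → ℕ → Route

inner : Route → ℕ
inner (ab xs)     = xs
inner (cd xs)     = xs
inner (both xs _) = xs

-- Numbers beyond m are sent to m.
fin : ∀ {m} → ℕ → Fin (suc m)
fin {zero}  _       = zero
fin {suc m} zero    = zero
fin {suc m} (suc k) = suc (fin k)

-- A plane graph on the vertices 0, …, m with the face 0123, pentagonal faces otherwise, and the exceptional vertex 4.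
-- near₁ and near₁-last are the four vertices met from 0 on along the pentagon at 4 beside the edge 01, and likewise
-- opposite from 2 on along the pentagon beside 23. near₂ and near₃ are the other pentagons at 4, and deleting 4
-- leaves the face merged in place of the three.
record Plan (m : ℕ) : Set where
  field
    rotations               : Vec (List ℕ) (suc m)
    near₁ opposite          : List ℕ
    near₁-last opposite-last : ℕ
    near₂ near₃ merged      : List ℕ
    others                  : List (List ℕ)
    routes                  : Vec Route (suc m)

fin-toℕ : ∀ {m} (x : Fin (suc m)) → fin (toℕ x) ≡ x
fin-toℕ {zero}  zero    = refl
fin-toℕ {suc m} zero    = refl
fin-toℕ {suc m} (suc x) = cong suc (fin-toℕ x)

joined-cases : ∀ {n} (x y u v : Fin n) → T (joined x y u v) → (u ≡ x × v ≡ y) ⊎ (u ≡ y × v ≡ x)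
joined-cases x y u v t with ∨-elim {(u == x) ∧ (v == y)} t
... | inj₁ e = let p , q = ∧-elim {u == x} e in inj₁ (==-sound {x = u} {x} p , ==-sound {x = v} {y} q)
... | inj₂ e = let p , q = ∧-elim {v == x} e in inj₂ (==-sound {x = u} {y} q , ==-sound {x = v} {x} p)

module Restriction {n : ℕ} (rowH rowK : Fin n → List (Fin n)) (a b c d w : Fin n) where

  kept : Fin n → Fin n → Bool
  kept u v = (u ≡ᶠ w) ∨ (v ≡ᶠ w) ∨ Table.adjacent rowK u v

  kept-sound : ∀ u v → T (kept u v) → u ≢ w → v ≢ w → T (Table.adjacent rowK u v)
  kept-sound u v k u≢w v≢w with ∨-elim {u ≡ᶠ w} k
  ... | inj₁ e = contradiction (≡ᶠ-sound u w e) u≢w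
  ... | inj₂ k with ∨-elim {v ≡ᶠ w} k
  ...   | inj₁ e = contradiction (≡ᶠ-sound v w e) v≢w
  ...   | inj₂ e = e

  -- The closed graph has the edges of H and, besides, only ab and cd, so four further darts
  -- complete the test of the rows.
  restrict : T (allᶠ λ u → all (kept u) (rowH u)) → T (kept a b) → T (kept b a) → T (kept c d) → T (kept d c) →
             ∀ u v → T ((Table.adjacent rowH u v ∨ joined a b u v) ∨ joined c d u v) → T (kept u v)
  restrict keptH kab kba kcd kdc u v t with ∨-elim {Table.adjacent rowH u v ∨ joined a b u v} t
  ... | inj₂ j with joined-cases c d u v j
  ...   | inj₁ (refl , refl) = kcd
  ...   | inj₂ (refl , refl) = kdc
  restrict keptH kab kba kcd kdc u v t | inj₁ t' with ∨-elim {Table.adjacent rowH u v} t'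
  ... | inj₁ e = all-sound (kept u) (rowH u) (allᶠ-sound (λ u → all (kept u) (rowH u)) keptH u) (Elemᶠ.elem-sound v (rowH u) e)
  ... | inj₂ j with joined-cases a b u v j
  ...   | inj₁ (refl , refl) = kab
  ...   | inj₂ (refl , refl) = kba

  avoids : T (allᶠ λ u → all (λ _ → not (u ≡ᶠ w)) (rowK u)) → ∀ u v → T (Table.adjacent rowK u v) → u ≢ w
  avoids avoid u v e refl = refute (≡ᶠ-refl w) (all-sound (λ _ → not (u ≡ᶠ w)) (rowK u)
    (allᶠ-sound (λ u → all (λ _ → not (u ≡ᶠ w)) (rowK u)) avoid u) (Elemᶠ.elem-sound v (rowK u) e))

  among : T (all (λ v → (v ≡ᶠ b) ∨ (v ≡ᶠ d)) (rowK a)) → ∀ v → T (Table.adjacent rowK a v) → v ≡ b ⊎ v ≡ d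
  among only v e with ∨-elim {v ≡ᶠ b} (all-sound (λ v → (v ≡ᶠ b) ∨ (v ≡ᶠ d)) (rowK a) only (Elemᶠ.elem-sound v (rowK a) e))
  ... | inj₁ x = inj₁ (≡ᶠ-sound v b x)
  ... | inj₂ x = inj₂ (≡ᶠ-sound v d x)

module Base {m : ℕ} (plan : Plan m) (t : ℕ) where
  open Plan plan
  private
    Vertex : Set
    Vertex = Fin (suc m)

  a b c d w : Vertex
  a = fin 0
  b = fin 1
  c = fin 2
  d = fin 3
  w = fin 4

  cut : Vertex → Vertex → Bool
  cut u v = ((u ≡ᶠ a) ∧ (v ≡ᶠ b)) ∨ ((u ≡ᶠ b) ∧ (v ≡ᶠ a)) ∨ ((u ≡ᶠ c) ∧ (v ≡ᶠ d)) ∨ ((u ≡ᶠ d) ∧ (v ≡ᶠ c))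

  -- One table of G serves both graphs: striking neighbours from a cyclic list leaves the rotation
  -- of the subgraph, for H without ab and cd and for K without `w`.
  row rowH rowK : Vertex → List Vertex
  row u  = map fin (lookup rotations u)
  rowH u = filterᵇ (λ v → not (cut u v)) (row u)
  rowK u = if u ≡ᶠ w then [] else filterᵇ (λ v → not (v ≡ᶠ w)) (row u)

  open DecUnique (_≟_ {suc m}) using (unique?)

  module TH = Table rowH
  module TK = Table rowK

  face : List ℕ → List (Dart (suc m))
  face []       = []
  face (x ∷ xs) = links (map fin (x ∷ xs)) (fin x)

  walk : ℕ → ℕ → ℕ → List ℕ
  walk x k y = x ∷ digits (suc m) k [] ++ [ y ]

  P Q quad : List (Dart (suc m))
  P = links (map fin near₁ ++ [ fin near₁-last ]) b
  Q = links (map fin opposite ++ [ fin opposite-last ]) d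
  quad = face (0 ∷ 1 ∷ 2 ∷ 3 ∷ [])

  -- K keeps the edge cd, so the pentagon on `Q` is a face of it. The pentagon on `P` is absent from
  -- `restK` because, like `near₂` and `near₃`, it has gone into `merged`.
  restH restK : List (List (Dart (suc m)))
  restH = face near₂ ∷ face near₃ ∷ map face others
  restK = (Q ++ [ d , c ]) ∷ map face others

  Covering : List ℕ → Set
  Covering ks = T (all (λ i → Elemⁿ.elem i ks) (upTo (suc m))) × length ks ≡ suc m

  covering? : ∀ ks → Dec (Covering ks)
  covering? ks = T? _ ×-dec (length ks ≟ℕ suc m)

  covering-↭ : ∀ v ks → Covering (toℕ v ∷ ks) → v ∷ map fin ks ↭ allFin (suc m)
  covering-↭ v ks (all-in , len) = subst (λ x → x ∷ map fin ks ↭ allFin (suc m)) (fin-toℕ v)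
    (cover-↭ (Uniqueₚ.allFin⁺ (suc m)) (λ {u} _ → subst (_∈ map fin (toℕ v ∷ ks)) (fin-toℕ u) (∈-map⁺ fin
        (Elemⁿ.elem-sound (toℕ u) (toℕ v ∷ ks) (all-sound _ (upTo (suc m)) all-in (∈-upTo⁺ (toℕ<n u))))))
      (trans (length-map fin (toℕ v ∷ ks)) (trans len (sym (length-tabulate id)))))

  module _ (simpleH : T TH.simple) (simpleK : T TK.simple) where

    H K : Graph (suc m)
    H = TH.graph simpleH
    K = TK.graph simpleK

    Runs : ℕ → ℕ → ℕ → Vertex → Set
    Runs x y k v = Consec H (map fin (walk x k y)) × Covering (toℕ v ∷ walk x k y)

    runs? : ∀ x y k v → Dec (Runs x y k v)
    runs? x y k v = consec? H (map fin (walk x k y)) ×-dec covering? (toℕ v ∷ walk x k y)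

    ValidRoute : Vertex → Route → Set
    ValidRoute v (ab k)     = Runs 0 1 k v
    ValidRoute v (cd k)     = Runs 3 2 k v
    ValidRoute v (both k l) = Consec H (map fin (walk 1 k 2)) × Consec H (map fin (walk 3 l 0)) ×
                              Covering (toℕ v ∷ walk 1 k 2 ++ walk 3 l 0)

    validRoute? : ∀ v r → Dec (ValidRoute v r)
    validRoute? v (ab k)     = runs? 0 1 k v
    validRoute? v (cd k)     = runs? 3 2 k v
    validRoute? v (both k l) = consec? H (map fin (walk 1 k 2)) ×-dec consec? H (map fin (walk 3 l 0)) ×-dec
                               covering? (toℕ v ∷ walk 1 k 2 ++ walk 3 l 0)

    PlaneH : Set
    PlaneH = TH.Plane (suc m) ((P ++ (b , c) ∷ Q ++ [ d , a ]) ∷ restH) ×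
             All (λ X → length X ≡ 5) ((Q ++ [ d , c ]) ∷ (P ++ [ b , a ]) ∷ restH) × suc m ≡ 3 * t

    planeH? : Dec PlaneH
    planeH? = TH.plane? (suc m) ((P ++ (b , c) ∷ Q ++ [ d , a ]) ∷ restH) ×-dec
              All.all? (λ X → length X ≟ℕ 5) _ ×-dec (suc m ≟ℕ 3 * t)

    open Restriction rowH rowK a b c d w

    PlaneK : Set
    PlaneK = TK.Plane m (quad ∷ face merged ∷ restK) × length quad ≡ 4 × All (λ X → length X ≡ 5) restK ×
      T (Elemᵈ.elem (a , b) quad) × T (Elemᵈ.elem (b , a) (face merged)) ×
      T (allᶠ λ u → all (kept u) (rowH u)) × T (kept a b) × T (kept b a) × T (kept c d) × T (kept d c) ×
      T (allᶠ λ u → all (λ _ → not (u ≡ᶠ w)) (rowK u)) × T (all (λ v → (v ≡ᶠ b) ∨ (v ≡ᶠ d)) (rowK a))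

    planeK? : Dec PlaneK
    planeK? = TK.plane? m (quad ∷ face merged ∷ restK) ×-dec (length quad ≟ℕ 4) ×-dec
      All.all? (λ X → length X ≟ℕ 5) _ ×-dec T? _ ×-dec T? _ ×-dec T? _ ×-dec T? _ ×-dec T? _ ×-dec T? _ ×-dec
      T? _ ×-dec T? _ ×-dec T? _

    Routed : Set
    Routed = (∀ v → v ≢ w → ValidRoute v (lookup routes v)) ×
      -- The routes of the corners double as the paths of the `avoiding` fields, which fixes their
      -- ends: from d to c for a and b, and from a to b for c and d.
      Runs 3 2 (inner (lookup routes a)) a × Runs 3 2 (inner (lookup routes b)) b ×
      Runs 0 1 (inner (lookup routes c)) c × Runs 0 1 (inner (lookup routes d)) d

    routed? : Dec Routed
    routed? = all? (λ v → ¬? (v ≟ w) →-dec validRoute? v (lookup routes v)) ×-dec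
      runs? 3 2 (inner (lookup routes a)) a ×-dec runs? 3 2 (inner (lookup routes b)) b ×-dec
      runs? 0 1 (inner (lookup routes c)) c ×-dec runs? 0 1 (inner (lookup routes d)) d

    extensible : True (unique? (a ∷ b ∷ c ∷ d ∷ w ∷ [])) → True (local? H a b c d w) → True planeH? →
                 True planeK? → True routed? → Extensible (suc m)
    extensible dis loc pH pK rt = finish (toWitness {a? = planeH?} pH) (toWitness {a? = planeK?} pK) (toWitness {a? = routed?} rt)
      where
      trail : ∀ x y k → Consec H (map fin (walk x k y)) → Trail H (fin x) (fin y) (map fin (walk x k y))
      trail x y k con = map fin (digits (suc m) k []) , cong (fin x ∷_) (map-++ fin (digits (suc m) k []) [ y ]) , con
      running : ∀ x y k v → Runs x y k v → ∃[ l ] Trail H (fin x) (fin y) l × v ∷ l ↭ allFin (suc m)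
      running x y k v (con , cov) = map fin (walk x k y) , trail x y k con , covering-↭ v (walk x k y) cov
      spanning : ∀ v r → ValidRoute v r → Spans H a b c d v
      spanning v (ab k) ok = let _ , tr , p = running 0 1 k v ok in viaAB tr p
      spanning v (cd k) ok = let _ , tr , p = running 3 2 k v ok in viaCD tr p
      spanning v (both k l) (con₁ , con₂ , cov) = both (trail 1 2 k con₁) (trail 3 0 l con₂)
        (subst (λ z → v ∷ z ↭ allFin (suc m)) (map-++ fin (walk 1 k 2) (walk 3 l 0)) (covering-↭ v (walk 1 k 2 ++ walk 3 l 0) cov))
      finish : PlaneH → PlaneK → Routed → Extensible (suc m)
      finish (plH , fiveH , 3∣n)
             (plK , four , fiveK , ab∈ , ba∈ , keptH , kept-ab , kept-ba , kept-cd , kept-dc , avoid , only) (routed , ra , rb , rc , rd) =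
        Assemble.assemble {m} {t} H K a b c d w {P} {Q} {quad} {face merged} {restH} {restK}
          (endsAt-links (map fin near₁) (fin near₁-last) b) (endsAt-links (map fin opposite) (fin opposite-last) d) 3∣n
          (TH.plane-embedding simpleH plH) fiveH (TK.plane-embedding simpleK plK) four fiveK
          (Elemᵈ.elem-sound (a , b) quad ab∈) (Elemᵈ.elem-sound (b , a) (face merged) ba∈)
          (λ u v e → kept-sound u v (restrict keptH kept-ab kept-ba kept-cd kept-dc u v e)) (avoids avoid) (among only)
          (λ v v≢w → spanning v (lookup routes v) (routed v v≢w))
          (running 3 2 (inner (lookup routes a)) a ra) (running 3 2 (inner (lookup routes b)) b rb)
          (running 0 1 (inner (lookup routes c)) c rc) (running 0 1 (inner (lookup routes d)) d rd)
          (toWitness {a? = unique? (a ∷ b ∷ c ∷ d ∷ w ∷ [])} dis) (toWitness {a? = local? H a b c d w} loc)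

-- The four graphs

-- The faces are the quadrilateral and 22 pentagons, which makes 57 edges, and 36 - 57 + 23 = 2. The
-- three larger graphs have 24, 26 and 28 pentagons.
plan36 : Plan 35
plan36 = record
  { rotations =
        (1 ∷ 4 ∷ 3 ∷ [])
      ∷ (0 ∷ 2 ∷ 29 ∷ 5 ∷ [])
      ∷ (1 ∷ 3 ∷ 19 ∷ 28 ∷ [])
      ∷ (0 ∷ 8 ∷ 17 ∷ 2 ∷ [])
      ∷ (0 ∷ 6 ∷ 7 ∷ [])
      ∷ (1 ∷ 31 ∷ 6 ∷ [])
      ∷ (9 ∷ 4 ∷ 5 ∷ [])
      ∷ (10 ∷ 8 ∷ 4 ∷ [])
      ∷ (3 ∷ 7 ∷ 16 ∷ [])
      ∷ (34 ∷ 11 ∷ 10 ∷ 6 ∷ [])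
      ∷ (9 ∷ 13 ∷ 7 ∷ [])
      ∷ (9 ∷ 35 ∷ 12 ∷ [])
      ∷ (13 ∷ 11 ∷ 23 ∷ 14 ∷ [])
      ∷ (10 ∷ 12 ∷ 16 ∷ [])
      ∷ (12 ∷ 20 ∷ 15 ∷ [])
      ∷ (17 ∷ 16 ∷ 14 ∷ [])
      ∷ (13 ∷ 15 ∷ 8 ∷ [])
      ∷ (3 ∷ 15 ∷ 18 ∷ [])
      ∷ (17 ∷ 20 ∷ 19 ∷ [])
      ∷ (18 ∷ 22 ∷ 2 ∷ [])
      ∷ (18 ∷ 14 ∷ 21 ∷ [])
      ∷ (22 ∷ 20 ∷ 23 ∷ [])
      ∷ (19 ∷ 21 ∷ 25 ∷ [])
      ∷ (12 ∷ 24 ∷ 21 ∷ [])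
      ∷ (25 ∷ 23 ∷ 35 ∷ 26 ∷ [])
      ∷ (22 ∷ 24 ∷ 28 ∷ [])
      ∷ (27 ∷ 24 ∷ 32 ∷ [])
      ∷ (28 ∷ 26 ∷ 29 ∷ [])
      ∷ (25 ∷ 27 ∷ 2 ∷ [])
      ∷ (1 ∷ 27 ∷ 30 ∷ [])
      ∷ (32 ∷ 31 ∷ 29 ∷ [])
      ∷ (30 ∷ 34 ∷ 5 ∷ [])
      ∷ (26 ∷ 33 ∷ 30 ∷ [])
      ∷ (32 ∷ 35 ∷ 34 ∷ [])
      ∷ (31 ∷ 33 ∷ 9 ∷ [])
      ∷ (11 ∷ 33 ∷ 24 ∷ [])
      ∷ []
  ; near₁ = 0 ∷ 4 ∷ 6 ∷ [] ; near₁-last = 5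
  ; opposite = 2 ∷ 19 ∷ 18 ∷ [] ; opposite-last = 17
  ; near₂ = 0 ∷ 3 ∷ 8 ∷ 7 ∷ 4 ∷ []
  ; near₃ = 4 ∷ 7 ∷ 10 ∷ 9 ∷ 6 ∷ []
  ; merged = 1 ∷ 0 ∷ 3 ∷ 8 ∷ 7 ∷ 10 ∷ 9 ∷ 6 ∷ 5 ∷ []
  ; others =
        (1 ∷ 29 ∷ 27 ∷ 28 ∷ 2 ∷ [])
      ∷ (1 ∷ 5 ∷ 31 ∷ 30 ∷ 29 ∷ [])
      ∷ (2 ∷ 28 ∷ 25 ∷ 22 ∷ 19 ∷ [])
      ∷ (3 ∷ 17 ∷ 15 ∷ 16 ∷ 8 ∷ [])
      ∷ (5 ∷ 6 ∷ 9 ∷ 34 ∷ 31 ∷ [])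
      ∷ (7 ∷ 8 ∷ 16 ∷ 13 ∷ 10 ∷ [])
      ∷ (9 ∷ 11 ∷ 35 ∷ 33 ∷ 34 ∷ [])
      ∷ (9 ∷ 10 ∷ 13 ∷ 12 ∷ 11 ∷ [])
      ∷ (11 ∷ 12 ∷ 23 ∷ 24 ∷ 35 ∷ [])
      ∷ (12 ∷ 13 ∷ 16 ∷ 15 ∷ 14 ∷ [])
      ∷ (12 ∷ 14 ∷ 20 ∷ 21 ∷ 23 ∷ [])
      ∷ (14 ∷ 15 ∷ 17 ∷ 18 ∷ 20 ∷ [])
      ∷ (18 ∷ 19 ∷ 22 ∷ 21 ∷ 20 ∷ [])
      ∷ (21 ∷ 22 ∷ 25 ∷ 24 ∷ 23 ∷ [])
      ∷ (24 ∷ 25 ∷ 28 ∷ 27 ∷ 26 ∷ [])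
      ∷ (24 ∷ 26 ∷ 32 ∷ 33 ∷ 35 ∷ [])
      ∷ (26 ∷ 27 ∷ 29 ∷ 30 ∷ 32 ∷ [])
      ∷ (30 ∷ 31 ∷ 34 ∷ 33 ∷ 32 ∷ [])
      ∷ []
  ; routes =
        cd 1171516080704060501292726323031343335110910131214201819222123242528
      ∷ cd 1000406053130292726323334091007081613121135242321201415171819222528
      ∷ ab 1031718192225282729303134333226243511091013122321201415160807040605
      ∷ ab 1040708161310090605313433351112232426323029272825222120141517181902
      -- This is the entry of the exceptional vertex: the numeral 1 encodes an empty path and only
      -- fills the place.
      ∷ ab 1
      ∷ cd 1000406091007081613121135333431303226242321201415171819222528272901
      ∷ cd 1000407081613100911121415171820212324353334310501293032262728252219
      ∷ ab 1040605313433351109101312232426323029272825222120141516080317181902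
      ∷ both 1050609113524263233343130292728252219 117182021231214151613100704
      ∷ ab 1040605313433351112232426323029272825222120141516131007080317181902
      ∷ ab 1031715142018190228272632333409113524252221231213160807040605313029
      ∷ ab 1040710090605313433352426323029272825222123121316080317151420181902
      ∷ ab 1040605313409113533323029272624232120141516131007080317181922252802
      ∷ ab 1040710090605313433351112232426323029272825222120141516080317181902
      ∷ ab 1031715160807040605313029272632333409101312113524232120181922252802
      ∷ both 1293032262728252423212219 117182014121316080710091135333431050604
      ∷ ab 1030807040605313433351109101312232426323029272825222120141517181902
      ∷ ab 1030807040605313433352426323029272825222123121109101316151420181902
      ∷ ab 1031715142021231211352426323334091013160807040605313029272825221902
      ∷ ab 1040605313409113533323029272624231214151613100708031718202122252802
      ∷ cd 1000406050129272632303134333511091007081613121415171819222123242528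
      ∷ ab 1031718201415160807040605313433351109101312232425221902282726323029
      ∷ cd 1000406050129272825242632303134333511091007081613122321201415171819
      ∷ ab 1030807040605313029272632333409101316151718192221201412113524252802
      ∷ ab 1031715142018190228252221231211353332262729303134091013160807040605
      ∷ ab 1031718192221201415160807040605313433351109101312232426323029272802
      ∷ ab 1030807040605313409101316151718192225242321201412113533323029272802
      ∷ ab 1030807040605313433351109101316151718190228252221201412232426323029
      ∷ cd 1000406050129272632303134333511091007081613121415171820212324252219
      ∷ ab 1030816131007040609343335111214151718202123242522190228272632303105
      ∷ cd 1000406053134091007081613121135333226242321201415171819222528272901
      ∷ ab 1031715142018190228252221231211352426272930323334091013160807040605
      ∷ ab 1031715142018190228272624252221231211353334091013160807040605313029
      ∷ cd 1000406050129272632303134091007081613121135242321201415171819222528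
      ∷ ab 1040605313029272825222120141516131223242632333511091007080317181902
      ∷ ab 1040710131608031715142018190228272624252221231211090605313433323029
      ∷ []
  }

extensible36 : Extensible 36
-- The number 12 is a third of the order. The underscores are the tests of the plan, which evaluate
-- to the unit type.
extensible36 = Base.extensible plan36 12 _ _ _ _ _ _ _

plan39 : Plan 38
plan39 = record
  { rotations =
        (1 ∷ 4 ∷ 3 ∷ [])
      ∷ (0 ∷ 2 ∷ 29 ∷ 5 ∷ [])
      ∷ (1 ∷ 3 ∷ 19 ∷ 28 ∷ [])
      ∷ (0 ∷ 8 ∷ 17 ∷ 2 ∷ [])
      ∷ (0 ∷ 6 ∷ 7 ∷ [])
      ∷ (1 ∷ 31 ∷ 6 ∷ [])
      ∷ (9 ∷ 4 ∷ 5 ∷ [])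
      ∷ (10 ∷ 8 ∷ 4 ∷ [])
      ∷ (3 ∷ 7 ∷ 16 ∷ [])
      ∷ (11 ∷ 10 ∷ 6 ∷ [])
      ∷ (9 ∷ 13 ∷ 7 ∷ [])
      ∷ (31 ∷ 33 ∷ 12 ∷ 9 ∷ [])
      ∷ (11 ∷ 14 ∷ 13 ∷ [])
      ∷ (10 ∷ 12 ∷ 16 ∷ [])
      ∷ (12 ∷ 34 ∷ 15 ∷ [])
      ∷ (17 ∷ 16 ∷ 14 ∷ [])
      ∷ (13 ∷ 15 ∷ 8 ∷ [])
      ∷ (3 ∷ 15 ∷ 38 ∷ 18 ∷ [])
      ∷ (17 ∷ 20 ∷ 19 ∷ [])
      ∷ (18 ∷ 22 ∷ 2 ∷ [])
      ∷ (18 ∷ 37 ∷ 21 ∷ [])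
      ∷ (22 ∷ 20 ∷ 23 ∷ [])
      ∷ (19 ∷ 21 ∷ 25 ∷ [])
      ∷ (36 ∷ 24 ∷ 21 ∷ [])
      ∷ (25 ∷ 23 ∷ 26 ∷ [])
      ∷ (22 ∷ 24 ∷ 28 ∷ [])
      ∷ (27 ∷ 24 ∷ 35 ∷ 32 ∷ [])
      ∷ (28 ∷ 26 ∷ 29 ∷ [])
      ∷ (25 ∷ 27 ∷ 2 ∷ [])
      ∷ (1 ∷ 27 ∷ 30 ∷ [])
      ∷ (32 ∷ 31 ∷ 29 ∷ [])
      ∷ (30 ∷ 11 ∷ 5 ∷ [])
      ∷ (26 ∷ 33 ∷ 30 ∷ [])
      ∷ (32 ∷ 34 ∷ 11 ∷ [])
      ∷ (14 ∷ 33 ∷ 35 ∷ 38 ∷ [])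
      ∷ (26 ∷ 36 ∷ 34 ∷ [])
      ∷ (35 ∷ 23 ∷ 37 ∷ [])
      ∷ (36 ∷ 20 ∷ 38 ∷ [])
      ∷ (17 ∷ 34 ∷ 37 ∷ [])
      ∷ []
  ; near₁ = 0 ∷ 4 ∷ 6 ∷ [] ; near₁-last = 5
  ; opposite = 2 ∷ 19 ∷ 18 ∷ [] ; opposite-last = 17
  ; near₂ = 0 ∷ 3 ∷ 8 ∷ 7 ∷ 4 ∷ []
  ; near₃ = 4 ∷ 7 ∷ 10 ∷ 9 ∷ 6 ∷ []
  ; merged = 1 ∷ 0 ∷ 3 ∷ 8 ∷ 7 ∷ 10 ∷ 9 ∷ 6 ∷ 5 ∷ []
  ; others =
        (1 ∷ 29 ∷ 27 ∷ 28 ∷ 2 ∷ [])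
      ∷ (1 ∷ 5 ∷ 31 ∷ 30 ∷ 29 ∷ [])
      ∷ (2 ∷ 28 ∷ 25 ∷ 22 ∷ 19 ∷ [])
      ∷ (3 ∷ 17 ∷ 15 ∷ 16 ∷ 8 ∷ [])
      ∷ (5 ∷ 6 ∷ 9 ∷ 11 ∷ 31 ∷ [])
      ∷ (7 ∷ 8 ∷ 16 ∷ 13 ∷ 10 ∷ [])
      ∷ (9 ∷ 10 ∷ 13 ∷ 12 ∷ 11 ∷ [])
      ∷ (11 ∷ 33 ∷ 32 ∷ 30 ∷ 31 ∷ [])
      ∷ (11 ∷ 12 ∷ 14 ∷ 34 ∷ 33 ∷ [])
      ∷ (12 ∷ 13 ∷ 16 ∷ 15 ∷ 14 ∷ [])
      ∷ (14 ∷ 15 ∷ 17 ∷ 38 ∷ 34 ∷ [])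
      ∷ (17 ∷ 18 ∷ 20 ∷ 37 ∷ 38 ∷ [])
      ∷ (18 ∷ 19 ∷ 22 ∷ 21 ∷ 20 ∷ [])
      ∷ (20 ∷ 21 ∷ 23 ∷ 36 ∷ 37 ∷ [])
      ∷ (21 ∷ 22 ∷ 25 ∷ 24 ∷ 23 ∷ [])
      ∷ (23 ∷ 24 ∷ 26 ∷ 35 ∷ 36 ∷ [])
      ∷ (24 ∷ 25 ∷ 28 ∷ 27 ∷ 26 ∷ [])
      ∷ (26 ∷ 27 ∷ 29 ∷ 30 ∷ 32 ∷ [])
      ∷ (26 ∷ 32 ∷ 33 ∷ 34 ∷ 35 ∷ [])
      ∷ (34 ∷ 38 ∷ 37 ∷ 36 ∷ 35 ∷ [])
      ∷ []
  ; routes =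
        cd 1081613121415171819222524263536232120373834333230311109100704060501292728
      ∷ cd 1000406053130292728252221203738343536232426323311091007081613121415171819
      ∷ ab 1031738373635343311091013121415160807040605313032262423212018192225282729
      ∷ ab 1040605313029272825222120373834353623242632331109100708161312141517181902
      ∷ ab 1
      ∷ cd 1000406091007081613121131303233341415173837201819222123363526242528272901
      ∷ cd 1000407081613100911121415171819222120373834333230310501292726353623242528
      ∷ ab 1040605311109101312141516080317383736232426353433323029272825222120181902
      ∷ both 1292728 117181922252426353623212037383414151613121133323031050609100704
      ∷ ab 1040605311112141516131007080317383736232426353433323029272825222120181902
      ∷ ab 1030807040609111213161514343332263536232425222120373817181902282729303105
      ∷ cd 1000406091007081613121415171819222120373834333230310501292726353623242528
      ∷ ab 1030816131007040609113332262425222123363534141517383720181902282729303105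
      ∷ ab 1040710090605311112141516080317383736232426353433323029272825222120181902
      ∷ ab 1031715160807040609101312113332263534383736232425222120181902282729303105
      ∷ ab 1030816131214343536232426323311091007040605313029272825222120373817181902
      ∷ ab 1030807040605313029272825222120373834353623242632331109101312141517181902
      ∷ ab 1030816151412131007040609113332263534383736232425222120181902282729303105
      ∷ ab 1030807040605313032333414121109101316151738372021221902282524233635262729
      ∷ ab 1031718203738343536232122252426323311091013121415160807040605313029272802
      ∷ cd 1000406050129272825222123242635363738343332303111091007081613121415171819
      ∷ ab 1031718203738343536232426323311091013121415160807040605313029272825221902
      ∷ cd 1000406050129272825242635362321203738343332303111091007081613121415171819
      ∷ ab 1030807040605313032333414121109101316151738373635262425222120181902282729
      ∷ ab 1031718202123363738343526323311091013121415160807040605313029272825221902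
      ∷ ab 1031738343536372018192221232426323311091013121415160807040605313029272802
      ∷ cd 1000406053130323311091007081613121415171819222120373834353623242528272901
      ∷ ab 1031738343536372018190228252221232426323311091013121415160807040605313029
      ∷ cd 1000406050129272624252221233635343332303111091007081613121415173837201819
      ∷ ab 1031738373623242522212018190228272635343332303111091013121415160807040605
      ∷ cd 1000406053111091007081613121415171819222120373834333226353623242528272901
      ∷ ab 1031738343536372018190228252221232426272930323311091013121415160807040605
      ∷ ab 1030816131214151738373635343311091007040605313029272624232120181922252802
      ∷ ab 1031738373623242522212018190228272930322635341415160807040609101312113105
      ∷ ab 1030816151412131007040609113332263536232425222120373817181902282729303105
      ∷ ab 1031718202123363738343332262425221902282729303111091013121415160807040605
      ∷ ab 1040710131214151608031718192225242321203738343526323311090605313029272802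
      ∷ ab 1030816131214151738343311091007040605313032263536232425222120181902282729
      ∷ ab 1031715141211091013160807040605313032333435363720181902282522212324262729
      ∷ []
  }

extensible39 : Extensible 39
extensible39 = Base.extensible plan39 13 _ _ _ _ _ _ _

plan42 : Plan 41
plan42 = record
  { rotations =
        (1 ∷ 4 ∷ 3 ∷ [])
      ∷ (0 ∷ 2 ∷ 20 ∷ 5 ∷ [])
      ∷ (1 ∷ 3 ∷ 17 ∷ 15 ∷ [])
      ∷ (0 ∷ 8 ∷ 21 ∷ 2 ∷ [])
      ∷ (0 ∷ 6 ∷ 7 ∷ [])
      ∷ (1 ∷ 28 ∷ 6 ∷ [])
      ∷ (9 ∷ 4 ∷ 5 ∷ [])
      ∷ (10 ∷ 8 ∷ 4 ∷ [])
      ∷ (3 ∷ 7 ∷ 41 ∷ 25 ∷ [])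
      ∷ (34 ∷ 11 ∷ 10 ∷ 6 ∷ [])
      ∷ (9 ∷ 13 ∷ 7 ∷ [])
      ∷ (9 ∷ 37 ∷ 12 ∷ [])
      ∷ (11 ∷ 14 ∷ 13 ∷ [])
      ∷ (16 ∷ 41 ∷ 10 ∷ 12 ∷ [])
      ∷ (15 ∷ 12 ∷ 23 ∷ [])
      ∷ (16 ∷ 14 ∷ 18 ∷ 2 ∷ [])
      ∷ (19 ∷ 39 ∷ 13 ∷ 15 ∷ [])
      ∷ (22 ∷ 19 ∷ 2 ∷ [])
      ∷ (15 ∷ 24 ∷ 20 ∷ [])
      ∷ (17 ∷ 36 ∷ 16 ∷ [])
      ∷ (1 ∷ 18 ∷ 27 ∷ [])
      ∷ (3 ∷ 26 ∷ 22 ∷ [])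
      ∷ (21 ∷ 38 ∷ 17 ∷ [])
      ∷ (24 ∷ 14 ∷ 37 ∷ [])
      ∷ (18 ∷ 23 ∷ 31 ∷ [])
      ∷ (29 ∷ 26 ∷ 8 ∷ [])
      ∷ (21 ∷ 25 ∷ 33 ∷ [])
      ∷ (31 ∷ 28 ∷ 20 ∷ [])
      ∷ (27 ∷ 34 ∷ 5 ∷ [])
      ∷ (40 ∷ 30 ∷ 25 ∷ [])
      ∷ (29 ∷ 35 ∷ 33 ∷ [])
      ∷ (24 ∷ 32 ∷ 27 ∷ [])
      ∷ (31 ∷ 37 ∷ 34 ∷ [])
      ∷ (30 ∷ 38 ∷ 26 ∷ [])
      ∷ (28 ∷ 32 ∷ 9 ∷ [])
      ∷ (30 ∷ 39 ∷ 36 ∷ [])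
      ∷ (19 ∷ 38 ∷ 35 ∷ [])
      ∷ (11 ∷ 32 ∷ 23 ∷ [])
      ∷ (22 ∷ 33 ∷ 36 ∷ [])
      ∷ (16 ∷ 35 ∷ 40 ∷ [])
      ∷ (41 ∷ 39 ∷ 29 ∷ [])
      ∷ (13 ∷ 40 ∷ 8 ∷ [])
      ∷ []
  ; near₁ = 0 ∷ 4 ∷ 6 ∷ [] ; near₁-last = 5
  ; opposite = 2 ∷ 17 ∷ 22 ∷ [] ; opposite-last = 21
  ; near₂ = 0 ∷ 3 ∷ 8 ∷ 7 ∷ 4 ∷ []
  ; near₃ = 4 ∷ 7 ∷ 10 ∷ 9 ∷ 6 ∷ []
  ; merged = 1 ∷ 0 ∷ 3 ∷ 8 ∷ 7 ∷ 10 ∷ 9 ∷ 6 ∷ 5 ∷ []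
  ; others =
        (1 ∷ 20 ∷ 18 ∷ 15 ∷ 2 ∷ [])
      ∷ (1 ∷ 5 ∷ 28 ∷ 27 ∷ 20 ∷ [])
      ∷ (2 ∷ 15 ∷ 16 ∷ 19 ∷ 17 ∷ [])
      ∷ (3 ∷ 21 ∷ 26 ∷ 25 ∷ 8 ∷ [])
      ∷ (5 ∷ 6 ∷ 9 ∷ 34 ∷ 28 ∷ [])
      ∷ (7 ∷ 8 ∷ 41 ∷ 13 ∷ 10 ∷ [])
      ∷ (8 ∷ 25 ∷ 29 ∷ 40 ∷ 41 ∷ [])
      ∷ (9 ∷ 11 ∷ 37 ∷ 32 ∷ 34 ∷ [])
      ∷ (9 ∷ 10 ∷ 13 ∷ 12 ∷ 11 ∷ [])
      ∷ (11 ∷ 12 ∷ 14 ∷ 23 ∷ 37 ∷ [])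
      ∷ (12 ∷ 13 ∷ 16 ∷ 15 ∷ 14 ∷ [])
      ∷ (13 ∷ 41 ∷ 40 ∷ 39 ∷ 16 ∷ [])
      ∷ (14 ∷ 15 ∷ 18 ∷ 24 ∷ 23 ∷ [])
      ∷ (16 ∷ 39 ∷ 35 ∷ 36 ∷ 19 ∷ [])
      ∷ (17 ∷ 19 ∷ 36 ∷ 38 ∷ 22 ∷ [])
      ∷ (18 ∷ 20 ∷ 27 ∷ 31 ∷ 24 ∷ [])
      ∷ (21 ∷ 22 ∷ 38 ∷ 33 ∷ 26 ∷ [])
      ∷ (23 ∷ 24 ∷ 31 ∷ 32 ∷ 37 ∷ [])
      ∷ (25 ∷ 26 ∷ 33 ∷ 30 ∷ 29 ∷ [])
      ∷ (27 ∷ 28 ∷ 34 ∷ 32 ∷ 31 ∷ [])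
      ∷ (29 ∷ 30 ∷ 35 ∷ 39 ∷ 40 ∷ [])
      ∷ (30 ∷ 33 ∷ 38 ∷ 36 ∷ 35 ∷ [])
      ∷ []
  ; routes =
        cd 1080704060501201824231412113732312728340910134140292526212217193638333035391615
      ∷ cd 1000406052827201824313234091007082526212217191639353638333029404113121137231415
      ∷ ab 1032126333822171936353029250807040605282731242314121137323409101341403916151820
      ∷ ab 1040708411310090605283432312720182423371112141516394029252621223833303536191702
      ∷ ab 1
      ∷ cd 1000406091007082526212217191639353638333029404113121137231415182431323428272001
      ∷ cd 1000407100911121423373234280501202731241815161341082526212238333029403935361917
      ∷ ab 1040605283432372324312720181514121109101316394041080321223833262529303536191702
      ∷ both 1 121221719363833262529303539404113161514121137232418202731323428050609100704
      ∷ ab 1040605283432312720182423371112141516394041131007080321223833262529303536191702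
      ∷ ab 1032122170215182431323409113723141213161936383326252930353940410807040605282720
      ∷ ab 1040710090605283432372314121341402930332625080321223836353916191702151824312720
      ∷ ab 1032122171916394029303536383326250841131007040605282720182431323409113723141502
      ∷ ab 1040710090605283432312720182423371112141516394041080321223833262529303536191702
      ∷ ab 1032122170215161936383326252930353940410807040609101312113723241820273132342805
      ∷ cd 1000406050120182423141211373231272834091007082526212238333029404113163935361917
      ∷ ab 1032122171936383326252930353940410807040605283432312720182423371109101312141502
      ∷ ab 1032122383326252930353619163940410807040605282720182431323409101312113723141502
      ∷ ab 1032122383635394029303326250841131619170215141211372324313234091007040605282720
      ∷ cd 1000406050120182423141516393536383330294041131211373231272834091007082526212217
      ∷ ab 1040710134108032122383635303326252940391619170215182423141211373231272834090605
      ∷ ab 1030807040605283432372324312720181514121109101341403916193635302925263338221702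
      ∷ ab 1032126250807040605282720181514121137232431323409101341402930333836353916191702
      ∷ ab 1040710134108032122383635303326252940391619170215141211373231241820272834090605
      ∷ ab 1040605283432312720181516394041131214233711091007080321223833262529303536191702
      ∷ ab 1030807040605282720181514121137232431323409101341402930353916193638332621221702
      ∷ both 1052834323127201824233711121415 121221719363833303539161341402925080710090604
      ∷ cd 1000406052834091007082526212217191639353638333029404113121137323124231415182001
      ∷ ab 1032122383635394029303326250841131619170215141211372324182027313234091007040605
      ∷ ab 1032126250807040605283432372324312720181514121109101341403916193635303338221702
      ∷ ab 1032122383326252940410807040605283432312720182423371109101312141516393536191702
      ∷ ab 1040605282720182423141211373234091007080321221719363833262529303539404113161502
      ∷ cd 1000406050120182431272834091007082526212217191639353638333029404113121137231415
      ∷ ab 1032126252930353940410807040605283432312720182423371109101312141516193638221702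
      ∷ ab 1040605282720182431323723141516394041131211091007080321223833262529303536191702
      ∷ ab 1030807040605282720181514121137232431323409101341403916193638333029252621221702
      ∷ ab 1032122383326250807040605282720181514121137232431323409101341402930353916191702
      ∷ ab 1030825293033262122383635394041131619170215182423141211091007040605283432312720
      ∷ cd 1000406050120182423141211373231272834091007082529303326212217193635394041131615
      ∷ ab 1032122383635303326252940410807040605282720182431323409101312113723141516191702
      ∷ cd 1000407100906050120181514232431272834323711121341082529303326212238363539161917
      ∷ ab 1032126333035363822171916394029250807040605282720182431323409101312113723141502
      ∷ []
  }

extensible42 : Extensible 42
extensible42 = Base.extensible plan42 14 _ _ _ _ _ _ _

plan45 : Plan 44
plan45 = record
  { rotations =
        (1 ∷ 4 ∷ 3 ∷ [])
      ∷ (0 ∷ 2 ∷ 29 ∷ 5 ∷ [])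
      ∷ (1 ∷ 3 ∷ 13 ∷ 15 ∷ [])
      ∷ (0 ∷ 8 ∷ 17 ∷ 2 ∷ [])
      ∷ (0 ∷ 6 ∷ 7 ∷ [])
      ∷ (1 ∷ 32 ∷ 6 ∷ [])
      ∷ (9 ∷ 4 ∷ 5 ∷ [])
      ∷ (10 ∷ 8 ∷ 4 ∷ [])
      ∷ (3 ∷ 7 ∷ 24 ∷ 19 ∷ [])
      ∷ (44 ∷ 11 ∷ 10 ∷ 6 ∷ [])
      ∷ (13 ∷ 23 ∷ 7 ∷ 9 ∷ [])
      ∷ (12 ∷ 9 ∷ 36 ∷ [])
      ∷ (13 ∷ 11 ∷ 14 ∷ [])
      ∷ (18 ∷ 10 ∷ 12 ∷ 2 ∷ [])
      ∷ (12 ∷ 16 ∷ 15 ∷ [])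
      ∷ (14 ∷ 21 ∷ 2 ∷ [])
      ∷ (14 ∷ 36 ∷ 35 ∷ [])
      ∷ (3 ∷ 20 ∷ 40 ∷ 18 ∷ [])
      ∷ (17 ∷ 22 ∷ 13 ∷ [])
      ∷ (26 ∷ 20 ∷ 8 ∷ [])
      ∷ (17 ∷ 19 ∷ 38 ∷ [])
      ∷ (15 ∷ 35 ∷ 29 ∷ [])
      ∷ (18 ∷ 41 ∷ 23 ∷ [])
      ∷ (10 ∷ 22 ∷ 43 ∷ 24 ∷ [])
      ∷ (23 ∷ 25 ∷ 8 ∷ [])
      ∷ (24 ∷ 27 ∷ 26 ∷ [])
      ∷ (25 ∷ 30 ∷ 19 ∷ [])
      ∷ (25 ∷ 43 ∷ 28 ∷ [])
      ∷ (30 ∷ 27 ∷ 33 ∷ [])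
      ∷ (1 ∷ 21 ∷ 31 ∷ [])
      ∷ (26 ∷ 28 ∷ 38 ∷ [])
      ∷ (39 ∷ 32 ∷ 29 ∷ [])
      ∷ (31 ∷ 44 ∷ 5 ∷ [])
      ∷ (34 ∷ 28 ∷ 42 ∷ [])
      ∷ (38 ∷ 33 ∷ 40 ∷ [])
      ∷ (21 ∷ 16 ∷ 39 ∷ [])
      ∷ (37 ∷ 16 ∷ 11 ∷ [])
      ∷ (39 ∷ 36 ∷ 44 ∷ [])
      ∷ (30 ∷ 34 ∷ 20 ∷ [])
      ∷ (35 ∷ 37 ∷ 31 ∷ [])
      ∷ (17 ∷ 34 ∷ 41 ∷ [])
      ∷ (42 ∷ 22 ∷ 40 ∷ [])
      ∷ (33 ∷ 43 ∷ 41 ∷ [])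
      ∷ (23 ∷ 42 ∷ 27 ∷ [])
      ∷ (32 ∷ 37 ∷ 9 ∷ [])
      ∷ []
  ; near₁ = 0 ∷ 4 ∷ 6 ∷ [] ; near₁-last = 5
  ; opposite = 2 ∷ 13 ∷ 18 ∷ [] ; opposite-last = 17
  ; near₂ = 0 ∷ 3 ∷ 8 ∷ 7 ∷ 4 ∷ []
  ; near₃ = 4 ∷ 7 ∷ 10 ∷ 9 ∷ 6 ∷ []
  ; merged = 1 ∷ 0 ∷ 3 ∷ 8 ∷ 7 ∷ 10 ∷ 9 ∷ 6 ∷ 5 ∷ []
  ; others =
        (1 ∷ 29 ∷ 21 ∷ 15 ∷ 2 ∷ [])
      ∷ (1 ∷ 5 ∷ 32 ∷ 31 ∷ 29 ∷ [])
      ∷ (2 ∷ 15 ∷ 14 ∷ 12 ∷ 13 ∷ [])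
      ∷ (3 ∷ 17 ∷ 20 ∷ 19 ∷ 8 ∷ [])
      ∷ (5 ∷ 6 ∷ 9 ∷ 44 ∷ 32 ∷ [])
      ∷ (7 ∷ 8 ∷ 24 ∷ 23 ∷ 10 ∷ [])
      ∷ (8 ∷ 19 ∷ 26 ∷ 25 ∷ 24 ∷ [])
      ∷ (9 ∷ 11 ∷ 36 ∷ 37 ∷ 44 ∷ [])
      ∷ (9 ∷ 10 ∷ 13 ∷ 12 ∷ 11 ∷ [])
      ∷ (10 ∷ 23 ∷ 22 ∷ 18 ∷ 13 ∷ [])
      ∷ (11 ∷ 12 ∷ 14 ∷ 16 ∷ 36 ∷ [])
      ∷ (14 ∷ 15 ∷ 21 ∷ 35 ∷ 16 ∷ [])
      ∷ (16 ∷ 35 ∷ 39 ∷ 37 ∷ 36 ∷ [])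
      ∷ (17 ∷ 40 ∷ 34 ∷ 38 ∷ 20 ∷ [])
      ∷ (17 ∷ 18 ∷ 22 ∷ 41 ∷ 40 ∷ [])
      ∷ (19 ∷ 20 ∷ 38 ∷ 30 ∷ 26 ∷ [])
      ∷ (21 ∷ 29 ∷ 31 ∷ 39 ∷ 35 ∷ [])
      ∷ (22 ∷ 23 ∷ 43 ∷ 42 ∷ 41 ∷ [])
      ∷ (23 ∷ 24 ∷ 25 ∷ 27 ∷ 43 ∷ [])
      ∷ (25 ∷ 26 ∷ 30 ∷ 28 ∷ 27 ∷ [])
      ∷ (27 ∷ 28 ∷ 33 ∷ 42 ∷ 43 ∷ [])
      ∷ (28 ∷ 30 ∷ 38 ∷ 34 ∷ 33 ∷ [])
      ∷ (31 ∷ 32 ∷ 44 ∷ 37 ∷ 39 ∷ [])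
      ∷ (33 ∷ 34 ∷ 40 ∷ 41 ∷ 42 ∷ [])
      ∷ []
  ; routes =
        cd 1081920174034383026252423432728334241221813121416353931324437361109100704060501292115
      ∷ cd 1000406053231292115141211361635393744091007081920383026252423224142432728333440171813
      ∷ ab 1031740414243272526302833343820190824232218131007040609443739351636111214152129313205
      ∷ ab 1040708242322414034383028334243272526192017181310090605324437393129213516361112141502
      ∷ ab 1
      ∷ cd 1000406091007081920383026252423224142432728333440171813121136161415213539374432312901
      ∷ cd 1000407081920383026252423224142432728333440171813100911121415212931393516363744320501
      ∷ ab 1040605324437393129213516361109102324252630282743423334382019080317404122181312141502
      ∷ both 1050609113616353937443231292115141213 117182241403433424327283038201926252423100704
      ∷ ab 1031740414243272526302833343820190824232218131007040605324437393129213516361112141502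
      ∷ cd 1000407081920383026252423224142432728333440171813121109060501292135393132443736161415
      ∷ ab 1040708031718224140343342432728303820192625242310090605324437361635393129211514121302
      ∷ ab 1030819201740343830262524234327283342412218131007040605323129213539374409113616141502
      ∷ ab 1040708031718224140343342432728303820192625242310090605324437393129213516361112141502
      ∷ ab 1040710232241403433424327283038201926252408031718131211361635393744090605323129211502
      ∷ cd 1000406050129213516141211363739313244091007081920383026252423224142432728333440171813
      ∷ ab 1040710232241403433424327283038201926252408031718130215141211363739352129313244090605
      ∷ ab 1030807040605324437393129213516361109102324252619203830282743423334404122181312141502
      ∷ ab 1031740412223242526302827434233343820190807040605324437361635393129211514121109101302
      ∷ ab 1030807040609102324252630382017403433282743424122181302152129313935161412113637443205
      ∷ both 1293132050609443739352115141636111213 117182241403438302833424327252619082423100704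
      ∷ ab 1040708031718224140343342432728303820192625242310090605324437361112130215141635393129
      ∷ cd 1000407102324081920383433283026252743424140171813121109060501292135393132443736161415
      ∷ ab 1031718224140343342432728303820192625240807040605324437361635393129211514121109101302
      ∷ ab 1031720383028333440414243272526190807040605323129211514121136163539374409102322181302
      ∷ cd 1000407102324081926302827434233343820174041221813121109060501292135393132443736161415
      ∷ ab 1031718224140343342432324252728303820190807040605324437361635393129211514121109101302
      ∷ ab 1031718222343424140343328303820192625240807040605323129211514121136163539374409101302
      ∷ ab 1030807040609102324252743423334383026192017404122181302152129313935161412113637443205
      ∷ ab 1031740412218130215213539313244373616141211091023242526302827434233343820190807040605
      ∷ ab 1031740414243272833343820192625240807040605324437393129213516361109102322181312141502
      ∷ cd 1000406053244091007081920383026252423224142432728333440171813121136373935161415212901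
      ∷ ab 1031740343328274342412218130215212931393516141211363744091023242526303820190807040605
      ∷ ab 1031718222343424140343820192630282725240807040605323129211514121136163539374409101302
      ∷ cd 1000407102324081926252743423328303820174041221813121109060501292135393132443736161415
      ∷ ab 1031740414243272526302833343820190824232218131007040605324409111214163637393129211502
      ∷ ab 1031740412218130215213516141211091023242526302827434233343820190807040605324437393129
      ∷ cd 1000406050129211514121136163539313244091007081920383026252423224142432728333440171813
      ∷ ab 1031720192630282725240807040605323129211514121136163539374409102343423334404122181302
      ∷ ab 1030819201740343830262524234327283342412218131211363744091007040605323129213516141502
      ∷ ab 1031720192630383433282725240807040605323129211514121136163539374409102343424122181302
      ∷ ab 1031740343342432728303820192625240807040605323139374409102322181302151412113616352129
      ∷ ab 1031718224140343328274323242526303820190807040605323129211514121136163539374409101302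
      ∷ ab 1040605323139374409100708031720192630383440414233282725242322181302151412113616352129
      ∷ ab 1031740343328274342412218131211091023242526303820190807040605323129213539373616141502
      ∷ []
  }

extensible45 : Extensible 45
extensible45 = Base.extensible plan45 15 _ _ _ _ _ _ _

-- The orders reached

from36 : ∀ k → Extensible (k * 4 + 36)
from36 zero    = extensible36
from36 (suc k) = extension (from36 k)

-- The orders 42 and 45 are base graphs, 43 is one operation above 39, and 44 is two above 36. These
-- four consecutive orders start the induction in steps of four.
from42 : ∀ k → Extensible (k + 42)
from42 0 = extensible42
from42 1 = extension extensible39
from42 2 = extension (extension extensible36)
from42 3 = extensible45
from42 (suc (suc (suc (suc k)))) = extension (from42 k)

theorem3p15 : (n : ℕ) → ((∃[ k ] (n ≡ 36 + 4 * k)) ⊎ 73 ≤ n) →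
    Σ (Graph n) (λ G → Σ (Fin n) (λ w →
    Connected G × Planar G × AlmostHypohamiltonianWith G w × degree G w ≡ 3))
theorem3p15 n (inj₁ (k , refl)) =
  subst Witness (trans (+-comm (k * 4) 36) (cong (36 +_) (*-comm k 4))) (witness (from36 k))
theorem3p15 n (inj₂ 73≤n) =
  -- The number 31 is the distance from 42 to the bound 73.
  subst Witness (m∸n+n≡m (≤-trans (m≤m+n 42 31) 73≤n)) (witness (from42 (n ∸ 42)))
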